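{- Let $q$ be a prime power that is a square and let $k=3t$ with $t\ge1$ an integer. The code $\mathcal{D}_{k,q}$ defined in the context is a minimal $\left[(q+\sqrt q+1)\frac{2k^2}{9},\,k,\,d\right]_q$ code, where $d\ge q\left(\frac43k-2\right)$.
   Context: Codes: for $v\in\mathbb{F}_q^n$ the support is $\sigma(v)=\{i: v_i\neq0\}$ and the weight is $\omega(v)=|\sigma(v)|$. An $[n,k,d]_q$ code is a $k$-dimensional $\mathbb{F}_q$-linear subspace of $\mathbb{F}_q^n$ whose nonzero codewords have minimum weight $d$. A nonzero codeword $c\in\mathcal{C}$ is minimal if every $c'\in\mathcal{C}$ with $\sigma(c')\subseteq\sigma(c)$ is a scalar multiple of $c$; the code is minimal if all its nonzero codewords are minimal. Construction of $\mathcal{D}_{k,q}$: let $\gamma$ be a primitive element of $\mathbb{F}_{q^3}$ (a generator of $\mathbb{F}_{q^3}^*$), let $M\in\mathbb{F}_q^{3\times3}$ be the companion matrix of its minimal polynomial over $\mathbb{F}_q$, and let $\phi:\mathbb{F}_{q^3}\to\mathbb{F}_q[M]$ be the $\mathbb{F}_q$-algebra isomorphism with $\phi(\gamma)=M$. For a point $P=[(v_1,\dots,v_t)]\in\mathrm{PG}(t-1,q^3)$ let $\bar\varphi(P)\subseteq\mathbb{F}_q^{3t}$ be the $\mathbb{F}_q$-row space of the $3\times3t$ matrix $(\phi(v_1)\mid\cdots\mid\phi(v_t))$; this is a 3-dimensional subspace (independent of the representative), i.e. a plane of $\mathrm{PG}(k-1,q)$. With $e_1,\dots,e_t$ the standard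 basis of $\mathbb{F}_{q^3}^t$, put $P_\ell=[e_\ell]$ and $Q_{\ell,m,i}=[e_\ell+\gamma^ie_m]$ for $1\le\ell<m\le t$. For every pair $1\le\ell<m\le t$ choose $i_{\ell,m},j_{\ell,m}\in\{1,\dots,q^3-1\}$ with $j_{\ell,m}-i_{\ell,m}\not\equiv0\bmod(q^2+q+1)$. The $t^2$ planes $\bar\varphi(P_\ell)$ $(1\le\ell\le t)$, $\bar\varphi(Q_{\ell,m,i_{\ell,m}})$ and $\bar\varphi(Q_{\ell,m,j_{\ell,m}})$ $(1\le\ell<m\le t)$ of $\mathrm{PG}(k-1,q)$ are pairwise disjoint. In each of these planes choose two disjoint Baer subplanes (a Baer subplane of $\mathrm{PG}(2,q)$ is a subgeometry isomorphic to $\mathrm{PG}(2,\sqrt q)$). $\mathcal{D}_{k,q}$ is the code generated by a matrix with $k$ rows whose columns are vector representatives (one for each point) of all the points in the union of these $2t^2$ Baer subplanes. -}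

module Defs where

open import Algebra.Apartness.Bundles using (HeytingField; HeytingCommutativeRing)
open import Algebra.Bundles using (CommutativeRing)
open import Algebra.Bundles.Raw using (RawRing)
open import Algebra.Definitions.RawSemiring using () renaming (_^_ to pow)
open import Algebra.Morphism.Structures using (module RingMorphisms)
open import Data.Bool.Base using (if_then_else_; not)
open import Data.Empty using (⊥)
open import Data.Fin.Base as Fin using (Fin)
open import Data.Fin.Patterns using (0F; 1F; 2F)
import Data.Fin.Properties as Fin
open import Data.Fin.Subset using (Subset; ∣_∣; _⊆_)
import Data.Integer.Base as ℤ
import Data.Integer.Divisibility as ℤ
open import Data.Nat.Base as ℕ using (ℕ; _≤_)
open import Data.Nat.Primality using (Prime)
open import Data.Product using (Σ; ∃; ∃₂; _×_; _,_; proj₁)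
import Data.Vec.Base as Vec
open import Data.Vec.Functional using (Vector; _∷_; []; concat; transpose)
import Data.Vec.Functional.Relation.Binary.Equality.Setoid as VecEq
open import Function.Base using (_∘_)
open import Function.Bundles using (Inverse; _⇔_)
open import Function.Definitions using (Congruent; Injective)
open import Function.Properties.Inverse using (Inverse⇒Injection)
open import Level using (Level; _⊔_; suc)
open import Relation.Binary.Core using (Rel)
open import Relation.Binary.Definitions using (Decidable; _Respects_)
open import Relation.Binary.PropositionalEquality.Core using (_≡_)
import Relation.Binary.PropositionalEquality.Properties as ≡
open import Relation.Nullary using (¬_; does)
open import Relation.Nullary.Decidable using (via-injection)
open import Relation.Unary using (Pred; _∈_)
import Relation.Unary as Unary

IsPrimePower : ℕ → Set
IsPrimePower q = ∃₂ λ p e → Prime p × 1 ≤ e × q ≡ p ℕ.^ e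

-- The enumeration makes equality and invertibility decidable, so that the
-- apartness of the Heyting field coincides with _≉_.
record FiniteField (q : ℕ) (c ℓ : Level) : Set (suc (c ⊔ ℓ)) where
  field
    heytingField : HeytingField c ℓ ℓ

  open HeytingField heytingField public hiding (heytingCommutativeRing)

  commutativeRing : CommutativeRing c ℓ
  commutativeRing = HeytingCommutativeRing.commutativeRing
    (HeytingField.heytingCommutativeRing heytingField)

  open CommutativeRing commutativeRing public using (rawRing; _≉_)

  field
    enumeration : Inverse setoid (≡.setoid (Fin q))

  infix 4 _≟_
  _≟_ : Decidable _≈_
  _≟_ = via-injection (Inverse⇒Injection enumeration) Fin._≟_

  infixr 8 _^_
  _^_ : Carrier → ℕ → Carrier
  _^_ = pow (RawRing.rawSemiring rawRing)

module LinearAlgebra {q c ℓ} (F : FiniteField q c ℓ) where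
  open FiniteField F
  open import Algebra.Definitions.RawMonoid (RawRing.+-rawMonoid rawRing) using (sum) public
  open VecEq setoid public using (_≋_)

  infixl 6 _⊕_
  infixr 7 _•_

  0ᵛ : ∀ {n} → Vector Carrier n
  0ᵛ _ = 0#

  _⊕_ : ∀ {n} → Vector Carrier n → Vector Carrier n → Vector Carrier n
  (v ⊕ w) i = v i + w i

  _•_ : ∀ {n} → Carrier → Vector Carrier n → Vector Carrier n
  (a • v) i = a * v i

  unit : ∀ {n} → Fin n → Vector Carrier n
  unit i j = if does (i Fin.≟ j) then 1# else 0#

  -- A matrix is the vector of its rows.
  Matrix : ℕ → ℕ → Set c
  Matrix m n = Vector (Vector Carrier n) m

  combination : ∀ {m n} → Vector Carrier m → Matrix m n → Vector Carrier n
  combination x A j = sum (λ i → x i * A i j)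

  RowSpace : ∀ {m n} → Matrix m n → Pred (Vector Carrier n) (c ⊔ ℓ)
  RowSpace A v = ∃ λ x → v ≋ combination x A

  record IsSubspace {n p} (U : Pred (Vector Carrier n) p) : Set (c ⊔ ℓ ⊔ p) where
    field
      respects : U Respects _≋_
      0-closed : 0ᵛ ∈ U
      ⊕-closed : ∀ {v w} → v ∈ U → w ∈ U → v ⊕ w ∈ U
      •-closed : ∀ a {v} → v ∈ U → a • v ∈ U

  LinearlyIndependent : ∀ {m n} → Matrix m n → Set (c ⊔ ℓ)
  LinearlyIndependent b = ∀ x → combination x b ≋ 0ᵛ → x ≋ 0ᵛ

  HasDimension : ∀ {n p} → Pred (Vector Carrier n) p → ℕ → Set (c ⊔ ℓ ⊔ p)
  HasDimension {n} U k = Σ (Matrix k n) λ b →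
    LinearlyIndependent b × (∀ v → v ∈ U ⇔ v ∈ RowSpace b)

  matrixRing : ℕ → RawRing c ℓ
  matrixRing n = record
    { Carrier = Matrix n n
    ; _≈_     = λ A B → ∀ i → A i ≋ B i
    ; _+_     = λ A B i → A i ⊕ B i
    ; _*_     = λ A B i → combination (A i) B
    ; -_      = λ A i j → - A i j
    ; 0#      = λ _ → 0ᵛ
    ; 1#      = unit
    }

  -- F[M], the polynomials Σᵢ cᵢ Mⁱ in a square matrix M.
  PolynomialIn : ∀ {n} → Matrix n n → Pred (Matrix n n) (c ⊔ ℓ)
  PolynomialIn {n} M A = ∃ λ m → Σ (Vector Carrier m) λ a →
    ∀ r → A r ≋ λ s → sum (λ i → a i * pow (RawRing.rawSemiring (matrixRing n)) M (Fin.toℕ i) r s)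

  -- Companion matrix of x³ + a₂x² + a₁x + a₀, with the coefficients in the last column.
  companion : Vector Carrier 3 → Matrix 3 3
  companion a = (0# ∷ 0# ∷ - a 0F ∷ [])
              ∷ (1# ∷ 0# ∷ - a 1F ∷ [])
              ∷ (0# ∷ 1# ∷ - a 2F ∷ [])
              ∷ []

module Code {q c ℓ} (F : FiniteField q c ℓ) where
  open FiniteField F
  open LinearAlgebra F

  support : ∀ {n} → Vector Carrier n → Subset n
  support v = Vec.tabulate (λ i → not (does (v i ≟ 0#)))

  weight : ∀ {n} → Vector Carrier n → ℕ
  weight v = ∣ support v ∣

  HasMinimumWeight : ∀ {n p} → Pred (Vector Carrier n) p → ℕ → Set (c ⊔ ℓ ⊔ p)
  HasMinimumWeight C d =
    (∃ λ v → v ∈ C × ¬ (v ≋ 0ᵛ) × weight v ≡ d) ×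
    (∀ v → v ∈ C → ¬ (v ≋ 0ᵛ) → d ≤ weight v)

  record IsCode (n k d : ℕ) {p} (C : Pred (Vector Carrier n) p) : Set (c ⊔ ℓ ⊔ p) where
    field
      isSubspace    : IsSubspace C
      dimension     : HasDimension C k
      minimumWeight : HasMinimumWeight C d

  IsMinimalCodeword : ∀ {n p} → Pred (Vector Carrier n) p → Vector Carrier n → Set (c ⊔ ℓ ⊔ p)
  IsMinimalCodeword C v = ∀ w → w ∈ C → support w ⊆ support v → ∃ λ a → w ≋ a • v

  IsMinimalCode : ∀ {n p} → Pred (Vector Carrier n) p → Set (c ⊔ ℓ ⊔ p)
  IsMinimalCode C = ∀ v → v ∈ C → ¬ (v ≋ 0ᵛ) → IsMinimalCodeword C v

module Projective {q c ℓ} (F : FiniteField q c ℓ) where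
  open FiniteField F
  open LinearAlgebra F

  infix 4 _∼_

  -- Points of PG(n-1,q): nonzero vectors of F_qⁿ, identified by _∼_.
  Point : ℕ → Set (c ⊔ ℓ)
  Point n = Σ (Vector Carrier n) λ v → ¬ (v ≋ 0ᵛ)

  _∼_ : ∀ {n} → Rel (Point n) (c ⊔ ℓ)
  (v , _) ∼ (w , _) = ∃ λ a → v ≋ a • w

  OnLine : ∀ {n} → Point n → Point n → Pred (Point n) (c ⊔ ℓ)
  OnLine (a , _) (b , _) (v , _) = ∃₂ λ x y → v ≋ x • a ⊕ y • b

  Collinear : ∀ {n} → Point n → Point n → Point n → Set (c ⊔ ℓ)
  Collinear x y z = ∃₂ λ a b →
    ¬ (a ∼ b) × x ∈ OnLine a b × y ∈ OnLine a b × z ∈ OnLine a b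

module _ {q s c ℓ c₀ ℓ₀} (F : FiniteField q c ℓ) (F₀ : FiniteField s c₀ ℓ₀) where
  private
    module F = FiniteField F
    module P = Projective F
    module P₀ = Projective F₀

  -- For F₀ of order √q: B is a Baer subplane of the plane of PG(k-1,q) given by
  -- the vector subspace π, that is, a set of points of π which, with the
  -- collinearity induced from PG(k-1,q), is isomorphic to PG(2,√q).
  record IsBaerSubplane {k p b} (π : Pred (Vector F.Carrier k) p) (B : Pred (P.Point k) b)
      : Set (c ⊔ ℓ ⊔ c₀ ⊔ ℓ₀ ⊔ p ⊔ b) where
    field
      respects    : B Respects P._∼_
      in-plane    : ∀ {x} → x ∈ B → proj₁ x ∈ π
      iso         : P₀.Point 3 → P.Point k
      congruent   : Congruent P₀._∼_ P._∼_ iso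
      injective   : Injective P₀._∼_ P._∼_ iso
      image       : ∀ y → y ∈ B ⇔ (∃ λ x → y P.∼ iso x)
      collinear   : ∀ x y z → P₀.Collinear x y z ⇔ P.Collinear (iso x) (iso y) (iso z)

data PlaneIndex (t : ℕ) : Set where
  P     : Fin t → PlaneIndex t
  Qᵢ Qⱼ : (l m : Fin t) → l Fin.< m → PlaneIndex t

module _ {r c ℓ} (K : FiniteField r c ℓ) where
  open FiniteField K
  open LinearAlgebra K

  -- Vectors representing the points P_l = [e_l] and Q_{l,m,h} = [e_l + γʰ e_m],
  -- for h = i_{l,m} and h = j_{l,m}.
  representative : ∀ {t} → Carrier → (i j : Fin t → Fin t → ℕ) →
                   PlaneIndex t → Vector Carrier t
  representative γ i j (P l)      = unit l
  representative γ i j (Qᵢ l m _) = unit l ⊕ γ ^ i l m • unit m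
  representative γ i j (Qⱼ l m _) = unit l ⊕ γ ^ j l m • unit m

module FieldExtension {q r c ℓ c′ ℓ′} (F : FiniteField q c ℓ) (K : FiniteField r c′ ℓ′)
    (ι : FiniteField.Carrier F → FiniteField.Carrier K) where
  private
    module F = FiniteField F
    module K = FiniteField K
    module LF = LinearAlgebra F
    module LK = LinearAlgebra K

  IsPrimitive : K.Carrier → Set (c′ ⊔ ℓ′)
  IsPrimitive γ = γ K.≉ K.0# × (∀ x → x K.≉ K.0# → ∃ λ n → x K.≈ γ K.^ n)

  -- A vector a of length n stands for the monic polynomial xⁿ + Σᵢ aᵢxⁱ over F.
  IsRoot : K.Carrier → ∀ {n} → Vector F.Carrier n → Set ℓ′
  IsRoot γ {n} a = γ K.^ n K.+ LK.sum (λ i → ι (a i) K.* γ K.^ Fin.toℕ i) K.≈ K.0#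

  IsMinimalPolynomial : K.Carrier → ∀ {n} → Vector F.Carrier n → Set (c ⊔ ℓ′)
  IsMinimalPolynomial γ {n} a =
    IsRoot γ a × (∀ m (b : Vector F.Carrier m) → IsRoot γ b → n ≤ m)

  -- φ is an isomorphism of F-algebras from K onto F[M].
  record IsAlgebraIsomorphism {n} (M : LF.Matrix n n) (φ : K.Carrier → LF.Matrix n n)
      : Set (c ⊔ ℓ ⊔ c′ ⊔ ℓ′) where
    open RingMorphisms K.rawRing (LF.matrixRing n) using (IsRingMonomorphism)
    field
      isRingMonomorphism : IsRingMonomorphism φ
      linear : ∀ a x i → φ (ι a K.* x) i LF.≋ a LF.• φ x i
      image  : ∀ A → LF.PolynomialIn M A ⇔ (∃ λ x → ∀ i → φ x i LF.≋ A i)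

-- The choices entering the construction of 𝒟_{k,q}, with k = 3t; F, K and F₀ are
-- the fields with q, q³ and √q elements.
record Construction {q s c ℓ c′ ℓ′ c₀ ℓ₀}
    (F : FiniteField q c ℓ) (K : FiniteField (q ℕ.^ 3) c′ ℓ′) (F₀ : FiniteField s c₀ ℓ₀)
    (t : ℕ) (b : Level) : Set (c ⊔ ℓ ⊔ c′ ⊔ ℓ′ ⊔ c₀ ⊔ ℓ₀ ⊔ suc b) where
  private
    module F = FiniteField F
    module K = FiniteField K
    module LF = LinearAlgebra F
  open Projective F

  field
    ι     : F.Carrier → K.Carrier
    ι-isRingMonomorphism : RingMorphisms.IsRingMonomorphism F.rawRing K.rawRing ι

  open FieldExtension F K ι

  field
    γ             : K.Carrier
    γ-primitive   : IsPrimitive γ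
    minpoly       : Vector F.Carrier 3
    minpoly-γ     : IsMinimalPolynomial γ minpoly

  M : LF.Matrix 3 3
  M = LF.companion minpoly

  field
    φ       : K.Carrier → LF.Matrix 3 3
    φ-iso   : IsAlgebraIsomorphism M φ
    φ-γ     : ∀ i → φ γ i LF.≋ M i

  φ̄ : Vector K.Carrier t → Pred (Vector F.Carrier (t ℕ.* 3)) (c ⊔ ℓ)
  φ̄ v = LF.RowSpace (λ r → concat (λ l → φ (v l) r))

  field
    -- Only the values at l < m matter.
    i j      : Fin t → Fin t → ℕ
    i-range  : ∀ l m → l Fin.< m → 1 ≤ i l m × i l m ≤ q ℕ.^ 3 ℕ.∸ 1
    j-range  : ∀ l m → l Fin.< m → 1 ≤ j l m × j l m ≤ q ℕ.^ 3 ℕ.∸ 1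
    i-j      : ∀ l m → l Fin.< m →
               ¬ (ℤ.+ (q ℕ.^ 2 ℕ.+ q ℕ.+ 1) ℤ.∣ (ℤ.+ j l m ℤ.- ℤ.+ i l m))

  point : PlaneIndex t → Vector K.Carrier t
  point = representative K γ i j

  field
    B₁ B₂    : PlaneIndex t → Pred (Point (t ℕ.* 3)) b
    B₁-baer  : ∀ x → IsBaerSubplane F F₀ (φ̄ (point x)) (B₁ x)
    B₂-baer  : ∀ x → IsBaerSubplane F F₀ (φ̄ (point x)) (B₂ x)
    disjoint : ∀ x {y} → y ∈ B₁ x → y ∈ B₂ x → ⊥

  Union : Pred (Point (t ℕ.* 3)) b
  Union y = ∃ λ x → y ∈ (B₁ x Unary.∪ B₂ x)

  field
    n          : ℕ
    column     : Fin n → Point (t ℕ.* 3)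
    column-∈   : ∀ x → column x ∈ Union
    column-inj : ∀ {x y} → column x ∼ column y → x ≡ y
    column-sur : ∀ {y} → y ∈ Union → ∃ λ x → y ∼ column x

  𝒟 : Pred (Vector F.Carrier n) (c ⊔ ℓ)
  𝒟 = LF.RowSpace (transpose (proj₁ ∘ column))

{-# OPTIONS --safe #-}

-- Restrict a functional u on F³ᵗ, with blocks u₁, …, uₜ in F³, to the plane φ̄ v: in the
-- coordinates of the plane this is the vector Σₗ vₗuₗ of F³, where K acts on F³ through φ.
-- A line of PG(2,q) meets every Baer subplane and misses at least q of its points.  Hence
-- a functional w vanishing wherever u does on the two disjoint subplanes of a plane is
-- proportional to u on that plane.  On P_l this says wₗ = aₗuₗ with aₗ in F; if aₗ ≠ aₘ and
-- uₗ, uₘ ≠ 0, the planes Q_{l,m,i} and Q_{l,m,j} make both γⁱuₘ and γʲuₘ proportional to uₗ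
-- over F, so γʲ⁻ⁱ lies in F and q² + q + 1 divides j - i, which is excluded.  For the
-- distance, if uₗ ≠ 0 then u is nonzero on P_l and, for each m ≠ l, on at least two of the
-- three planes P_m, Q_{l,m,i}, Q_{l,m,j}: in all 2t - 1 planes with 2q nonzero entries each.
module Submission where

open import Defs
open import Algebra.Bundles using (CommutativeRing)
open import Algebra.Morphism.Structures using (module RingMorphisms)
open import Algebra.Solver.Ring.AlmostCommutativeRing
  using (AlmostCommutativeRing; fromCommutativeRing; _-Raw-AlmostCommutative⟶_)
open import Data.Bool.Base using (true; false; not)
open import Data.Empty using (⊥; ⊥-elim)
open import Data.Fin.Base as Fin using (Fin; zero; suc)
open import Data.Fin.Patterns using (0F; 1F; 2F)
import Data.Fin.Properties as Fin
open import Data.Fin.Subset using (Subset; inside; outside; ∣_∣) renaming (_∈_ to _∈ₛ_)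
open import Data.Integer.Base as ℤ using (ℤ; +_; -[1+_])
import Data.Integer.Divisibility as ℤ
import Data.Integer.Properties as ℤ
open import Data.Maybe.Base as Maybe using (Maybe)
open import Data.Nat.Base as ℕ using (ℕ; zero; suc; z≤n; s≤s)
import Data.Nat.Divisibility as ℕ
import Data.Nat.DivMod as ℕ
import Data.Nat.Properties as ℕ
open import Data.Nat.Tactic.RingSolver using (solve-∀)
open import Data.Product using (∃; ∃₂; _×_; _,_; proj₁; proj₂)
open import Data.Product.Function.NonDependent.Propositional using (_×-↔_)
open import Data.Sum.Base using (_⊎_; inj₁; inj₂; [_,_])
open import Data.Sum.Function.Propositional using (_⊎-↔_)
open import Data.Vec.Base as Vec using (here; there)
import Data.Vec.Properties as Vec
open import Data.Vec.Functional using (Vector; _∷_; []; concat; transpose)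
open import Function.Base using (_∘_; id; case_of_)
open import Function.Bundles using (Inverse; _↔_; mk↔ₛ′; Equivalence; mk⇔)
open import Function.Construct.Composition using (_↔-∘_)
open import Function.Definitions using (Injective)
open import Level using (Level; _⊔_)
open import Relation.Binary.Definitions using (tri<; tri≈; tri>)
open import Relation.Binary.PropositionalEquality as ≡ using (_≡_; _≢_; refl)
open import Relation.Nullary using (¬_; Dec; yes; no; does; contradiction)
import Relation.Nullary.Decidable as Dec
open import Relation.Unary using (Pred; _∈_)
import Relation.Unary as Unary

-- A Baer subplane is given only by a map from PG(2,√q) that preserves and reflects equality and
-- collinearity of points: no semilinear map and no inclusion of F₀ in F is at hand. All geometry of
-- a subplane is therefore carried by one predicate, the vanishing of a 3 × 3 determinant, to which
-- collinearity is reduced on both sides. The q missed points come from it as well: the subplane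
-- points on a line of PG(2,q) lie on a single line of the subplane, and deleting that line leaves
-- an affine plane of order √q. The number q² + q + 1 enters as the index of F* in K*: if N > 0 is
-- least with γᴺ in F, counting K gives q³ - 1 = N(q - 1). Length and distance are counts of
-- columns, so a column has to determine its plane, its subplane and its point of PG(2,√q); for this
-- the planes are proved pairwise disjoint, from the supports of their representatives and from γⁱ ≠
-- γʲ. The constant of the distance is 2q(2t - 1) = q(4k/3 - 2) for k = 3t.

-- Least witnesses and counting by injections

least : ∀ {p} {P : Pred ℕ p} → Unary.Decidable P →
        ∀ n → P n → ∃ λ m → P m × (∀ k → P k → m ℕ.≤ k)
least P? n Pn with P? 0
... | yes P0 = 0 , P0 , λ _ _ → z≤n
least P? zero    Pn | no ¬P0 = contradiction Pn ¬P0
least P? (suc n) Pn | no ¬P0 with least (P? ∘ suc) n Pn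
... | m , Pm , min = suc m , Pm , λ where
  zero    P0 → contradiction P0 ¬P0
  (suc k) Pk → s≤s (min k Pk)

↔-to-injective : ∀ {a b} {A : Set a} {B : Set b} (e : A ↔ B) → ∀ x y →
                 Inverse.to e x ≡ Inverse.to e y → x ≡ y
↔-to-injective e x y eq = ≡.trans (≡.sym (Inverse.strictlyInverseʳ e x))
  (≡.trans (≡.cong (Inverse.from e) eq) (Inverse.strictlyInverseʳ e y))

↔-from-injective : ∀ {a b} {A : Set a} {B : Set b} (e : A ↔ B) → ∀ x y →
                   Inverse.from e x ≡ Inverse.from e y → x ≡ y
↔-from-injective e x y eq = ≡.trans (≡.sym (Inverse.strictlyInverseˡ e x))
  (≡.trans (≡.cong (Inverse.to e) eq) (Inverse.strictlyInverseˡ e y))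

↔-injective⇒≤ : ∀ {m n a} {A : Set a} → Fin m ↔ A → (f : A → Fin n) →
                Injective _≡_ _≡_ f → m ℕ.≤ n
↔-injective⇒≤ e f f-inj = Fin.injective⇒≤ {f = f ∘ Inverse.to e} λ eq →
  ↔-to-injective e _ _ (f-inj eq)

↔-injective⇒≥ : ∀ {m n a} {A : Set a} → Fin m ↔ A → (f : Fin n → A) →
                Injective _≡_ _≡_ f → n ℕ.≤ m
↔-injective⇒≥ e f f-inj = Fin.injective⇒≤ {f = Inverse.from e ∘ f} λ eq →
  f-inj (↔-from-injective e _ _ eq)

private
  -- Numbers the members of `p` in increasing order, which turns an injection into `p` into one
  -- between finite types; weights are bounded below in this way.
  rank : ∀ {n} (p : Subset n) {x} → x ∈ₛ p → Fin ∣ p ∣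
  rank (inside  Vec.∷ p) here        = zero
  rank (inside  Vec.∷ p) (there x∈p) = suc (rank p x∈p)
  rank (outside Vec.∷ p) (there x∈p) = rank p x∈p

  rank-injective : ∀ {n} (p : Subset n) {x y} (x∈p : x ∈ₛ p) (y∈p : y ∈ₛ p) →
                   rank p x∈p ≡ rank p y∈p → x ≡ y
  rank-injective (inside  Vec.∷ p) here        here        eq = refl
  rank-injective (inside  Vec.∷ p) (there x∈p) (there y∈p) eq =
    ≡.cong suc (rank-injective p x∈p y∈p (Fin.suc-injective eq))
  rank-injective (outside Vec.∷ p) (there x∈p) (there y∈p) eq =
    ≡.cong suc (rank-injective p x∈p y∈p eq)

injection⇒≤∣p∣ : ∀ {m n a} {A : Set a} (p : Subset n) → Fin m ↔ A → (f : A → Fin n) →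
                 Injective _≡_ _≡_ f → (∀ x → f x ∈ₛ p) → m ℕ.≤ ∣ p ∣
injection⇒≤∣p∣ p e f f-inj f-in = ↔-injective⇒≤ e (λ x → rank p (f-in x)) λ eq →
  f-inj (rank-injective p (f-in _) (f-in _) eq)

-- Arithmetic of a finite field

module FieldProperties {q c ℓ} (F : FiniteField q c ℓ) where
  open FiniteField F public hiding (refl; sym; trans; reflexive; zero)
  open CommutativeRing commutativeRing public
    using (semiring; ring; +-abelianGroup)
  module ≈ = CommutativeRing commutativeRing using (refl; sym; trans; reflexive)
  open import Algebra.Properties.Ring ring public
    using (-‿distribˡ-*; -‿distribʳ-*; -1*x≈-x)
  open import Algebra.Properties.AbelianGroup +-abelianGroup public
    using () renaming (∙-cancelˡ to +-cancelˡ; ⁻¹-∙-comm to -‿+-comm; ⁻¹-involutive to -‿involutive;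
                       ε⁻¹≈ε to -0#≈0#; x∙y⁻¹≈ε⇒x≈y to x-y≈0⇒x≈y; x≈y⇒x∙y⁻¹≈ε to x≈y⇒x-y≈0)
  open import Algebra.Properties.Semiring.Mult semiring
    using (×-homo-+; ×1-homo-*) renaming (_×_ to _×#_)
  open import Relation.Binary.Reasoning.Setoid setoid

  private
    -- The canonical map from the integers, which serve as coefficients of the ring solver: their
    -- equality computes, as it does not in an abstract field, so cancelling terms disappear.
    ⟦_⟧ : ℤ → Carrier
    ⟦ + n ⟧      = n ×# 1#
    ⟦ -[1+ n ] ⟧ = - (suc n ×# 1#)

    ⟦⟧-⊖ : ∀ m n → ⟦ m ℤ.⊖ n ⟧ ≈ m ×# 1# + - (n ×# 1#)
    ⟦⟧-⊖ zero    zero    = ≈.sym (-‿inverseʳ 0#)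
    ⟦⟧-⊖ zero    (suc n) = ≈.sym (+-identityˡ _)
    ⟦⟧-⊖ (suc m) zero    = ≈.sym (≈.trans (+-congˡ -0#≈0#) (+-identityʳ _))
    ⟦⟧-⊖ (suc m) (suc n) = begin
      ⟦ suc m ℤ.⊖ suc n ⟧                       ≡⟨ ≡.cong ⟦_⟧ (ℤ.[1+m]⊖[1+n]≡m⊖n m n) ⟩
      ⟦ m ℤ.⊖ n ⟧                               ≈⟨ ⟦⟧-⊖ m n ⟩
      m ×# 1# + - (n ×# 1#)                       ≈⟨ +-congʳ (≈.sym (+-identityˡ _)) ⟩
      0# + m ×# 1# + - (n ×# 1#)                  ≈⟨ +-congʳ (+-congʳ (-‿inverseʳ 1#)) ⟨
      1# + - 1# + m ×# 1# + - (n ×# 1#)           ≈⟨ +-congʳ (+-assoc _ _ _) ⟩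
      1# + (- 1# + m ×# 1#) + - (n ×# 1#)         ≈⟨ +-congʳ (+-congˡ (+-comm _ _)) ⟩
      1# + (m ×# 1# + - 1#) + - (n ×# 1#)         ≈⟨ +-congʳ (+-assoc _ _ _) ⟨
      suc m ×# 1# + - 1# + - (n ×# 1#)            ≈⟨ +-assoc _ _ _ ⟩
      suc m ×# 1# + (- 1# + - (n ×# 1#))          ≈⟨ +-congˡ (-‿+-comm _ _) ⟩
      suc m ×# 1# + - (suc n ×# 1#)               ∎

    ⟦⟧-+ : ∀ i j → ⟦ i ℤ.+ j ⟧ ≈ ⟦ i ⟧ + ⟦ j ⟧
    ⟦⟧-+ (+ m)    (+ n)    = ×-homo-+ 1# m n
    ⟦⟧-+ (+ m)    -[1+ n ] = ⟦⟧-⊖ m (suc n)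
    ⟦⟧-+ -[1+ m ] (+ n)    = ≈.trans (⟦⟧-⊖ n (suc m)) (+-comm _ _)
    ⟦⟧-+ -[1+ m ] -[1+ n ] = begin
      - (suc (suc (m ℕ.+ n)) ×# 1#)       ≡⟨ ≡.cong (λ k → - (suc k ×# 1#)) (≡.sym (ℕ.+-suc m n)) ⟩
      - ((suc m ℕ.+ suc n) ×# 1#)         ≈⟨ -‿cong (×-homo-+ 1# (suc m) (suc n)) ⟩
      - (suc m ×# 1# + suc n ×# 1#)        ≈⟨ -‿+-comm _ _ ⟨
      - (suc m ×# 1#) + - (suc n ×# 1#)    ∎

    ⟦⟧-neg : ∀ i → ⟦ ℤ.- i ⟧ ≈ - ⟦ i ⟧
    ⟦⟧-neg (+ zero)  = ≈.sym -0#≈0#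
    ⟦⟧-neg (+ suc n) = ≈.refl
    ⟦⟧-neg -[1+ n ]  = ≈.sym (-‿involutive _)

    ⟦⟧-*ˡ : ∀ m j → ⟦ + m ℤ.* j ⟧ ≈ ⟦ + m ⟧ * ⟦ j ⟧
    ⟦⟧-*ˡ m (+ n)    = ≈.trans (≈.reflexive (≡.cong ⟦_⟧ (≡.sym (ℤ.pos-* m n)))) (×1-homo-* m n)
    ⟦⟧-*ˡ m -[1+ n ] = begin
      ⟦ + m ℤ.* -[1+ n ] ⟧        ≡⟨ ≡.cong ⟦_⟧ (ℤ.neg-distribʳ-* (+ m) (+ suc n)) ⟨
      ⟦ ℤ.- (+ m ℤ.* + suc n) ⟧   ≈⟨ ⟦⟧-neg (+ m ℤ.* + suc n) ⟩
      - ⟦ + m ℤ.* + suc n ⟧       ≈⟨ -‿cong (⟦⟧-*ˡ m (+ suc n)) ⟩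
      - (⟦ + m ⟧ * ⟦ + suc n ⟧)   ≈⟨ -‿distribʳ-* _ _ ⟩
      ⟦ + m ⟧ * ⟦ -[1+ n ] ⟧      ∎

    ⟦⟧-* : ∀ i j → ⟦ i ℤ.* j ⟧ ≈ ⟦ i ⟧ * ⟦ j ⟧
    ⟦⟧-* (+ m)    j = ⟦⟧-*ˡ m j
    ⟦⟧-* -[1+ m ] j = begin
      ⟦ -[1+ m ] ℤ.* j ⟧       ≡⟨ ≡.cong ⟦_⟧ (ℤ.neg-distribˡ-* (+ suc m) j) ⟨
      ⟦ ℤ.- (+ suc m ℤ.* j) ⟧  ≈⟨ ⟦⟧-neg (+ suc m ℤ.* j) ⟩
      - ⟦ + suc m ℤ.* j ⟧      ≈⟨ -‿cong (⟦⟧-*ˡ (suc m) j) ⟩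
      - (⟦ + suc m ⟧ * ⟦ j ⟧)  ≈⟨ -‿distribˡ-* _ _ ⟩
      ⟦ -[1+ m ] ⟧ * ⟦ j ⟧     ∎

    almostCommutativeRing : AlmostCommutativeRing c ℓ
    almostCommutativeRing = fromCommutativeRing commutativeRing

    morphism : ℤ.+-*-rawRing -Raw-AlmostCommutative⟶ almostCommutativeRing
    morphism = record
      { ⟦_⟧    = ⟦_⟧
      ; +-homo = ⟦⟧-+
      ; *-homo = ⟦⟧-*
      ; -‿homo = ⟦⟧-neg
      ; 0-homo = ≈.refl
      ; 1-homo = +-identityʳ 1#
      }

  open import Algebra.Solver.Ring ℤ.+-*-rawRing almostCommutativeRing morphism
    (λ i j → Maybe.map (≈.reflexive ∘ ≡.cong ⟦_⟧) (Dec.dec⇒maybe (i ℤ.≟ j))) public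
    using (solve; con; _:=_; _:+_; _:*_; _:-_; :-_; Polynomial)

  module Enum = Inverse enumeration

  elements : Fin q → Carrier
  elements = Enum.from

  index : Carrier → Fin q
  index = Enum.to

  elements-index : ∀ x → elements (index x) ≈ x
  elements-index = Enum.strictlyInverseʳ

  elements-injective : ∀ {i j} → elements i ≈ elements j → i ≡ j
  elements-injective {i} {j} eq = ≡.trans (≡.sym (Enum.strictlyInverseˡ i))
    (≡.trans (Enum.to-cong eq) (Enum.strictlyInverseˡ j))

  abstract
    -- The field axioms invert elements apart from 0, and x ≉ 0 does not by itself yield apartness.
    -- A search through the enumeration decides invertibility; if it fails, x is not apart from 0,
    -- so tightness makes it equal to 0.
    inverse : ∀ {x} → x ≉ 0# → ∃ λ y → x * y ≈ 1#
    inverse {x} x≉0 with Fin.any? (λ i → x * elements i ≟ 1#)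
    ... | yes (i , eq) = elements i , eq
    ... | no ¬inv = contradiction (proj₁ (tight x 0#) ¬x#0) x≉0
      where
      ¬x#0 : ¬ (x # 0#)
      ¬x#0 x#0 with y , _ , xy≈1 ← #⇒invertible x#0 = ¬inv (index y , (begin
        x * elements (index y)  ≈⟨ *-congˡ (elements-index y) ⟩
        x * y                   ≈⟨ *-congʳ (≈.trans (+-congˡ -0#≈0#) (+-identityʳ x)) ⟨
        (x + - 0#) * y          ≈⟨ xy≈1 ⟩
        1#                      ∎))

  *-zero-product : ∀ {x y} → x * y ≈ 0# → x ≉ 0# → y ≈ 0#
  *-zero-product {x} {y} xy≈0 x≉0 with z , xz≈1 ← inverse x≉0 = begin
    y            ≈⟨ *-identityˡ y ⟨
    1# * y       ≈⟨ *-congʳ xz≈1 ⟨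
    x * z * y    ≈⟨ *-congʳ (*-comm x z) ⟩
    z * x * y    ≈⟨ *-assoc z x y ⟩
    z * (x * y)  ≈⟨ *-congˡ xy≈0 ⟩
    z * 0#       ≈⟨ zeroʳ z ⟩
    0#           ∎

  *-cancel : ∀ {x y z} → z ≉ 0# → x * z ≈ y * z → x ≈ y
  *-cancel {x} {y} {z} z≉0 eq = x-y≈0⇒x≈y x y (*-zero-product (begin
    z * (x + - y)      ≈⟨ solve 3 (λ x y z → z :* (x :+ :- y) := x :* z :- y :* z) ≈.refl x y z ⟩
    x * z + - (y * z)  ≈⟨ x≈y⇒x-y≈0 eq ⟩
    0#                 ∎) z≉0)

  *-≉0 : ∀ {x y} → x ≉ 0# → y ≉ 0# → x * y ≉ 0#
  *-≉0 x≉0 y≉0 xy≈0 = y≉0 (*-zero-product xy≈0 x≉0)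

  2≤q⇒1≉0 : 2 ℕ.≤ q → 1# ≉ 0#
  2≤q⇒1≉0 2≤q 1≈0 = ℕ.<⇒≱ 2≤q (Fin.injective⇒≤ {f = λ _ → zero {0}} λ {i} {j} _ →
    elements-injective (≈.trans (all-zero _) (≈.sym (all-zero _))))
    where
    all-zero : ∀ x → x ≈ 0#
    all-zero x = begin
      x       ≈⟨ *-identityˡ x ⟨
      1# * x  ≈⟨ *-congʳ 1≈0 ⟩
      0# * x  ≈⟨ zeroˡ x ⟩
      0#      ∎

-- Vectors, proportionality and the points of PG(n-1,q)

funToFin-cong : ∀ {m n} {f g : Fin m → Fin n} → (∀ i → f i ≡ g i) →
                Fin.funToFin f ≡ Fin.funToFin g
funToFin-cong {zero}  f≗g = refl
funToFin-cong {suc m} f≗g = ≡.cong₂ Fin.combine (f≗g zero) (funToFin-cong (f≗g ∘ suc))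

module VectorProperties {q c ℓ} (F : FiniteField q c ℓ) where
  open FieldProperties F
  open LinearAlgebra F
  open import Algebra.Properties.Semiring.Sum semiring public
    using (sum-cong-≋; ∑-distrib-+; ∑-comm; *-distribˡ-sum; sum-replicate-zero)
  open import Relation.Binary.Reasoning.Setoid setoid

  ≋-refl : ∀ {n} {v : Vector Carrier n} → v ≋ v
  ≋-refl i = ≈.refl

  ≋-sym : ∀ {n} {v w : Vector Carrier n} → v ≋ w → w ≋ v
  ≋-sym v≋w i = ≈.sym (v≋w i)

  ≋-trans : ∀ {n} {u v w : Vector Carrier n} → u ≋ v → v ≋ w → u ≋ w
  ≋-trans u≋v v≋w i = ≈.trans (u≋v i) (v≋w i)

  dot : ∀ {n} → Vector Carrier n → Vector Carrier n → Carrier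
  dot v w = sum (λ i → v i * w i)

  dot-cong : ∀ {n} {v v′ w w′ : Vector Carrier n} → v ≋ v′ → w ≋ w′ → dot v w ≈ dot v′ w′
  dot-cong v≋v′ w≋w′ = sum-cong-≋ λ i → *-cong (v≋v′ i) (w≋w′ i)

  dot-comm : ∀ {n} (v w : Vector Carrier n) → dot v w ≈ dot w v
  dot-comm v w = sum-cong-≋ λ i → *-comm (v i) (w i)

  dot-⊕ʳ : ∀ {n} (u v w : Vector Carrier n) → dot u (v ⊕ w) ≈ dot u v + dot u w
  dot-⊕ʳ u v w = ≈.trans (sum-cong-≋ λ i → distribˡ (u i) (v i) (w i))
    (∑-distrib-+ (λ i → u i * v i) (λ i → u i * w i))

  dot-•ʳ : ∀ {n} a (v w : Vector Carrier n) → dot v (a • w) ≈ a * dot v w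
  dot-•ʳ a v w = begin
    dot v (a • w)                   ≈⟨ sum-cong-≋ (λ i → solve 3 (λ a v w → v :* (a :* w) := a :* (v :* w)) ≈.refl a (v i) (w i)) ⟩
    sum (λ i → a * (v i * w i))     ≈⟨ *-distribˡ-sum a (λ i → v i * w i) ⟨
    a * dot v w                     ∎

  dot-⊕ˡ : ∀ {n} (u v w : Vector Carrier n) → dot (u ⊕ v) w ≈ dot u w + dot v w
  dot-⊕ˡ u v w = ≈.trans (dot-comm (u ⊕ v) w)
    (≈.trans (dot-⊕ʳ w u v) (+-cong (dot-comm w u) (dot-comm w v)))

  dot-•ˡ : ∀ {n} a (v w : Vector Carrier n) → dot (a • v) w ≈ a * dot v w
  dot-•ˡ a v w = ≈.trans (dot-comm (a • v) w) (≈.trans (dot-•ʳ a w v) (*-congˡ (dot-comm w v)))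

  dot-zeroˡ : ∀ {n} {v w : Vector Carrier n} → v ≋ 0ᵛ → dot v w ≈ 0#
  dot-zeroˡ {n} {w = w} v≋0 = ≈.trans
    (sum-cong-≋ λ i → ≈.trans (*-congʳ (v≋0 i)) (zeroˡ (w i))) (sum-replicate-zero n)

  dot-zeroʳ : ∀ {n} {v w : Vector Carrier n} → w ≋ 0ᵛ → dot v w ≈ 0#
  dot-zeroʳ {v = v} {w} w≋0 = ≈.trans (dot-comm v w) (dot-zeroˡ w≋0)

  unit-dot : ∀ {n} i (v : Vector Carrier n) → dot (unit i) v ≈ v i
  unit-dot zero    v = ≈.trans (+-cong (*-identityˡ _) (dot-zeroˡ {w = v ∘ suc} λ _ → ≈.refl)) (+-identityʳ _)
  unit-dot (suc i) v = ≈.trans (+-cong (zeroˡ _) (unit-dot i (v ∘ suc))) (+-identityˡ _)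

  dot-combination : ∀ {m n} (u : Vector Carrier n) (y : Vector Carrier m) (A : Matrix m n) →
                    dot u (combination y A) ≈ dot y (λ r → dot u (A r))
  dot-combination u y A = begin
    sum (λ j → u j * sum (λ r → y r * A r j))
      ≈⟨ sum-cong-≋ (λ j → *-distribˡ-sum (u j) (λ r → y r * A r j)) ⟩
    sum (λ j → sum (λ r → u j * (y r * A r j)))
      ≈⟨ ∑-comm (λ j r → u j * (y r * A r j)) ⟩
    sum (λ r → sum (λ j → u j * (y r * A r j)))
      ≈⟨ sum-cong-≋ (λ r → sum-cong-≋ λ j →
           solve 3 (λ u y a → u :* (y :* a) := y :* (u :* a)) ≈.refl (u j) (y r) (A r j)) ⟩
    sum (λ r → sum (λ j → y r * (u j * A r j)))
      ≈⟨ sum-cong-≋ (λ r → ≈.sym (*-distribˡ-sum (y r) (λ j → u j * A r j))) ⟩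
    sum (λ r → y r * sum (λ j → u j * A r j))
      ∎

  combination-cong : ∀ {m n} {y z : Vector Carrier m} (A : Matrix m n) → y ≋ z →
                     combination y A ≋ combination z A
  combination-cong A y≋z j = dot-cong y≋z λ _ → ≈.refl

  combination-⊕ : ∀ {m n} (y z : Vector Carrier m) (A : Matrix m n) →
                  combination (y ⊕ z) A ≋ combination y A ⊕ combination z A
  combination-⊕ y z A j = dot-⊕ˡ y z (λ i → A i j)

  combination-• : ∀ {m n} a (y : Vector Carrier m) (A : Matrix m n) →
                  combination (a • y) A ≋ a • combination y A
  combination-• a y A j = dot-•ˡ a y (λ i → A i j)

  combination-zero : ∀ {m n} {y : Vector Carrier m} (A : Matrix m n) → y ≋ 0ᵛ →
                     combination y A ≋ 0ᵛ
  combination-zero A y≋0 j = dot-zeroˡ y≋0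

  •-zero : ∀ {n a} (v : Vector Carrier n) → a ≈ 0# → a • v ≋ 0ᵛ
  •-zero v a≈0 i = ≈.trans (*-congʳ a≈0) (zeroˡ (v i))

  abstract
    zero? : ∀ {n} (v : Vector Carrier n) → Dec (v ≋ 0ᵛ)
    zero? v = Fin.all? λ i → v i ≟ 0#

  abstract
    nonzero-entry : ∀ {n} {v : Vector Carrier n} → ¬ (v ≋ 0ᵛ) → ∃ λ i → v i ≉ 0#
    nonzero-entry {v = v} v≉0 = Fin.¬∀⟶∃¬ _ _ (λ i → v i ≟ 0#) v≉0

  infix 4 _∝_
  -- The relation `_∼_` on bare vectors. The scalar may be 0, so the zero vector is proportional to
  -- everything and the relation can be reversed only if its left side is nonzero.
  _∝_ : ∀ {n} → Vector Carrier n → Vector Carrier n → Set (c ⊔ ℓ)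
  v ∝ w = ∃ λ a → v ≋ a • w

  ∝-trans : ∀ {n} {u v w : Vector Carrier n} → u ∝ v → v ∝ w → u ∝ w
  ∝-trans {w = w} (a , u≋av) (b , v≋bw) = a * b , λ i →
    ≈.trans (u≋av i) (≈.trans (*-congˡ (v≋bw i)) (≈.sym (*-assoc a b (w i))))

  ≋⇒∝ : ∀ {n} {v w : Vector Carrier n} → v ≋ w → v ∝ w
  ≋⇒∝ {w = w} v≋w = 1# , λ i → ≈.trans (v≋w i) (≈.sym (*-identityˡ (w i)))

  scalar≉0 : ∀ {n a} {v w : Vector Carrier n} → ¬ (v ≋ 0ᵛ) → v ≋ a • w → a ≉ 0#
  scalar≉0 {w = w} v≉0 v≋aw a≈0 = v≉0 (≋-trans v≋aw (•-zero w a≈0))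

  ∝-sym : ∀ {n} {v w : Vector Carrier n} → ¬ (v ≋ 0ᵛ) → v ∝ w → w ∝ v
  ∝-sym {v = v} {w} v≉0 (a , v≋aw) with b , ab≈1 ← inverse (scalar≉0 {w = w} v≉0 v≋aw) =
    b , λ i → begin
      w i            ≈⟨ *-identityˡ (w i) ⟨
      1# * w i       ≈⟨ *-congʳ ab≈1 ⟨
      a * b * w i    ≈⟨ solve 3 (λ a b w → a :* b :* w := b :* (a :* w)) ≈.refl a b (w i) ⟩
      b * (a * w i)  ≈⟨ *-congˡ (v≋aw i) ⟨
      b * v i        ∎

  ∝-dot : ∀ {n} (u : Vector Carrier n) {v w} → v ∝ w → dot u w ≈ 0# → dot u v ≈ 0#
  ∝-dot u {v} {w} (a , v≋aw) uw≈0 = begin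
    dot u v        ≈⟨ dot-cong {v = u} ≋-refl v≋aw ⟩
    dot u (a • w)  ≈⟨ dot-•ʳ a u w ⟩
    a * dot u w    ≈⟨ *-congˡ uw≈0 ⟩
    a * 0#         ≈⟨ zeroʳ a ⟩
    0#             ∎

  vector : ∀ {n} → Fin (q ℕ.^ n) → Vector Carrier n
  vector i = elements ∘ Fin.finToFun i

  vectorIndex : ∀ {n} → Vector Carrier n → Fin (q ℕ.^ n)
  vectorIndex v = Fin.funToFin (index ∘ v)

  vector-index : ∀ {n} (v : Vector Carrier n) → vector (vectorIndex v) ≋ v
  vector-index v i = ≈.trans
    (≈.reflexive (≡.cong elements (Fin.finToFun-funToFin (index ∘ v) i))) (elements-index (v i))

  vector-injective : ∀ {n} {i j : Fin (q ℕ.^ n)} → vector i ≋ vector {n} j → i ≡ j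
  vector-injective {n} {i} {j} eq = ≡.trans (≡.sym (Fin.funToFin-finToFin {n} {q} i))
    (≡.trans (funToFin-cong (λ k → elements-injective (eq k))) (Fin.funToFin-finToFin {n} {q} j))

  -- Normalised representatives of the points of PG(n-1,q): the first nonzero coordinate is 1.
  NormalForm : ℕ → Set
  NormalForm zero    = Fin 0
  NormalForm (suc n) = Fin (q ℕ.^ n) ⊎ NormalForm n

  -- The sum q^(n-1) + ... + q + 1, split by the position of the leading 1.
  points : ℕ → ℕ
  points zero    = 0
  points (suc n) = q ℕ.^ n ℕ.+ points n

  NormalForm-↔ : ∀ n → Fin (points n) ↔ NormalForm n
  NormalForm-↔ zero    = mk↔ₛ′ id id (λ _ → refl) (λ _ → refl)
  NormalForm-↔ (suc n) = (mk↔ₛ′ id id (λ _ → refl) (λ _ → refl) ⊎-↔ NormalForm-↔ n) ↔-∘ Fin.+↔⊎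

  normal : ∀ {n} → NormalForm n → Vector Carrier n
  normal {suc n} (inj₁ i) = 1# ∷ vector i
  normal {suc n} (inj₂ i) = 0# ∷ normal i

  abstract
    normal-covers : ∀ {n} {v : Vector Carrier n} → ¬ (v ≋ 0ᵛ) → ∃ λ i → v ∝ normal i
    normal-covers {zero} v≉0 = contradiction (λ ()) v≉0
    normal-covers {suc n} {v} v≉0 with v zero ≟ 0#
    ... | yes v₀≈0 with i , a , v≋ai ← normal-covers {n} {v ∘ suc} (λ tail≋0 → v≉0 λ where
                                          zero    → v₀≈0
                                          (suc i) → tail≋0 i) =
      inj₂ i , a , λ where
        zero    → ≈.trans v₀≈0 (≈.sym (zeroʳ a))
        (suc j) → v≋ai j
    ... | no v₀≉0 with b , v₀b≈1 ← inverse v₀≉0 =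
      inj₁ (vectorIndex (b • (v ∘ suc))) , v zero , λ where
        zero    → ≈.sym (*-identityʳ _)
        (suc j) → begin
          v (suc j)                  ≈⟨ *-identityˡ _ ⟨
          1# * v (suc j)             ≈⟨ *-congʳ v₀b≈1 ⟨
          v zero * b * v (suc j)     ≈⟨ *-assoc _ _ _ ⟩
          v zero * (b * v (suc j))   ≈⟨ *-congˡ (vector-index (b • (v ∘ suc)) j) ⟨
          v zero * _                 ∎

  module _ (1≉0 : 1# ≉ 0#) where

    normal-nonzero : ∀ {n} (i : NormalForm n) → ¬ (normal i ≋ 0ᵛ)
    normal-nonzero {suc n} (inj₁ i) eq = 1≉0 (eq zero)
    normal-nonzero {suc n} (inj₂ i) eq = normal-nonzero i (eq ∘ suc)

    normal-injective : ∀ {n} {i j : NormalForm n} → normal i ∝ normal j → i ≡ j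
    normal-injective {suc n} {inj₁ i} {inj₁ j} (a , eq) = ≡.cong inj₁ (vector-injective {n} λ k → begin
      vector i k       ≈⟨ eq (suc k) ⟩
      a * vector j k   ≈⟨ *-congʳ (≈.trans (eq zero) (*-identityʳ a)) ⟨
      1# * vector j k  ≈⟨ *-identityˡ _ ⟩
      vector j k       ∎)
    normal-injective {suc n} {inj₁ i} {inj₂ j} (a , eq) = contradiction (≈.trans (eq zero) (zeroʳ a)) 1≉0
    normal-injective {suc n} {inj₂ i} {inj₁ j} (a , eq) = contradiction
      (≋-trans (eq ∘ suc) (•-zero _ (≈.sym (≈.trans (eq zero) (*-identityʳ a))))) (normal-nonzero i)
    normal-injective {suc n} {inj₂ i} {inj₂ j} (a , eq) = ≡.cong inj₂ (normal-injective (a , eq ∘ suc))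

-- Points and lines of a projective plane by cross products

module CrossProduct {q c ℓ} (F : FiniteField q c ℓ) where
  open FieldProperties F
  open LinearAlgebra F
  open VectorProperties F
  open import Relation.Binary.Reasoning.Setoid setoid

  infixl 7 _⨯_
  _⨯_ : Vector Carrier 3 → Vector Carrier 3 → Vector Carrier 3
  x ⨯ y = x 1F * y 2F - x 2F * y 1F
        ∷ x 2F * y 0F - x 0F * y 2F
        ∷ x 0F * y 1F - x 1F * y 0F
        ∷ []

  private
    Triple : ℕ → Set _
    Triple n = Fin 3 → Polynomial n

    triple : ∀ {n} → Polynomial n → Polynomial n → Polynomial n → Triple n
    triple a b c 0F = a
    triple a b c 1F = b
    triple a b c 2F = c

    -- The trailing zero is the empty tail of `sum` over `Fin 3`; with it the solver's expression
    -- evaluates to `dot` on the nose.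
    dotₚ : ∀ {n} → Triple n → Triple n → Polynomial n
    dotₚ x y = x 0F :* y 0F :+ (x 1F :* y 1F :+ (x 2F :* y 2F :+ con (+ 0)))

    crossₚ : ∀ {n} → Triple n → Triple n → Triple n
    crossₚ x y = triple (x 1F :* y 2F :- x 2F :* y 1F)
                        (x 2F :* y 0F :- x 0F :* y 2F)
                        (x 0F :* y 1F :- x 1F :* y 0F)

  dot-⨯ˡ : ∀ x y → dot x (x ⨯ y) ≈ 0#
  dot-⨯ˡ x y = solve 6 (λ a b c d e f → let x = triple a b c; y = triple d e f in
    dotₚ x (crossₚ x y) := con (+ 0)) ≈.refl (x 0F) (x 1F) (x 2F) (y 0F) (y 1F) (y 2F)

  dot-⨯ʳ : ∀ x y → dot y (x ⨯ y) ≈ 0#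
  dot-⨯ʳ x y = solve 6 (λ a b c d e f → let x = triple a b c; y = triple d e f in
    dotₚ y (crossₚ x y) := con (+ 0)) ≈.refl (x 0F) (x 1F) (x 2F) (y 0F) (y 1F) (y 2F)

  triple-product : ∀ n x y i → (n ⨯ (x ⨯ y)) i ≈ dot n y * x i - dot n x * y i
  triple-product n x y 0F = solve 9 (λ a b c d e f g h k →
    let n = triple a b c; x = triple d e f; y = triple g h k in
    crossₚ n (crossₚ x y) 0F := dotₚ n y :* x 0F :- dotₚ n x :* y 0F)
    ≈.refl (n 0F) (n 1F) (n 2F) (x 0F) (x 1F) (x 2F) (y 0F) (y 1F) (y 2F)
  triple-product n x y 1F = solve 9 (λ a b c d e f g h k →
    let n = triple a b c; x = triple d e f; y = triple g h k in
    crossₚ n (crossₚ x y) 1F := dotₚ n y :* x 1F :- dotₚ n x :* y 1F)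
    ≈.refl (n 0F) (n 1F) (n 2F) (x 0F) (x 1F) (x 2F) (y 0F) (y 1F) (y 2F)
  triple-product n x y 2F = solve 9 (λ a b c d e f g h k →
    let n = triple a b c; x = triple d e f; y = triple g h k in
    crossₚ n (crossₚ x y) 2F := dotₚ n y :* x 2F :- dotₚ n x :* y 2F)
    ≈.refl (n 0F) (n 1F) (n 2F) (x 0F) (x 1F) (x 2F) (y 0F) (y 1F) (y 2F)

  private
    -- Cramer's rule as the linear dependency of four vectors in 3-space. If `z` is orthogonal to
    -- `x ⨯ y` the last term drops out, and a unit vector `m` at a nonzero entry of `x ⨯ y` lets one
    -- solve for `z`.
    cramer : ∀ m x y z j → dot m (x ⨯ y) * z j ≈
             dot m (z ⨯ y) * x j + dot m (x ⨯ z) * y j + dot z (x ⨯ y) * m j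
    cramer m x y z 0F = solve 12 (λ a b c d e f g h k r s t →
      let m = triple a b c; x = triple d e f; y = triple g h k; z = triple r s t in
      dotₚ m (crossₚ x y) :* z 0F :=
      dotₚ m (crossₚ z y) :* x 0F :+ dotₚ m (crossₚ x z) :* y 0F :+ dotₚ z (crossₚ x y) :* m 0F)
      ≈.refl (m 0F) (m 1F) (m 2F) (x 0F) (x 1F) (x 2F) (y 0F) (y 1F) (y 2F) (z 0F) (z 1F) (z 2F)
    cramer m x y z 1F = solve 12 (λ a b c d e f g h k r s t →
      let m = triple a b c; x = triple d e f; y = triple g h k; z = triple r s t in
      dotₚ m (crossₚ x y) :* z 1F :=
      dotₚ m (crossₚ z y) :* x 1F :+ dotₚ m (crossₚ x z) :* y 1F :+ dotₚ z (crossₚ x y) :* m 1F)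
      ≈.refl (m 0F) (m 1F) (m 2F) (x 0F) (x 1F) (x 2F) (y 0F) (y 1F) (y 2F) (z 0F) (z 1F) (z 2F)
    cramer m x y z 2F = solve 12 (λ a b c d e f g h k r s t →
      let m = triple a b c; x = triple d e f; y = triple g h k; z = triple r s t in
      dotₚ m (crossₚ x y) :* z 2F :=
      dotₚ m (crossₚ z y) :* x 2F :+ dotₚ m (crossₚ x z) :* y 2F :+ dotₚ z (crossₚ x y) :* m 2F)
      ≈.refl (m 0F) (m 1F) (m 2F) (x 0F) (x 1F) (x 2F) (y 0F) (y 1F) (y 2F) (z 0F) (z 1F) (z 2F)

    minor : ∀ {x y} → x ⨯ y ≋ 0ᵛ → ∀ i j → x i * y j ≈ x j * y i
    minor eq 0F 0F = ≈.refl
    minor eq 0F 1F = x-y≈0⇒x≈y _ _ (eq 2F)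
    minor eq 0F 2F = ≈.sym (x-y≈0⇒x≈y _ _ (eq 1F))
    minor eq 1F 0F = ≈.sym (x-y≈0⇒x≈y _ _ (eq 2F))
    minor eq 1F 1F = ≈.refl
    minor eq 1F 2F = x-y≈0⇒x≈y _ _ (eq 0F)
    minor eq 2F 0F = x-y≈0⇒x≈y _ _ (eq 1F)
    minor eq 2F 1F = ≈.sym (x-y≈0⇒x≈y _ _ (eq 0F))
    minor eq 2F 2F = ≈.refl

  ⨯≋0⇒∝ : ∀ {x y} → x ⨯ y ≋ 0ᵛ → ¬ (y ≋ 0ᵛ) → x ∝ y
  ⨯≋0⇒∝ {x} {y} eq y≉0 with i , yᵢ≉0 ← nonzero-entry y≉0 with b , yᵢb≈1 ← inverse yᵢ≉0 =
    x i * b , λ j → begin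
      x j                ≈⟨ *-identityʳ (x j) ⟨
      x j * 1#           ≈⟨ *-congˡ yᵢb≈1 ⟨
      x j * (y i * b)    ≈⟨ *-assoc _ _ _ ⟨
      x j * y i * b      ≈⟨ *-congʳ (minor {x} {y} eq i j) ⟨
      x i * y j * b      ≈⟨ solve 3 (λ x y b → x :* y :* b := x :* b :* y) ≈.refl (x i) (y j) b ⟩
      x i * b * y j      ∎

  ∝⇒⨯≋0 : ∀ {x y} → x ∝ y → x ⨯ y ≋ 0ᵛ
  ∝⇒⨯≋0 {x} {y} (a , eq) = λ where
      0F → lemma 1F 2F
      1F → lemma 2F 0F
      2F → lemma 0F 1F
    where
    lemma : ∀ i j → x i * y j - x j * y i ≈ 0#
    lemma i j = ≈.trans (+-cong (*-congʳ (eq i)) (-‿cong (*-congʳ (eq j))))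
      (solve 3 (λ a y z → a :* y :* z :- a :* z :* y := con (+ 0)) ≈.refl a (y i) (y j))

  -- Both terms of the triple product n ⨯ (x ⨯ y) vanish. Geometrically: two distinct points lie on
  -- only one line.
  ⊥⇒∝⨯ : ∀ {n x y} → dot n x ≈ 0# → dot n y ≈ 0# → ¬ (x ⨯ y ≋ 0ᵛ) → n ∝ x ⨯ y
  ⊥⇒∝⨯ {n} {x} {y} nx ny = ⨯≋0⇒∝ λ i → begin
    (n ⨯ (x ⨯ y)) i                  ≈⟨ triple-product n x y i ⟩
    dot n y * x i - dot n x * y i    ≈⟨ +-cong (*-congʳ ny) (-‿cong (*-congʳ nx)) ⟩
    0# * x i - 0# * y i              ≈⟨ solve 2 (λ x y → con (+ 0) :* x :- con (+ 0) :* y := con (+ 0)) ≈.refl (x i) (y i) ⟩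
    0#                               ∎

  ⊥⨯⇒span : ∀ {x y z} → dot z (x ⨯ y) ≈ 0# → ¬ (x ⨯ y ≋ 0ᵛ) → ∃₂ λ α β → z ≋ α • x ⊕ β • y
  ⊥⨯⇒span {x} {y} {z} z⊥ n≉0 with i , nᵢ≉0 ← nonzero-entry n≉0
    with b , mnb≈1 ← inverse {dot (unit i) (x ⨯ y)} (nᵢ≉0 ∘ ≈.trans (≈.sym (unit-dot i (x ⨯ y)))) =
    b * dot m (z ⨯ y) , b * dot m (x ⨯ z) , λ j → begin
      z j                                ≈⟨ *-identityˡ _ ⟨
      1# * z j                           ≈⟨ *-congʳ mnb≈1 ⟨
      dot m (x ⨯ y) * b * z j            ≈⟨ solve 3 (λ d b z → d :* b :* z := b :* (d :* z)) ≈.refl (dot m (x ⨯ y)) b (z j) ⟩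
      b * (dot m (x ⨯ y) * z j)          ≈⟨ *-congˡ (cramer m x y z j) ⟩
      b * (dot m (z ⨯ y) * x j + dot m (x ⨯ z) * y j + dot z (x ⨯ y) * m j)
        ≈⟨ *-congˡ (+-congˡ (*-congʳ z⊥)) ⟩
      b * (dot m (z ⨯ y) * x j + dot m (x ⨯ z) * y j + 0# * m j)
        ≈⟨ solve 6 (λ b d e x y m → b :* (d :* x :+ e :* y :+ con (+ 0) :* m) := b :* d :* x :+ b :* e :* y)
             ≈.refl b (dot m (z ⨯ y)) (dot m (x ⨯ z)) (x j) (y j) (m j) ⟩
      b * dot m (z ⨯ y) * x j + b * dot m (x ⨯ z) * y j ∎
    where m = unit i

  -- The entries of `x ⨯ y` are the 2 × 2 minors up to sign; times a nonzero one, each coefficient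
  -- can be expressed through the combination alone.
  span-injective : ∀ {x y α β α′ β′} → ¬ (x ⨯ y ≋ 0ᵛ) →
                   α • x ⊕ β • y ≋ α′ • x ⊕ β′ • y → α ≈ α′ × β ≈ β′
  span-injective {x} {y} {α} {β} {α′} {β′} n≉0 eq = from-entry (nonzero-entry n≉0)
    where
    from-minor : ∀ i j → x i * y j - x j * y i ≉ 0# → α ≈ α′ × β ≈ β′
    from-minor i j m≉0 =
      *-cancel m≉0 (begin
        α * (x i * y j - x j * y i)
          ≈⟨ solve 6 (λ α β x₁ x₂ y₁ y₂ → α :* (x₁ :* y₂ :- x₂ :* y₁) :=
               (α :* x₁ :+ β :* y₁) :* y₂ :- (α :* x₂ :+ β :* y₂) :* y₁) ≈.refl α β (x i) (x j) (y i) (y j) ⟩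
        (α * x i + β * y i) * y j - (α * x j + β * y j) * y i
          ≈⟨ +-cong (*-congʳ (eq i)) (-‿cong (*-congʳ (eq j))) ⟩
        (α′ * x i + β′ * y i) * y j - (α′ * x j + β′ * y j) * y i
          ≈⟨ solve 6 (λ α β x₁ x₂ y₁ y₂ → (α :* x₁ :+ β :* y₁) :* y₂ :- (α :* x₂ :+ β :* y₂) :* y₁ :=
               α :* (x₁ :* y₂ :- x₂ :* y₁)) ≈.refl α′ β′ (x i) (x j) (y i) (y j) ⟩
        α′ * (x i * y j - x j * y i) ∎) ,
      *-cancel m≉0 (begin
        β * (x i * y j - x j * y i)
          ≈⟨ solve 6 (λ α β x₁ x₂ y₁ y₂ → β :* (x₁ :* y₂ :- x₂ :* y₁) :=
               x₁ :* (α :* x₂ :+ β :* y₂) :- x₂ :* (α :* x₁ :+ β :* y₁)) ≈.refl α β (x i) (x j) (y i) (y j) ⟩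
        x i * (α * x j + β * y j) - x j * (α * x i + β * y i)
          ≈⟨ +-cong (*-congˡ (eq j)) (-‿cong (*-congˡ (eq i))) ⟩
        x i * (α′ * x j + β′ * y j) - x j * (α′ * x i + β′ * y i)
          ≈⟨ solve 6 (λ α β x₁ x₂ y₁ y₂ → x₁ :* (α :* x₂ :+ β :* y₂) :- x₂ :* (α :* x₁ :+ β :* y₁) :=
               β :* (x₁ :* y₂ :- x₂ :* y₁)) ≈.refl α′ β′ (x i) (x j) (y i) (y j) ⟩
        β′ * (x i * y j - x j * y i) ∎)
    from-entry : (∃ λ i → (x ⨯ y) i ≉ 0#) → α ≈ α′ × β ≈ β′
    from-entry (0F , m≉0) = from-minor 1F 2F m≉0
    from-entry (1F , m≉0) = from-minor 2F 0F m≉0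
    from-entry (2F , m≉0) = from-minor 0F 1F m≉0

  -- Two points spanning the line h^⊥. Orthogonality, independence and spanning are all read off the
  -- one relation between `a ⨯ b` and `h`.
  record PerpBasis (h : Vector Carrier 3) : Set (c ⊔ ℓ) where
    field
      a b    : Vector Carrier 3
      a⨯b≉0 : ¬ (a ⨯ b ≋ 0ᵛ)
      a⨯b∝h : a ⨯ b ∝ h

    h∝a⨯b : h ∝ a ⨯ b
    h∝a⨯b = ∝-sym a⨯b≉0 a⨯b∝h

    a⊥h : dot a h ≈ 0#
    a⊥h = ∝-dot a h∝a⨯b (dot-⨯ˡ a b)

    b⊥h : dot b h ≈ 0#
    b⊥h = ∝-dot b h∝a⨯b (dot-⨯ʳ a b)

    a≉0 : ¬ (a ≋ 0ᵛ)
    a≉0 a≋0 = a⨯b≉0 (∝⇒⨯≋0 {a} {b} (0# , λ i → ≈.trans (a≋0 i) (≈.sym (zeroˡ (b i)))))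

    b≉0 : ¬ (b ≋ 0ᵛ)
    b≉0 b≋0 = a⨯b≉0 λ where
        0F → vanish 1F 2F
        1F → vanish 2F 0F
        2F → vanish 0F 1F
      where
      vanish : ∀ i j → a i * b j - a j * b i ≈ 0#
      vanish i j = ≈.trans (+-cong (*-congˡ (b≋0 j)) (-‿cong (*-congˡ (b≋0 i))))
        (solve 2 (λ x y → x :* con (+ 0) :- y :* con (+ 0) := con (+ 0)) ≈.refl (a i) (a j))

    a∝̸b : ¬ (a ∝ b)
    a∝̸b = a⨯b≉0 ∘ ∝⇒⨯≋0

    ⊥⇒span : ∀ z → dot z h ≈ 0# → ∃₂ λ α β → z ≋ α • a ⊕ β • b
    ⊥⇒span z z⊥h = ⊥⨯⇒span {a} {b} {z} (∝-dot z a⨯b∝h z⊥h) a⨯b≉0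

    span⇒⊥ : ∀ z {α β} → z ≋ α • a ⊕ β • b → dot z h ≈ 0#
    span⇒⊥ z {α} {β} eq = begin
      dot z h                        ≈⟨ dot-cong {w = h} eq ≋-refl ⟩
      dot (α • a ⊕ β • b) h          ≈⟨ dot-⊕ˡ (α • a) (β • b) h ⟩
      dot (α • a) h + dot (β • b) h  ≈⟨ +-cong (dot-•ˡ α a h) (dot-•ˡ β b h) ⟩
      α * dot a h + β * dot b h      ≈⟨ +-cong (*-congˡ a⊥h) (*-congˡ b⊥h) ⟩
      α * 0# + β * 0#                ≈⟨ +-cong (zeroʳ α) (zeroʳ β) ⟩
      0# + 0#                        ≈⟨ +-identityˡ 0# ⟩
      0#                             ∎

  -- For a pivot hᵢ ≉ 0, take the two rows of the skew matrix of h ⨯ _ that contain hᵢ, one with its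
  -- sign changed; ordered as here, their cross product is exactly hᵢh.
  perp-basis : ∀ h → ¬ (h ≋ 0ᵛ) → PerpBasis h
  perp-basis h h≉0 with nonzero-entry h≉0
  ... | 0F , h₀≉0 = record
    { a      = - h 1F ∷ h 0F ∷ 0# ∷ []
    ; b      = - h 2F ∷ 0# ∷ h 0F ∷ []
    ; a⨯b≉0 = λ eq → *-≉0 h₀≉0 h₀≉0 (≈.trans (≈.sym (proportional 0F)) (eq 0F))
    ; a⨯b∝h = h 0F , proportional
    }
    where
    proportional : (- h 1F ∷ h 0F ∷ 0# ∷ []) ⨯ (- h 2F ∷ 0# ∷ h 0F ∷ []) ≋ h 0F • h
    proportional 0F = solve 1 (λ x → x :* x :- con (+ 0) :* con (+ 0) := x :* x) ≈.refl (h 0F)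
    proportional 1F = solve 3 (λ x y z → con (+ 0) :* :- z :- :- y :* x := x :* y) ≈.refl (h 0F) (h 1F) (h 2F)
    proportional 2F = solve 3 (λ x y z → :- y :* con (+ 0) :- x :* :- z := x :* z) ≈.refl (h 0F) (h 1F) (h 2F)
  ... | 1F , h₁≉0 = record
    { a      = 0# ∷ - h 2F ∷ h 1F ∷ []
    ; b      = h 1F ∷ - h 0F ∷ 0# ∷ []
    ; a⨯b≉0 = λ eq → *-≉0 h₁≉0 h₁≉0 (≈.trans (≈.sym (proportional 1F)) (eq 1F))
    ; a⨯b∝h = h 1F , proportional
    }
    where
    proportional : (0# ∷ - h 2F ∷ h 1F ∷ []) ⨯ (h 1F ∷ - h 0F ∷ 0# ∷ []) ≋ h 1F • h
    proportional 0F = solve 3 (λ x y z → :- z :* con (+ 0) :- y :* :- x := y :* x) ≈.refl (h 0F) (h 1F) (h 2F)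
    proportional 1F = solve 1 (λ y → y :* y :- con (+ 0) :* con (+ 0) := y :* y) ≈.refl (h 1F)
    proportional 2F = solve 3 (λ x y z → con (+ 0) :* :- x :- :- z :* y := y :* z) ≈.refl (h 0F) (h 1F) (h 2F)
  ... | 2F , h₂≉0 = record
    { a      = h 2F ∷ 0# ∷ - h 0F ∷ []
    ; b      = 0# ∷ h 2F ∷ - h 1F ∷ []
    ; a⨯b≉0 = λ eq → *-≉0 h₂≉0 h₂≉0 (≈.trans (≈.sym (proportional 2F)) (eq 2F))
    ; a⨯b∝h = h 2F , proportional
    }
    where
    proportional : (h 2F ∷ 0# ∷ - h 0F ∷ []) ⨯ (0# ∷ h 2F ∷ - h 1F ∷ []) ≋ h 2F • h
    proportional 0F = solve 3 (λ x y z → con (+ 0) :* :- y :- :- x :* z := z :* x) ≈.refl (h 0F) (h 1F) (h 2F)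
    proportional 1F = solve 3 (λ x y z → :- x :* con (+ 0) :- z :* :- y := z :* y) ≈.refl (h 0F) (h 1F) (h 2F)
    proportional 2F = solve 1 (λ z → z :* z :- con (+ 0) :* con (+ 0) := z :* z) ≈.refl (h 2F)

  det : Vector Carrier 3 → Vector Carrier 3 → Vector Carrier 3 → Carrier
  det x y z = dot x (y ⨯ z)

  -- Unless `y ⨯ z` vanishes, it is the only normal of `y` and `z` up to a scalar, so it is
  -- orthogonal to `x` because `h` is.
  common-normal⇒det≈0 : ∀ h {x y z} → ¬ (h ≋ 0ᵛ) → dot h x ≈ 0# → dot h y ≈ 0# → dot h z ≈ 0# →
                        det x y z ≈ 0#
  common-normal⇒det≈0 h {x} {y} {z} h≉0 h⊥x h⊥y h⊥z with zero? (y ⨯ z)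
  ... | yes y⨯z≋0 = dot-zeroʳ {v = x} y⨯z≋0
  ... | no  y⨯z≉0 = ∝-dot x (∝-sym h≉0 (⊥⇒∝⨯ {h} {y} {z} h⊥y h⊥z y⨯z≉0)) (≈.trans (dot-comm x h) h⊥x)

  -- The line is the join of `y` and `z` if they differ, else that of `x` and `z`, and some line
  -- through the common point if all three coincide.
  det≈0⇒common-normal : ∀ {x y z} → ¬ (x ≋ 0ᵛ) → ¬ (y ≋ 0ᵛ) → ¬ (z ≋ 0ᵛ) → det x y z ≈ 0# →
                        ∃ λ h → ¬ (h ≋ 0ᵛ) × dot x h ≈ 0# × dot y h ≈ 0# × dot z h ≈ 0#
  det≈0⇒common-normal {x} {y} {z} x≉0 y≉0 z≉0 det≈0 with zero? (y ⨯ z) | zero? (x ⨯ z)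
  ... | no y⨯z≉0 | _ = y ⨯ z , y⨯z≉0 , det≈0 , dot-⨯ˡ y z , dot-⨯ʳ y z
  ... | yes y⨯z≋0 | no x⨯z≉0 = x ⨯ z , x⨯z≉0 , dot-⨯ˡ x z , y⊥ , dot-⨯ʳ x z
    where
    y⊥ : dot y (x ⨯ z) ≈ 0#
    y⊥ = ≈.trans (dot-comm y (x ⨯ z))
      (∝-dot (x ⨯ z) (⨯≋0⇒∝ {y} {z} y⨯z≋0 z≉0) (≈.trans (dot-comm (x ⨯ z) z) (dot-⨯ʳ x z)))
  ... | yes y⨯z≋0 | yes x⨯z≋0 = PerpBasis.a nb , PerpBasis.a≉0 nb , ⊥a x x⨯z≋0 , ⊥a y y⨯z≋0 , z⊥a
    where
    nb = perp-basis z z≉0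
    z⊥a = ≈.trans (dot-comm z (PerpBasis.a nb)) (PerpBasis.a⊥h nb)
    ⊥a : ∀ w → w ⨯ z ≋ 0ᵛ → dot w (PerpBasis.a nb) ≈ 0#
    ⊥a w eq = ≈.trans (dot-comm w (PerpBasis.a nb))
      (∝-dot (PerpBasis.a nb) (⨯≋0⇒∝ {w} {z} eq z≉0) (PerpBasis.a⊥h nb))

  -- Serves to find a dependency among three combinations of two vectors, with `x` and `y` listing
  -- the coefficients. These may be zero, and `1# ≉ 0#` provides the normal when both are.
  common-normal : 1# ≉ 0# → ∀ (x y : Vector Carrier 3) → ∃ λ h → ¬ (h ≋ 0ᵛ) × dot h x ≈ 0# × dot h y ≈ 0#
  common-normal 1≉0 x y with zero? y | zero? (x ⨯ y)
  ... | _ | no x⨯y≉0 = x ⨯ y , x⨯y≉0 ,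
    ≈.trans (dot-comm (x ⨯ y) x) (dot-⨯ˡ x y) , ≈.trans (dot-comm (x ⨯ y) y) (dot-⨯ʳ x y)
  ... | no y≉0 | yes x⨯y≋0 = a , a≉0 , ∝-dot a (⨯≋0⇒∝ {x} {y} x⨯y≋0 y≉0) a⊥h , a⊥h
    where open PerpBasis (perp-basis y y≉0)
  ... | yes y≋0 | yes _ with zero? x
  ...   | no  x≉0 = a , a≉0 , a⊥h , dot-zeroʳ {v = a} y≋0
    where open PerpBasis (perp-basis x x≉0)
  ...   | yes x≋0 = unit 0F , (λ eq → 1≉0 (eq 0F)) , dot-zeroʳ {v = unit 0F} x≋0 , dot-zeroʳ {v = unit 0F} y≋0

  private
    -- Replacing row i of `Y` by the combination kY multiplies the determinant by kᵢ; here i = 0,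
    -- and cyclically in `expand₁` and `expand₂`.
    expand₀ : ∀ (k : Vector Carrier 3) (Y : Matrix 3 3) → k 0F * det (Y 0F) (Y 1F) (Y 2F) ≈ dot (combination k Y) (Y 1F ⨯ Y 2F)
    expand₀ k Y = solve 12 (λ k₀ k₁ k₂ a b c d e f g h i →
      let k = triple k₀ k₁ k₂; x = triple a b c; y = triple d e f; z = triple g h i in
      k₀ :* dotₚ x (crossₚ y z) :=
      dotₚ (λ j → dotₚ k (triple (x j) (y j) (z j))) (crossₚ y z))
      ≈.refl (k 0F) (k 1F) (k 2F) (Y 0F 0F) (Y 0F 1F) (Y 0F 2F) (Y 1F 0F) (Y 1F 1F) (Y 1F 2F)
             (Y 2F 0F) (Y 2F 1F) (Y 2F 2F)

    expand₁ : ∀ (k : Vector Carrier 3) (Y : Matrix 3 3) → k 1F * det (Y 0F) (Y 1F) (Y 2F) ≈ dot (combination k Y) (Y 2F ⨯ Y 0F)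
    expand₁ k Y = solve 12 (λ k₀ k₁ k₂ a b c d e f g h i →
      let k = triple k₀ k₁ k₂; x = triple a b c; y = triple d e f; z = triple g h i in
      k₁ :* dotₚ x (crossₚ y z) :=
      dotₚ (λ j → dotₚ k (triple (x j) (y j) (z j))) (crossₚ z x))
      ≈.refl (k 0F) (k 1F) (k 2F) (Y 0F 0F) (Y 0F 1F) (Y 0F 2F) (Y 1F 0F) (Y 1F 1F) (Y 1F 2F)
             (Y 2F 0F) (Y 2F 1F) (Y 2F 2F)

    expand₂ : ∀ (k : Vector Carrier 3) (Y : Matrix 3 3) → k 2F * det (Y 0F) (Y 1F) (Y 2F) ≈ dot (combination k Y) (Y 0F ⨯ Y 1F)
    expand₂ k Y = solve 12 (λ k₀ k₁ k₂ a b c d e f g h i →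
      let k = triple k₀ k₁ k₂; x = triple a b c; y = triple d e f; z = triple g h i in
      k₂ :* dotₚ x (crossₚ y z) :=
      dotₚ (λ j → dotₚ k (triple (x j) (y j) (z j))) (crossₚ x y))
      ≈.refl (k 0F) (k 1F) (k 2F) (Y 0F 0F) (Y 0F 1F) (Y 0F 2F) (Y 1F 0F) (Y 1F 1F) (Y 1F 2F)
             (Y 2F 0F) (Y 2F 1F) (Y 2F 2F)

  dependent⇒det≈0 : ∀ k (Y : Matrix 3 3) → ¬ (k ≋ 0ᵛ) → combination k Y ≋ 0ᵛ →
                    det (Y 0F) (Y 1F) (Y 2F) ≈ 0#
  dependent⇒det≈0 k Y k≉0 kY≋0 with nonzero-entry k≉0
  ... | 0F , k₀≉0 = *-zero-product (≈.trans (expand₀ k Y) (dot-zeroˡ {w = Y 1F ⨯ Y 2F} kY≋0)) k₀≉0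
  ... | 1F , k₁≉0 = *-zero-product (≈.trans (expand₁ k Y) (dot-zeroˡ {w = Y 2F ⨯ Y 0F} kY≋0)) k₁≉0
  ... | 2F , k₂≉0 = *-zero-product (≈.trans (expand₂ k Y) (dot-zeroˡ {w = Y 0F ⨯ Y 1F} kY≋0)) k₂≉0

-- Collinearity in an embedded plane as a vanishing determinant

module EmbeddedPlane {q c ℓ} (F : FiniteField q c ℓ)
    (1≉0 : FiniteField._≉_ F (FiniteField.1# F) (FiniteField.0# F))
    {n} (G : LinearAlgebra.Matrix F 3 n)
    (G-injective : ∀ y → LinearAlgebra._≋_ F (LinearAlgebra.combination F y G) (LinearAlgebra.0ᵛ F) →
                   LinearAlgebra._≋_ F y (LinearAlgebra.0ᵛ F)) where
  open FieldProperties F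
  open LinearAlgebra F
  open VectorProperties F
  open CrossProduct F
  open Projective F
  open import Relation.Binary.Reasoning.Setoid setoid

  combination-injective : ∀ y z → combination y G ≋ combination z G → y ≋ z
  combination-injective y z eq i = x-y≈0⇒x≈y (y i) (z i) (≈.trans
    (+-congˡ (≈.sym (-1*x≈-x (z i))))
    (G-injective (y ⊕ - 1# • z) (λ j → begin
      combination (y ⊕ - 1# • z) G j                ≈⟨ combination-⊕ y (- 1# • z) G j ⟩
      combination y G j + combination (- 1# • z) G j ≈⟨ +-cong (eq j) (combination-• (- 1#) z G j) ⟩
      combination z G j + - 1# * combination z G j   ≈⟨ +-congˡ (-1*x≈-x _) ⟩
      combination z G j + - combination z G j        ≈⟨ -‿inverseʳ _ ⟩
      0# ∎) i))

  combination-∝ : ∀ y z → y ∝ z → combination y G ∝ combination z G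
  combination-∝ y z (a , eq) = a , ≋-trans (combination-cong {y = y} {a • z} G eq) (combination-• a z G)

  combination-∝⁻¹ : ∀ y z → combination y G ∝ combination z G → y ∝ z
  combination-∝⁻¹ y z (a , eq) = a ,
    combination-injective y (a • z) (≋-trans eq (≋-sym (combination-• a z G)))

  private
    nonzero : ∀ (p : Point n) y → proj₁ p ≋ combination y G → ¬ (y ≋ 0ᵛ)
    nonzero p y eq y≋0 = proj₂ p (≋-trans eq (combination-zero G y≋0))

  -- `Collinear` asks for two distinct points spanning the line, and the three given ones may all
  -- coincide; a basis of the common normal's orthogonal line provides them in every case.
  det≈0⇒collinear : ∀ (p₁ p₂ p₃ : Point n) y₁ y₂ y₃ →
                    proj₁ p₁ ≋ combination y₁ G → proj₁ p₂ ≋ combination y₂ G →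
                    proj₁ p₃ ≋ combination y₃ G → det y₁ y₂ y₃ ≈ 0# → Collinear p₁ p₂ p₃
  det≈0⇒collinear p₁ p₂ p₃ y₁ y₂ y₃ e₁ e₂ e₃ det≈0 =
    fromNormal (det≈0⇒common-normal {y₁} {y₂} {y₃}
      (nonzero p₁ y₁ e₁) (nonzero p₂ y₂ e₂) (nonzero p₃ y₃ e₃) det≈0)
    where
    fromBasis : ∀ {h} → PerpBasis h → dot y₁ h ≈ 0# → dot y₂ h ≈ 0# → dot y₃ h ≈ 0# →
                Collinear p₁ p₂ p₃
    fromBasis {h} nb h₁ h₂ h₃ =
      point a a≉0 , point b b≉0 , (λ a∼b → a∝̸b (combination-∝⁻¹ a b a∼b)) ,
      onLine p₁ y₁ e₁ (⊥⇒span y₁ h₁) , onLine p₂ y₂ e₂ (⊥⇒span y₂ h₂) , onLine p₃ y₃ e₃ (⊥⇒span y₃ h₃)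
      where
      open PerpBasis nb
      point : ∀ y → ¬ (y ≋ 0ᵛ) → Point n
      point y y≉0 = combination y G , y≉0 ∘ G-injective y
      onLine : ∀ (p : Point n) y → proj₁ p ≋ combination y G → (∃₂ λ α β → y ≋ α • a ⊕ β • b) →
               OnLine (point a a≉0) (point b b≉0) p
      onLine p y e (α , β , eq) = α , β , λ j → begin
        proj₁ p j                                ≈⟨ e j ⟩
        combination y G j                        ≈⟨ combination-cong {y = y} {α • a ⊕ β • b} G eq j ⟩
        combination (α • a ⊕ β • b) G j          ≈⟨ combination-⊕ (α • a) (β • b) G j ⟩
        combination (α • a) G j + combination (β • b) G j
                                                 ≈⟨ +-cong (combination-• α a G j) (combination-• β b G j) ⟩
        α * combination a G j + β * combination b G j ∎

    fromNormal : (∃ λ h → ¬ (h ≋ 0ᵛ) × dot y₁ h ≈ 0# × dot y₂ h ≈ 0# × dot y₃ h ≈ 0#) →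
                 Collinear p₁ p₂ p₃
    fromNormal (h , h≉0 , h₁ , h₂ , h₃) = fromBasis (perp-basis h h≉0) h₁ h₂ h₃

  -- The points `a` and `b` spanning the line are not known to lie in the plane, so they have no
  -- coordinates there. Instead a vector `k` orthogonal to both lists of coefficients gives a
  -- dependency of the three points in the ambient space, and injectivity of `G` carries it over to
  -- the coordinates.
  collinear⇒det≈0 : ∀ (p₁ p₂ p₃ : Point n) y₁ y₂ y₃ →
                    proj₁ p₁ ≋ combination y₁ G → proj₁ p₂ ≋ combination y₂ G →
                    proj₁ p₃ ≋ combination y₃ G → Collinear p₁ p₂ p₃ → det y₁ y₂ y₃ ≈ 0#
  collinear⇒det≈0 p₁ p₂ p₃ y₁ y₂ y₃ e₁ e₂ e₃
      ((a , _) , (b , _) , _ , (α₁ , β₁ , l₁) , (α₂ , β₂ , l₂) , (α₃ , β₃ , l₃)) =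
    fromDependency (common-normal 1≉0 α β)
    where
    Y : Matrix 3 3
    Y = y₁ ∷ y₂ ∷ y₃ ∷ []
    α β : Vector Carrier 3
    α = α₁ ∷ α₂ ∷ α₃ ∷ []
    β = β₁ ∷ β₂ ∷ β₃ ∷ []
    column : ∀ (p : Point n) y {α β} → proj₁ p ≋ combination y G → proj₁ p ≋ α • a ⊕ β • b →
             ∀ j → dot (λ i → G i j) y ≈ a j * α + b j * β
    column p y e l j = ≈.trans (dot-comm (λ i → G i j) y) (≈.trans (≈.sym (e j))
      (≈.trans (l j) (+-cong (*-comm _ _) (*-comm _ _))))
    on-line : ∀ j → (λ r → dot (λ i → G i j) (Y r)) ≋ (a j • α ⊕ b j • β)
    on-line j 0F = column p₁ y₁ e₁ l₁ j
    on-line j 1F = column p₂ y₂ e₂ l₂ j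
    on-line j 2F = column p₃ y₃ e₃ l₃ j
    fromDependency : (∃ λ k → ¬ (k ≋ 0ᵛ) × dot k α ≈ 0# × dot k β ≈ 0#) → det y₁ y₂ y₃ ≈ 0#
    fromDependency (k , k≉0 , k⊥α , k⊥β) =
      dependent⇒det≈0 k Y k≉0 (G-injective (combination k Y) λ j → begin
        dot (combination k Y) (λ i → G i j)         ≈⟨ dot-comm (combination k Y) (λ i → G i j) ⟩
        dot (λ i → G i j) (combination k Y)         ≈⟨ dot-combination (λ i → G i j) k Y ⟩
        dot k (λ r → dot (λ i → G i j) (Y r))       ≈⟨ dot-cong {v = k} {k} {λ r → dot (λ i → G i j) (Y r)} {a j • α ⊕ b j • β} ≋-refl (on-line j) ⟩
        dot k (a j • α ⊕ b j • β)                   ≈⟨ dot-⊕ʳ k (a j • α) (b j • β) ⟩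
        dot k (a j • α) + dot k (b j • β)           ≈⟨ +-cong (dot-•ʳ (a j) k α) (dot-•ʳ (b j) k β) ⟩
        a j * dot k α + b j * dot k β               ≈⟨ +-cong (*-congˡ k⊥α) (*-congˡ k⊥β) ⟩
        a j * 0# + b j * 0#                         ≈⟨ +-cong (zeroʳ (a j)) (zeroʳ (b j)) ⟩
        0# + 0#                                     ≈⟨ +-identityˡ 0# ⟩
        0#                                          ∎)

module _ {q c ℓ} (F : FiniteField q c ℓ) where
  open FieldProperties F
  open LinearAlgebra F
  open VectorProperties F

  combination-unit : ∀ {n} (x : Vector Carrier n) → combination x unit ≋ x
  combination-unit {suc n} x zero = ≈.trans
    (+-cong (*-identityʳ _) (dot-zeroʳ {v = x ∘ suc} λ _ → ≈.refl)) (+-identityʳ _)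
  combination-unit {suc n} x (suc j) = ≈.trans
    (+-cong (zeroʳ _) (combination-unit (x ∘ suc) j)) (+-identityˡ _)

-- Baer subplanes and the lines of PG(2,q)

private
  -- The inequality q + 1 < q + √q + 1 for q = s², in the unfolded forms of `points 2` over F and
  -- `points 3` over F₀.
  line<plane : ∀ {s} → 2 ℕ.≤ s → (s ℕ.^ 2) ℕ.^ 1 ℕ.+ ((s ℕ.^ 2) ℕ.^ 0 ℕ.+ 0) ℕ.<
                                 s ℕ.^ 2 ℕ.+ (s ℕ.^ 1 ℕ.+ (s ℕ.^ 0 ℕ.+ 0))
  line<plane {s} 2≤s = begin
    suc ((s ℕ.^ 2) ℕ.^ 1 ℕ.+ ((s ℕ.^ 2) ℕ.^ 0 ℕ.+ 0))  ≡⟨ lhs s ⟩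
    s ℕ.^ 2 ℕ.+ 2                                      ≤⟨ ℕ.+-monoʳ-≤ (s ℕ.^ 2) 2≤s ⟩
    s ℕ.^ 2 ℕ.+ s                                      ≤⟨ ℕ.m≤m+n _ 1 ⟩
    s ℕ.^ 2 ℕ.+ s ℕ.+ 1                                ≡⟨ rhs s ⟩
    s ℕ.^ 2 ℕ.+ (s ℕ.^ 1 ℕ.+ (s ℕ.^ 0 ℕ.+ 0))          ∎
    where
    open ℕ.≤-Reasoning
    lhs : ∀ s → suc (s ℕ.* (s ℕ.* 1) ℕ.* 1 ℕ.+ 1) ≡ s ℕ.* (s ℕ.* 1) ℕ.+ 2
    lhs = solve-∀
    rhs : ∀ s → s ℕ.* (s ℕ.* 1) ℕ.+ s ℕ.+ 1 ≡ s ℕ.* (s ℕ.* 1) ℕ.+ (s ℕ.* 1 ℕ.+ 1)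
    rhs = solve-∀

-- A Baer subplane in coordinates: a map from PG(2,√q) to PG(2,q) that preserves and
-- reflects equality and collinearity of points.
record PlaneEmbedding {q s c ℓ c₀ ℓ₀} (F : FiniteField q c ℓ) (F₀ : FiniteField s c₀ ℓ₀)
    : Set (c ⊔ ℓ ⊔ c₀ ⊔ ℓ₀) where
  private
    module F = FiniteField F
    module L = LinearAlgebra F
    module V = VectorProperties F
    module C = CrossProduct F
    module F₀ = FiniteField F₀
    module V₀ = VectorProperties F₀
    module C₀ = CrossProduct F₀
  open Projective F₀ using (Point)
  field
    f       : Point 3 → Vector F.Carrier 3
    f≉0     : ∀ x → ¬ (f x L.≋ L.0ᵛ)
    f-cong  : ∀ x y → proj₁ x V₀.∝ proj₁ y → f x V.∝ f y
    f-inj   : ∀ x y → f x V.∝ f y → proj₁ x V₀.∝ proj₁ y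
    f-det   : ∀ x y z → C₀.det (proj₁ x) (proj₁ y) (proj₁ z) F₀.≈ F₀.0# →
              C.det (f x) (f y) (f z) F.≈ F.0#
    f-det⁻¹ : ∀ x y z → C.det (f x) (f y) (f z) F.≈ F.0# →
              C₀.det (proj₁ x) (proj₁ y) (proj₁ z) F₀.≈ F₀.0#

module PlaneEmbeddingProperties {q s c ℓ c₀ ℓ₀} (F : FiniteField q c ℓ) (F₀ : FiniteField s c₀ ℓ₀)
    (q≡s² : q ≡ s ℕ.^ 2) (2≤s : 2 ℕ.≤ s) (E : PlaneEmbedding F F₀) where
  open PlaneEmbedding E
  open FieldProperties F
  open LinearAlgebra F
  open VectorProperties F
  open CrossProduct F
  open Projective F₀ using (Point)
  open import Relation.Binary.Reasoning.Setoid setoid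
  private
    module Z where
      open FieldProperties F₀ public
      open LinearAlgebra F₀ public
      open VectorProperties F₀ public
      open CrossProduct F₀ public

  point : Z.NormalForm 3 → Point 3
  point i = Z.normal i , Z.normal-nonzero (Z.2≤q⇒1≉0 2≤s) i

  -- The lines of the subplane: the line g^⊥ of PG(2,√q) spans the line h^⊥ of PG(2,q).
  record Line (g : Vector Z.Carrier 3) : Set (c ⊔ ℓ ⊔ c₀ ⊔ ℓ₀) where
    field
      h      : Vector Carrier 3
      h≉0    : ¬ (h ≋ 0ᵛ)
      x₀     : Point 3
      x₀∈h   : dot (f x₀) h ≈ 0#
      g⇒h    : ∀ x → Z.dot (proj₁ x) g Z.≈ Z.0# → dot (f x) h ≈ 0#
      h⇒g    : ∀ x → dot (f x) h ≈ 0# → Z.dot (proj₁ x) g Z.≈ Z.0#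

  -- For `a` and `b` spanning g^⊥, incidence of `x` with the line amounts to det x a b = 0, which
  -- `f` both preserves and reflects.
  line : ∀ g → ¬ (g Z.≋ Z.0ᵛ) → Line g
  line g g≉0 = record
    { h    = f a ⨯ f b
    ; h≉0  = h≉0
    ; x₀   = a
    ; x₀∈h = dot-⨯ˡ (f a) (f b)
    ; g⇒h  = λ x x⊥g → f-det x a b (Z.∝-dot (proj₁ x) N.a⨯b∝h x⊥g)
    ; h⇒g  = λ x x⊥h → Z.∝-dot (proj₁ x) N.h∝a⨯b (f-det⁻¹ x a b x⊥h)
    }
    where
    module N = Z.PerpBasis (Z.perp-basis g g≉0)
    a b : Point 3
    a = N.a , N.a≉0
    b = N.b , N.b≉0
    h≉0 : ¬ (f a ⨯ f b ≋ 0ᵛ)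
    h≉0 eq = N.a∝̸b (f-inj a b (⨯≋0⇒∝ {f a} {f b} eq (f≉0 b)))

  -- If the spans agree, the two basis points of g′^⊥ also lie on g^⊥, and two points determine a
  -- line of the subplane.
  lines-∝ : ∀ {g g′} → ¬ (g Z.≋ Z.0ᵛ) → ¬ (g′ Z.≋ Z.0ᵛ) → (l : Line g) (l′ : Line g′) →
            Line.h l ∝ Line.h l′ → g Z.∝ g′
  lines-∝ {g} {g′} g≉0 g′≉0 l l′ h∝h′ = Z.∝-trans
    (Z.⊥⇒∝⨯ {g} {N.a} {N.b} (⊥g N.a N.a≉0 N.a⊥h) (⊥g N.b N.b≉0 N.b⊥h) N.a⨯b≉0) N.a⨯b∝h
    where
    module N = Z.PerpBasis (Z.perp-basis g′ g′≉0)
    module l = Line l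
    module l′ = Line l′
    ⊥g : ∀ x → ¬ (x Z.≋ Z.0ᵛ) → Z.dot x g′ Z.≈ Z.0# → Z.dot g x Z.≈ Z.0#
    ⊥g x x≉0 x⊥g′ = Z.≈.trans (Z.dot-comm g x)
      (l.h⇒g (x , x≉0) (∝-dot (f (x , x≉0)) h∝h′ (l′.g⇒h (x , x≉0) x⊥g′)))

  f-⊥ : ∀ w x y → proj₁ x Z.∝ proj₁ y → dot (f y) w ≈ 0# → dot (f x) w ≈ 0#
  f-⊥ w x y x∝y y⊥w = ≈.trans (dot-comm (f x) w)
    (∝-dot w (f-cong x y x∝y) (≈.trans (dot-comm w (f y)) y⊥w))

  module _ (w : Vector Carrier 3) (w≉0 : ¬ (w ≋ 0ᵛ)) where
    private
      module W = PerpBasis (perp-basis w w≉0)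
      g : Z.NormalForm 3 → Vector Z.Carrier 3
      g i = Z.normal i

      g≉0 : ∀ i → ¬ (g i Z.≋ Z.0ᵛ)
      g≉0 i = proj₂ (point i)

      l : ∀ i → Line (g i)
      l i = line (g i) (g≉0 i)

      h : Z.NormalForm 3 → Vector Carrier 3
      h i = Line.h (l i)

      -- The line h i meets w^⊥ in the point (h i · b) a - (h i · a) b.
      trace : Z.NormalForm 3 → Vector Carrier 2
      trace i = dot (h i) W.a ∷ dot (h i) W.b ∷ []

      ⊥ab⇒∝w : ∀ v → dot v W.a ≈ 0# → dot v W.b ≈ 0# → v ∝ w
      ⊥ab⇒∝w v v⊥a v⊥b = ∝-trans (⊥⇒∝⨯ {v} {W.a} {W.b} v⊥a v⊥b W.a⨯b≉0) W.a⨯b∝h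

      module _ (missed : ∀ x → ¬ (dot (f x) w ≈ 0#)) where

        -- With zero trace the line h i would be w^⊥ itself, which then contains the subplane point
        -- `x₀` of that line.
        trace≉0 : ∀ i → ¬ (trace i ≋ 0ᵛ)
        trace≉0 i eq = missed (Line.x₀ (l i))
          (∝-dot (f (Line.x₀ (l i))) (∝-sym (Line.h≉0 (l i)) (⊥ab⇒∝w (h i) (eq 0F) (eq 1F))) (Line.x₀∈h (l i)))

        class : ∀ i → ∃ λ k → trace i ∝ normal k
        class i = normal-covers (trace≉0 i)

        -- Let `p` be the common point of the subplane lines i and j. The line d = h i - a h j
        -- belongs to the pencil through f p, and equality of traces makes it orthogonal to both
        -- basis points of w^⊥. So it is w^⊥, which would pass through f p.
        no-collision : ∀ {i j} → i ≢ j → ¬ (trace i ∝ trace j)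
        no-collision {i} {j} i≢j (a , eq) = missed p
          (∝-dot (f p) (∝-sym d≉0 (⊥ab⇒∝w d (d⊥ W.a (eq 0F)) (d⊥ W.b (eq 1F)))) p⊥d)
          where
          p : Point 3
          p = g i Z.⨯ g j , λ gᵢ⨯gⱼ≋0 → i≢j
            (Z.normal-injective (Z.2≤q⇒1≉0 2≤s) (Z.⨯≋0⇒∝ {g i} {g j} gᵢ⨯gⱼ≋0 (g≉0 j)))
          d : Vector Carrier 3
          d = h i ⊕ (- a) • h j
          d≉0 : ¬ (d ≋ 0ᵛ)
          d≉0 d≋0 = i≢j (Z.normal-injective (Z.2≤q⇒1≉0 2≤s) (lines-∝ (g≉0 i) (g≉0 j) (l i) (l j)
            (a , λ k → x-y≈0⇒x≈y (h i k) (a * h j k)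
              (≈.trans (+-congˡ (-‿distribˡ-* a (h j k))) (d≋0 k)))))
          d⊥ : ∀ v → dot (h i) v ≈ a * dot (h j) v → dot d v ≈ 0#
          d⊥ v e = begin
            dot d v                               ≈⟨ dot-⊕ˡ (h i) ((- a) • h j) v ⟩
            dot (h i) v + dot ((- a) • h j) v     ≈⟨ +-cong e (dot-•ˡ (- a) (h j) v) ⟩
            a * dot (h j) v + - a * dot (h j) v   ≈⟨ +-congˡ (≈.sym (-‿distribˡ-* a (dot (h j) v))) ⟩
            a * dot (h j) v + - (a * dot (h j) v) ≈⟨ -‿inverseʳ _ ⟩
            0#                                    ∎
          p⊥d : dot (f p) d ≈ 0#
          p⊥d = begin
            dot (f p) d                           ≈⟨ dot-⊕ʳ (f p) (h i) ((- a) • h j) ⟩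
            dot (f p) (h i) + dot (f p) ((- a) • h j)
              ≈⟨ +-cong (Line.g⇒h (l i) p (Z.≈.trans (Z.dot-comm (g i Z.⨯ g j) (g i)) (Z.dot-⨯ˡ (g i) (g j))))
                        (dot-•ʳ (- a) (f p) (h j)) ⟩
            0# + - a * dot (f p) (h j)
              ≈⟨ +-congˡ (*-congˡ (Line.g⇒h (l j) p (Z.≈.trans (Z.dot-comm (g i Z.⨯ g j) (g j)) (Z.dot-⨯ʳ (g i) (g j))))) ⟩
            0# + - a * 0#                         ≈⟨ ≈.trans (+-identityˡ _) (zeroʳ (- a)) ⟩
            0#                                    ∎

        collision : ∃₂ λ i j → i ≢ j × trace i ∝ trace j
        collision = fromPigeons (Fin.pigeonhole fewer hole)
          where
          to₃ : Fin (Z.points 3) → Z.NormalForm 3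
          to₃ = Inverse.to (Z.NormalForm-↔ 3)
          hole : Fin (Z.points 3) → Fin (points 2)
          hole i = Inverse.from (NormalForm-↔ 2) (proj₁ (class (to₃ i)))
          to₃-≢ : ∀ {i j} → i Fin.< j → to₃ i ≢ to₃ j
          to₃-≢ i<j e = Fin.<⇒≢ i<j (↔-to-injective (Z.NormalForm-↔ 3) _ _ e)
          fromPigeons : (∃₂ λ i j → i Fin.< j × hole i ≡ hole j) → ∃₂ λ i j → i ≢ j × trace i ∝ trace j
          fromPigeons (i , j , i<j , eq) =
            to₃ i , to₃ j , to₃-≢ i<j , ∝-trans (proj₂ (class (to₃ i))) (∝-sym (trace≉0 (to₃ j))
              (≡.subst (λ k → trace (to₃ j) ∝ normal k) (≡.sym (↔-from-injective (NormalForm-↔ 2) (proj₁ (class (to₃ i))) (proj₁ (class (to₃ j))) eq)) (proj₂ (class (to₃ j)))))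
          fewer : points 2 ℕ.< Z.points 3
          fewer = ≡.subst (λ q → q ℕ.^ 1 ℕ.+ (q ℕ.^ 0 ℕ.+ 0) ℕ.< Z.points 3) (≡.sym q≡s²) (line<plane 2≤s)

    -- Every line of PG(2,q) contains a point of the subplane: otherwise two of the
    -- q + √q + 1 lines of the subplane would have the same trace among the q + 1 points of
    -- w^⊥, although any two of them meet inside the subplane.
    meets-line : ∃ λ x → dot (f x) w ≈ 0#
    meets-line with Fin.any? (λ i → dot (f (point (Inverse.to (Z.NormalForm-↔ 3) i))) w ≟ 0#)
    ... | yes (i , eq) = point (Inverse.to (Z.NormalForm-↔ 3) i) , eq
    ... | no  missed   = case collision missed′ of λ where
        (i , j , i≢j , eq) → contradiction eq (no-collision missed′ i≢j)
      where
      missed′ : ∀ x → ¬ (dot (f x) w ≈ 0#)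
      missed′ x x⊥w with i , x∝i ← Z.normal-covers (proj₂ x) = missed (Inverse.from (Z.NormalForm-↔ 3) i ,
        ≡.subst (λ i → dot (f (point i)) w ≈ 0#) (≡.sym (Inverse.strictlyInverseˡ (Z.NormalForm-↔ 3) i))
          (f-⊥ w (point i) x (Z.∝-sym (proj₂ x) x∝i) x⊥w))

    private
      -- If w^⊥ holds two distinct subplane points, `f-det⁻¹` puts all others on their join inside
      -- the subplane; if it holds only one, any subplane line through that point will do.
      containing-line : ∃ λ g → ¬ (g Z.≋ Z.0ᵛ) ×
                                (∀ x → dot (f x) w ≈ 0# → Z.dot (proj₁ x) g Z.≈ Z.0#)
      containing-line = fromFirst meets-line
        where
        fromSecond : ∀ x₀ → dot (f x₀) w ≈ 0# →
                     Dec (∃ λ i → dot (f (point (Inverse.to (Z.NormalForm-↔ 3) i))) w ≈ 0# ×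
                                  ¬ (Z.normal (Inverse.to (Z.NormalForm-↔ 3) i) Z.⨯ proj₁ x₀ Z.≋ Z.0ᵛ)) →
                     ∃ λ g → ¬ (g Z.≋ Z.0ᵛ) × (∀ x → dot (f x) w ≈ 0# → Z.dot (proj₁ x) g Z.≈ Z.0#)
        fromSecond x₀ x₀⊥w (yes (i , x₁⊥w , x₁⨯x₀≉0)) = proj₁ x₁ Z.⨯ proj₁ x₀ , x₁⨯x₀≉0 , λ x x⊥w →
          f-det⁻¹ x x₁ x₀ (common-normal⇒det≈0 w {f x} {f x₁} {f x₀} w≉0
            (≈.trans (dot-comm w (f x)) x⊥w) (≈.trans (dot-comm w (f x₁)) x₁⊥w)
            (≈.trans (dot-comm w (f x₀)) x₀⊥w))
          where
          x₁ : Point 3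
          x₁ = point (Inverse.to (Z.NormalForm-↔ 3) i)
        fromSecond x₀ x₀⊥w (no unique) = N.a , N.a≉0 , λ x x⊥w → Z.≈.trans (Z.dot-comm (proj₁ x) N.a)
            (Z.∝-dot N.a (x∝x₀ x x⊥w (Z.normal-covers (proj₂ x))) N.a⊥h)
          where
          module N = Z.PerpBasis (Z.perp-basis (proj₁ x₀) (proj₂ x₀))
          x∝x₀ : ∀ x → dot (f x) w ≈ 0# → (∃ λ i → proj₁ x Z.∝ Z.normal i) → proj₁ x Z.∝ proj₁ x₀
          x∝x₀ x x⊥w (i , x∝i) = Z.∝-trans x∝i (Z.⨯≋0⇒∝ {Z.normal i} {proj₁ x₀}
            (Dec.decidable-stable (Z.zero? (Z.normal i Z.⨯ proj₁ x₀)) λ ≉0 →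
              unique (Inverse.from (Z.NormalForm-↔ 3) i ,
                ≡.subst (λ i → dot (f (point i)) w ≈ 0# × ¬ (Z.normal i Z.⨯ proj₁ x₀ Z.≋ Z.0ᵛ))
                  (≡.sym (Inverse.strictlyInverseˡ (Z.NormalForm-↔ 3) i))
                  (f-⊥ w (point i) x (Z.∝-sym (proj₂ x) x∝i) x⊥w , ≉0)))
            (proj₂ x₀))
        fromFirst : (∃ λ x → dot (f x) w ≈ 0#) →
                    ∃ λ g → ¬ (g Z.≋ Z.0ᵛ) × (∀ x → dot (f x) w ≈ 0# → Z.dot (proj₁ x) g Z.≈ Z.0#)
        fromFirst (x₀ , x₀⊥w) = fromSecond x₀ x₀⊥w (Fin.any? λ i →
          (dot (f (point (Inverse.to (Z.NormalForm-↔ 3) i))) w ≟ 0#) Dec.×-dec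
          Dec.¬? (Z.zero? (Z.normal (Inverse.to (Z.NormalForm-↔ 3) i) Z.⨯ proj₁ x₀)))

    -- The indices run through F₀², with s² = q elements: the points are e + αa + βb with `a`, `b`
    -- spanning a subplane line g^⊥ and `e` a unit vector off it. All take the same nonzero value on
    -- g, so proportional ones are equal.
    record OffLine : Set (c ⊔ ℓ ⊔ c₀ ⊔ ℓ₀) where
      field
        off       : Fin (s ℕ.^ 2) → Point 3
        off≉0     : ∀ i → dot (f (off i)) w ≉ 0#
        off-inj   : ∀ i j → proj₁ (off i) Z.∝ proj₁ (off j) → i ≡ j

    -- The affine plane left when a line g^⊥ containing all points on w^⊥ is removed.
    off-line : OffLine
    off-line = fromLine containing-line
      where
      fromLine : (∃ λ g → ¬ (g Z.≋ Z.0ᵛ) × (∀ x → dot (f x) w ≈ 0# → Z.dot (proj₁ x) g Z.≈ Z.0#)) → OffLine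
      fromLine (g , g≉0 , on-g) = record
        { off     = λ i → affine i , λ eq → affine∙g≉0 i (Z.dot-zeroˡ {w = g} eq)
        ; off≉0   = λ i i⊥w → affine∙g≉0 i (on-g _ i⊥w)
        ; off-inj = λ i j i∝j → Z.vector-injective {2} (coordinates i j i∝j)
        }
        where
        module N = Z.PerpBasis (Z.perp-basis g g≉0)
        k : Fin 3
        k = proj₁ (Z.nonzero-entry g≉0)
        plane : Fin (s ℕ.^ 2) → Vector Z.Carrier 3
        plane i = Z.vector {2} i 0F Z.• N.a Z.⊕ Z.vector {2} i 1F Z.• N.b
        affine : Fin (s ℕ.^ 2) → Vector Z.Carrier 3
        affine i = Z.unit k Z.⊕ plane i
        affine∙g : ∀ i → Z.dot (affine i) g Z.≈ g k
        affine∙g i = Z.≈.trans (Z.dot-⊕ˡ (Z.unit k) (plane i) g)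
          (Z.≈.trans (Z.+-cong (Z.unit-dot k g) (N.span⇒⊥ (plane i) (Z.≋-refl {v = plane i}))) (Z.+-identityʳ (g k)))
        affine∙g≉0 : ∀ i → Z.dot (affine i) g Z.≉ Z.0#
        affine∙g≉0 i eq = proj₂ (Z.nonzero-entry g≉0) (Z.≈.trans (Z.≈.sym (affine∙g i)) eq)
        coordinates : ∀ i j → affine i Z.∝ affine j → Z.vector {2} i Z.≋ Z.vector {2} j
        coordinates i j (a , eq) = λ where
            0F → proj₁ same
            1F → proj₂ same
          where
          a≈1 : a Z.≈ Z.1#
          a≈1 = Z.*-cancel (proj₂ (Z.nonzero-entry g≉0)) (Z.≈.trans
            (Z.≈.trans (Z.≈.trans (Z.*-congˡ (Z.≈.sym (affine∙g j))) (Z.≈.sym (Z.dot-•ˡ a (affine j) g)))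
              (Z.≈.trans (Z.≈.sym (Z.dot-cong {w = g} eq Z.≋-refl)) (affine∙g i)))
            (Z.≈.sym (Z.*-identityˡ (g k))))
          plane-≋ : plane i Z.≋ plane j
          plane-≋ m = Z.+-cancelˡ (Z.unit k m) _ _ (Z.≈.trans (eq m)
            (Z.≈.trans (Z.*-congʳ a≈1) (Z.*-identityˡ _)))
          same = Z.span-injective {N.a} {N.b} N.a⨯b≉0 plane-≋

  -- A subplane is contained in no line, hence a functional on the plane is determined by its values
  -- on one subplane.
  nonzero-on-plane : ∀ w → (∀ x → dot (f x) w ≈ 0#) → w ≋ 0ᵛ
  nonzero-on-plane w all⊥w = Dec.decidable-stable (zero? w) λ w≉0 →
    let open OffLine (off-line w w≉0) in off≉0 origin (all⊥w (off origin))
    where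
    -- Any index would do; the zero vector supplies one without rewriting `s ^ 2` as a successor.
    origin : Fin (s ℕ.^ 2)
    origin = Z.vectorIndex {2} Z.0ᵛ

-- Coordinates for a Baer subplane of an embedded plane

module BaerSubplane {q s c ℓ c₀ ℓ₀} (F : FiniteField q c ℓ) (F₀ : FiniteField s c₀ ℓ₀)
    (2≤q : 2 ℕ.≤ q) (2≤s : 2 ℕ.≤ s) {n} (G : LinearAlgebra.Matrix F 3 n)
    (G-injective : ∀ y → LinearAlgebra._≋_ F (LinearAlgebra.combination F y G) (LinearAlgebra.0ᵛ F) →
                   LinearAlgebra._≋_ F y (LinearAlgebra.0ᵛ F))
    {b} {B : Pred (Projective.Point F n) b}
    (baer : IsBaerSubplane F F₀ (LinearAlgebra.RowSpace F G) B) where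
  open FieldProperties F
  open LinearAlgebra F
  open VectorProperties F
  open Projective F
  open IsBaerSubplane baer
  private
    module F₀ = FieldProperties F₀
    module P₀ = Projective F₀
    module L₀ = LinearAlgebra F₀
    module Plane = EmbeddedPlane F (2≤q⇒1≉0 2≤q) G G-injective

  ∼-refl : ∀ (x : Point n) → x ∼ x
  ∼-refl x = ≋⇒∝ (≋-refl {v = proj₁ x})

  iso∈B : ∀ x → iso x ∈ B
  iso∈B x = Equivalence.from (image (iso x)) (x , ∼-refl (iso x))

  coordinates : P₀.Point 3 → Vector Carrier 3
  coordinates x = proj₁ (in-plane (iso∈B x))

  iso-coordinates : ∀ x → proj₁ (iso x) ≋ combination (coordinates x) G
  iso-coordinates x = proj₂ (in-plane (iso∈B x))

  private
    unit-injective : ∀ (y : Vector F₀.Carrier 3) → L₀.combination y L₀.unit L₀.≋ L₀.0ᵛ → y L₀.≋ L₀.0ᵛ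
    unit-injective y eq i = F₀.≈.trans (F₀.≈.sym (combination-unit F₀ y i)) (eq i)

    -- PG(2,√q) is regarded as embedded in itself by the identity matrix, so that its collinearity
    -- becomes a determinant condition by the same lemmas.
    module Plane₀ = EmbeddedPlane F₀ (F₀.2≤q⇒1≉0 2≤s) L₀.unit unit-injective

    unit-coordinates : ∀ (x : P₀.Point 3) → proj₁ x L₀.≋ L₀.combination (proj₁ x) L₀.unit
    unit-coordinates x i = F₀.≈.sym (combination-unit F₀ (proj₁ x) i)

  ∼⇒∝ : ∀ x y → iso x ∼ iso y → coordinates x ∝ coordinates y
  ∼⇒∝ x y x∼y = Plane.combination-∝⁻¹ (coordinates x) (coordinates y)
    (∝-trans (≋⇒∝ (≋-sym (iso-coordinates x))) (∝-trans {v = proj₁ (iso y)} x∼y (≋⇒∝ (iso-coordinates y))))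

  ∝⇒∼ : ∀ x y → coordinates x ∝ coordinates y → iso x ∼ iso y
  ∝⇒∼ x y x∝y = ∝-trans (≋⇒∝ (iso-coordinates x)) (∝-trans {w = proj₁ (iso y)}
    (Plane.combination-∝ (coordinates x) (coordinates y) x∝y) (≋⇒∝ (≋-sym (iso-coordinates y))))

  embedding : PlaneEmbedding F F₀
  embedding = record
    { f       = coordinates
    ; f≉0     = λ x eq → proj₂ (iso x) (≋-trans (iso-coordinates x) (combination-zero G eq))
    ; f-cong  = λ x y x∝y → ∼⇒∝ x y (congruent {x} {y} x∝y)
    ; f-inj   = λ x y x∝y → injective {x} {y} (∝⇒∼ x y x∝y)
    ; f-det   = λ x y z det≈0 → Plane.collinear⇒det≈0 (iso x) (iso y) (iso z)
        (coordinates x) (coordinates y) (coordinates z)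
        (iso-coordinates x) (iso-coordinates y) (iso-coordinates z)
        (Equivalence.to (collinear x y z) (Plane₀.det≈0⇒collinear x y z (proj₁ x) (proj₁ y) (proj₁ z)
          (unit-coordinates x) (unit-coordinates y) (unit-coordinates z) det≈0))
    ; f-det⁻¹ = λ x y z det≈0 → Plane₀.collinear⇒det≈0 x y z (proj₁ x) (proj₁ y) (proj₁ z)
        (unit-coordinates x) (unit-coordinates y) (unit-coordinates z)
        (Equivalence.from (collinear x y z) (Plane.det≈0⇒collinear (iso x) (iso y) (iso z)
          (coordinates x) (coordinates y) (coordinates z)
          (iso-coordinates x) (iso-coordinates y) (iso-coordinates z) det≈0))
    }

-- The actions of K on row and column vectors through φ

module FieldAction {q r c ℓ c′ ℓ′} (F : FiniteField q c ℓ) (K : FiniteField r c′ ℓ′)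
    (ι : FiniteField.Carrier F → FiniteField.Carrier K) {n} (M : LinearAlgebra.Matrix F n n)
    (φ : FiniteField.Carrier K → LinearAlgebra.Matrix F n n)
    (φ-iso : FieldExtension.IsAlgebraIsomorphism F K ι M φ) where
  open FieldProperties F
  open LinearAlgebra F
  open VectorProperties F
  open import Relation.Binary.Reasoning.Setoid setoid
  private
    module K = FieldProperties K
    module φ where
      open FieldExtension.IsAlgebraIsomorphism φ-iso public
      open RingMorphisms.IsRingMonomorphism isRingMonomorphism public using (isRingHomomorphism)
      open RingMorphisms.IsRingHomomorphism isRingHomomorphism public

  -- Matrix times column, for blocks of functionals; `coact` is row times matrix, for coordinates of
  -- points of a plane.
  act : K.Carrier → Vector Carrier n → Vector Carrier n
  act k w i = dot (φ k i) w

  coact : K.Carrier → Vector Carrier n → Vector Carrier n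
  coact k a = combination a (φ k)

  act-cong : ∀ k {v w} → v ≋ w → act k v ≋ act k w
  act-cong k {v} {w} eq i = dot-cong {v = φ k i} {w = v} {w} ≋-refl eq

  act-congˡ : ∀ {k l} w → k K.≈ l → act k w ≋ act l w
  act-congˡ {k} {l} w k≈l i = dot-cong {v = φ k i} {φ l i} {w} (φ.⟦⟧-cong k≈l i) ≋-refl

  act-• : ∀ k a w → act k (a • w) ≋ a • act k w
  act-• k a w i = dot-•ʳ a (φ k i) w

  act-+ : ∀ k l w → act (k K.+ l) w ≋ act k w ⊕ act l w
  act-+ k l w i = ≈.trans (dot-cong {v = φ (k K.+ l) i} {φ k i ⊕ φ l i} {w} (φ.+-homo k l i) ≋-refl)
    (dot-⊕ˡ (φ k i) (φ l i) w)

  act-ι : ∀ a k w → act (ι a K.* k) w ≋ a • act k w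
  act-ι a k w i = ≈.trans (dot-cong {v = φ (ι a K.* k) i} {a • φ k i} {w} (φ.linear a k i) ≋-refl)
    (dot-•ˡ a (φ k i) w)

  act-* : ∀ k l w → act (k K.* l) w ≋ act k (act l w)
  act-* k l w i = begin
    dot (φ (k K.* l) i) w                  ≈⟨ dot-cong {v = φ (k K.* l) i} {combination (φ k i) (φ l)} {w} (φ.*-homo k l i) ≋-refl ⟩
    dot (combination (φ k i) (φ l)) w      ≈⟨ dot-comm (combination (φ k i) (φ l)) w ⟩
    dot w (combination (φ k i) (φ l))      ≈⟨ dot-combination w (φ k i) (φ l) ⟩
    dot (φ k i) (λ r → dot w (φ l r))      ≈⟨ dot-cong {v = φ k i} {w = λ r → dot w (φ l r)} {act l w} ≋-refl (λ r → dot-comm w (φ l r)) ⟩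
    dot (φ k i) (act l w)                  ∎

  act-1 : ∀ w → act K.1# w ≋ w
  act-1 w i = ≈.trans (dot-cong {v = φ K.1# i} {unit i} {w} (φ.1#-homo i) ≋-refl) (unit-dot i w)

  act-0 : ∀ k {w} → w ≋ 0ᵛ → act k w ≋ 0ᵛ
  act-0 k {w} w≋0 i = dot-zeroʳ {v = φ k i} {w} w≋0

  act-free : ∀ {k} w → k K.≉ K.0# → act k w ≋ 0ᵛ → w ≋ 0ᵛ
  act-free {k} w k≉0 eq = fromInverse (K.inverse k≉0)
    where
    fromInverse : (∃ λ l → k K.* l K.≈ K.1#) → w ≋ 0ᵛ
    fromInverse (l , kl≈1) i = begin
      w i                   ≈⟨ act-1 w i ⟨
      act K.1# w i          ≈⟨ act-congˡ w (K.≈.trans (K.*-comm l k) kl≈1) i ⟨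
      act (l K.* k) w i     ≈⟨ act-* l k w i ⟩
      act l (act k w) i     ≈⟨ act-0 l {act k w} eq i ⟩
      0#                    ∎

  private
    split : ∀ k l → k K.≈ l K.+ (k K.- l)
    split k l = K.solve 2 (λ k l → k K.:= l K.:+ (k K.:- l)) K.≈.refl k l

  -- Otherwise k - l would be a unit of K annihilating `w`. Splitting k as l + (k - l) uses only
  -- additivity of the action.
  act-injective : ∀ k l w → ¬ (w ≋ 0ᵛ) → act k w ≋ act l w → k K.≈ l
  act-injective k l w w≉0 eq = Dec.decidable-stable (k K.≟ l) λ k≉l →
    w≉0 (act-free w (k≉l ∘ K.x-y≈0⇒x≈y k l) λ i →
      +-cancelˡ (act l w i) (act (k K.- l) w i) 0# (begin
        act l w i + act (k K.- l) w i   ≈⟨ act-+ l (k K.- l) w i ⟨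
        act (l K.+ (k K.- l)) w i       ≈⟨ act-congˡ w (split k l) i ⟨
        act k w i                       ≈⟨ eq i ⟩
        act l w i                       ≈⟨ +-identityʳ _ ⟨
        act l w i + 0#                  ∎))

  coact-congˡ : ∀ {k l} a → k K.≈ l → coact k a ≋ coact l a
  coact-congˡ {k} {l} a k≈l j = dot-cong {v = a} {w = λ i → φ k i j} {λ i → φ l i j} ≋-refl λ i → φ.⟦⟧-cong k≈l i j

  coact-+ : ∀ k l a → coact (k K.+ l) a ≋ coact k a ⊕ coact l a
  coact-+ k l a j = ≈.trans
    (dot-cong {v = a} {w = λ i → φ (k K.+ l) i j} {λ i → φ k i j + φ l i j} ≋-refl λ i → φ.+-homo k l i j)
    (dot-⊕ʳ a (λ i → φ k i j) (λ i → φ l i j))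

  coact-* : ∀ k l a → coact (k K.* l) a ≋ coact l (coact k a)
  coact-* k l a j = begin
    dot a (λ i → φ (k K.* l) i j)
      ≈⟨ dot-cong {v = a} {w = λ i → φ (k K.* l) i j} {λ i → combination (φ k i) (φ l) j} ≋-refl (λ i → φ.*-homo k l i j) ⟩
    dot a (λ i → dot (φ k i) (λ r → φ l r j))
      ≈⟨ dot-cong {v = a} {w = λ i → dot (φ k i) (λ r → φ l r j)} {λ i → dot (λ r → φ l r j) (φ k i)} ≋-refl
           (λ i → dot-comm (φ k i) (λ r → φ l r j)) ⟩
    dot a (λ i → dot (λ r → φ l r j) (φ k i))
      ≈⟨ dot-combination (λ r → φ l r j) a (φ k) ⟨
    dot (λ r → φ l r j) (combination a (φ k))
      ≈⟨ dot-comm (λ r → φ l r j) (combination a (φ k)) ⟩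
    coact l (coact k a) j ∎

  coact-1 : ∀ a → coact K.1# a ≋ a
  coact-1 a j = ≈.trans
    (dot-cong {v = a} {w = λ i → φ K.1# i j} {λ i → unit i j} ≋-refl λ i → φ.1#-homo i j)
    (combination-unit F a j)

  coact-free : ∀ {k} a → k K.≉ K.0# → coact k a ≋ 0ᵛ → a ≋ 0ᵛ
  coact-free {k} a k≉0 eq = fromInverse (K.inverse k≉0)
    where
    fromInverse : (∃ λ l → k K.* l K.≈ K.1#) → a ≋ 0ᵛ
    fromInverse (l , kl≈1) i = begin
      a i                     ≈⟨ coact-1 a i ⟨
      coact K.1# a i          ≈⟨ coact-congˡ a kl≈1 i ⟨
      coact (k K.* l) a i     ≈⟨ coact-* k l a i ⟩
      coact l (coact k a) i   ≈⟨ combination-zero (φ l) eq i ⟩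
      0#                      ∎

  coact-injective : ∀ k l a → ¬ (a ≋ 0ᵛ) → coact k a ≋ coact l a → k K.≈ l
  coact-injective k l a a≉0 eq = Dec.decidable-stable (k K.≟ l) λ k≉l →
    a≉0 (coact-free a (k≉l ∘ K.x-y≈0⇒x≈y k l) λ i →
      +-cancelˡ (coact l a i) (coact (k K.- l) a i) 0# (begin
        coact l a i + coact (k K.- l) a i   ≈⟨ coact-+ l (k K.- l) a i ⟨
        coact (l K.+ (k K.- l)) a i         ≈⟨ coact-congˡ a (split k l) i ⟨
        coact k a i                         ≈⟨ eq i ⟩
        coact l a i                         ≈⟨ +-identityʳ _ ⟨
        coact l a i + 0#                    ∎))

  coact-0 : ∀ a → coact K.0# a ≋ 0ᵛ
  coact-0 a j = dot-zeroʳ {v = a} {λ i → φ K.0# i j} λ i → φ.0#-homo i j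

-- The index of F* in K*

private
  -- The factorisation q³ - 1 = (q² + q + 1)(q - 1), with q = m + 2 to avoid truncated subtraction.
  geometric : ∀ m → let q = suc (suc m) in q ℕ.^ 3 ≡ suc ((q ℕ.^ 2 ℕ.+ q ℕ.+ 1) ℕ.* suc m)
  geometric = lemma
    where
    lemma : ∀ m → (2 ℕ.+ m) ℕ.* ((2 ℕ.+ m) ℕ.* ((2 ℕ.+ m) ℕ.* 1)) ≡
                  1 ℕ.+ ((2 ℕ.+ m) ℕ.* ((2 ℕ.+ m) ℕ.* 1) ℕ.+ (2 ℕ.+ m) ℕ.+ 1) ℕ.* (1 ℕ.+ m)
    lemma = solve-∀

module PrimitiveElement {q c ℓ c′ ℓ′} (F : FiniteField q c ℓ) (K : FiniteField (q ℕ.^ 3) c′ ℓ′)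
    (2≤q : 2 ℕ.≤ q) (ι : FiniteField.Carrier F → FiniteField.Carrier K)
    (ι-mono : RingMorphisms.IsRingMonomorphism (FiniteField.rawRing F) (FiniteField.rawRing K) ι)
    (γ : FiniteField.Carrier K) (γ-primitive : FieldExtension.IsPrimitive F K ι γ) where
  open FieldProperties K
  open import Algebra.Properties.Semiring.Exp semiring using (^-homo-*)
  open import Relation.Binary.Reasoning.Setoid setoid
  private
    module F = FieldProperties F
    module ι = RingMorphisms.IsRingMonomorphism ι-mono

  ι-≉0 : ∀ {x} → x F.≉ F.0# → ι x ≉ 0#
  ι-≉0 {x} x≉0 ιx≈0 = x≉0 (ι.injective (≈.trans ιx≈0 (≈.sym ι.0#-homo)))

  ι⁻¹-≉0 : ∀ {x} → ι x ≉ 0# → x F.≉ F.0#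
  ι⁻¹-≉0 ιx≉0 x≈0 = ιx≉0 (≈.trans (ι.⟦⟧-cong x≈0) ι.0#-homo)

  γ^-≉0 : ∀ n → γ ^ n ≉ 0#
  γ^-≉0 zero    1≈0 = proj₁ γ-primitive (≈.trans (≈.sym (*-identityˡ γ)) (≈.trans (*-congʳ 1≈0) (zeroˡ γ)))
  γ^-≉0 (suc n) = *-≉0 (proj₁ γ-primitive) (γ^-≉0 n)

  -- The exponents of powers of γ lying in F. They are closed under sums and differences, so they
  -- are the multiples of the least positive one.
  InSubfield : ℕ → Set (c ⊔ ℓ′)
  InSubfield n = ∃ λ x → γ ^ n ≈ ι x

  inSubfield? : Unary.Decidable InSubfield
  inSubfield? n = Dec.map′ (λ (i , eq) → F.elements i , eq)
    (λ (x , eq) → F.index x , ≈.trans eq (≈.sym (ι.⟦⟧-cong (F.elements-index x))))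
    (Fin.any? λ i → γ ^ n ≟ ι (F.elements i))

  ratio-inSubfield : ∀ m n {x y} → y F.≉ F.0# → γ ^ (m ℕ.+ n) * ι x ≈ γ ^ m * ι y → x F.≉ F.0# →
                     InSubfield n
  ratio-inSubfield m n {x} {y} y≉0 eq x≉0 = fromInverse (F.inverse x≉0)
    where
    fromInverse : (∃ λ z → x F.* z F.≈ F.1#) → InSubfield n
    fromInverse (z , xz≈1) = y F.* z , *-cancel (γ^-≉0 m) (begin
      γ ^ n * γ ^ m              ≈⟨ *-comm _ _ ⟩
      γ ^ m * γ ^ n              ≈⟨ ^-homo-* γ m n ⟨
      γ ^ (m ℕ.+ n)              ≈⟨ *-identityʳ _ ⟨
      γ ^ (m ℕ.+ n) * 1#         ≈⟨ *-congˡ ι.1#-homo ⟨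
      γ ^ (m ℕ.+ n) * ι F.1#     ≈⟨ *-congˡ (ι.⟦⟧-cong xz≈1) ⟨
      γ ^ (m ℕ.+ n) * ι (x F.* z) ≈⟨ *-congˡ (ι.*-homo x z) ⟩
      γ ^ (m ℕ.+ n) * (ι x * ι z) ≈⟨ *-assoc _ _ _ ⟨
      γ ^ (m ℕ.+ n) * ι x * ι z  ≈⟨ *-congʳ eq ⟩
      γ ^ m * ι y * ι z          ≈⟨ *-assoc _ _ _ ⟩
      γ ^ m * (ι y * ι z)        ≈⟨ *-congˡ (ι.*-homo y z) ⟨
      γ ^ m * ι (y F.* z)        ≈⟨ *-comm _ _ ⟩
      ι (y F.* z) * γ ^ m        ∎)

  private
    power-≉0 : ∀ {n x} → γ ^ n ≈ ι x → x F.≉ F.0#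
    power-≉0 {n} eq = ι⁻¹-≉0 λ ιx≈0 → γ^-≉0 n (≈.trans eq ιx≈0)

    0-inSubfield : InSubfield 0
    0-inSubfield = F.1# , ≈.sym ι.1#-homo

    +-inSubfield : ∀ m n → InSubfield m → InSubfield n → InSubfield (m ℕ.+ n)
    +-inSubfield m n (x , γᵐ≈x) (y , γⁿ≈y) = x F.* y ,
      ≈.trans (^-homo-* γ m n) (≈.trans (*-cong γᵐ≈x γⁿ≈y) (≈.sym (ι.*-homo x y)))

    *-inSubfield : ∀ k n → InSubfield n → InSubfield (k ℕ.* n)
    *-inSubfield zero    n U = 0-inSubfield
    *-inSubfield (suc k) n U = +-inSubfield n (k ℕ.* n) U (*-inSubfield k n U)

    +-cancel-inSubfield : ∀ m n → InSubfield m → InSubfield (m ℕ.+ n) → InSubfield n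
    +-cancel-inSubfield m n (x , γᵐ≈x) (y , γᵐ⁺ⁿ≈y) =
      ratio-inSubfield m n (power-≉0 {m ℕ.+ n} γᵐ⁺ⁿ≈y)
        (≈.trans (*-cong γᵐ⁺ⁿ≈y (≈.sym γᵐ≈x)) (*-comm _ _)) (power-≉0 {m} γᵐ≈x)

    Period : ℕ → Set (c ⊔ ℓ′)
    Period n = 1 ℕ.≤ n × InSubfield n

    -- Among q³ + 1 powers of γ two coincide, and the quotient of these two is 1, which lies in F.
    some-period : ∃ Period
    some-period = fromPigeons (Fin.pigeonhole (ℕ.n<1+n (q ℕ.^ 3)) (λ i → index (γ ^ Fin.toℕ i)))
      where
      fromPigeons : (∃₂ λ i j → i Fin.< j × index (γ ^ Fin.toℕ i) ≡ index (γ ^ Fin.toℕ j)) → ∃ Period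
      fromPigeons (i , j , i<j , eq) = Fin.toℕ j ℕ.∸ Fin.toℕ i , ℕ.m<n⇒0<n∸m i<j ,
        ratio-inSubfield (Fin.toℕ i) (Fin.toℕ j ℕ.∸ Fin.toℕ i) 1≉0 (*-congʳ (begin
          γ ^ (Fin.toℕ i ℕ.+ (Fin.toℕ j ℕ.∸ Fin.toℕ i)) ≡⟨ ≡.cong (γ ^_) (ℕ.m+[n∸m]≡n (ℕ.<⇒≤ i<j)) ⟩
          γ ^ Fin.toℕ j                          ≈⟨ elements-index _ ⟨
          elements (index (γ ^ Fin.toℕ j))       ≡⟨ ≡.cong elements eq ⟨
          elements (index (γ ^ Fin.toℕ i))       ≈⟨ elements-index _ ⟩
          γ ^ Fin.toℕ i                          ∎)) 1≉0
        where 1≉0 = F.2≤q⇒1≉0 2≤q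

    minimal : ∃ λ n → Period n × (∀ k → Period k → n ℕ.≤ k)
    minimal = least (λ n → (1 ℕ.≤? n) Dec.×-dec inSubfield? n) (proj₁ some-period) (proj₂ some-period)

    module MinimalPeriod (N : ℕ) .{{_ : ℕ.NonZero N}} (N-inSubfield : InSubfield N)
        (N-minimal : ∀ k → Period k → N ℕ.≤ k) where
      below-period : ∀ k → InSubfield k → k ℕ.< N → k ≡ 0
      below-period zero    U k<N = refl
      below-period (suc k) U k<N = contradiction (N-minimal (suc k) (s≤s z≤n , U)) (ℕ.<⇒≱ k<N)

      period-∣ : ∀ k → InSubfield k → N ℕ.∣ k
      period-∣ k U = ℕ.m%n≡0⇒n∣m k N (below-period (k ℕ.% N)
        (+-cancel-inSubfield (k ℕ./ N ℕ.* N) (k ℕ.% N) (*-inSubfield (k ℕ./ N) N N-inSubfield)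
          (≡.subst InSubfield (≡.trans (ℕ.m≡m%n+[m/n]*n k N) (ℕ.+-comm (k ℕ.% N) _)) U))
        (ℕ.m%n<n k N))

      -- Each nonzero element of K is γᵉx for exactly one e < N and one nonzero x of F.
      module _ {q′} (q≡1+q′ : q ≡ suc q′) where
        -- Omitted by `punchIn` below, so that `Fin q′` enumerates the nonzero elements of F.
        zeroIndex : Fin (suc q′)
        zeroIndex = ≡.subst Fin q≡1+q′ (F.index F.0#)

        element : Fin (suc q′) → F.Carrier
        element i = F.elements (≡.subst Fin (≡.sym q≡1+q′) i)

        element-injective : ∀ {i j} → element i F.≈ element j → i ≡ j
        element-injective eq = ≡.subst-injective (≡.sym q≡1+q′) (F.elements-injective eq)

        nonzero : Fin q′ → F.Carrier
        nonzero i = element (Fin.punchIn zeroIndex i)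

        element-zero : element zeroIndex F.≈ F.0#
        element-zero = F.≈.trans (F.≈.reflexive (≡.cong F.elements (≡.subst-sym-subst q≡1+q′))) (F.elements-index F.0#)

        element-surjective : ∀ x → ∃ λ i → element i F.≈ x
        element-surjective x = ≡.subst Fin q≡1+q′ (F.index x) ,
          F.≈.trans (F.≈.reflexive (≡.cong F.elements (≡.subst-sym-subst q≡1+q′))) (F.elements-index x)

        nonzero-≉0 : ∀ i → nonzero i F.≉ F.0#
        nonzero-≉0 i eq = Fin.punchInᵢ≢i zeroIndex i (element-injective (F.≈.trans eq (F.≈.sym element-zero)))

        nonzero-surjective : ∀ x → x F.≉ F.0# → ∃ λ i → nonzero i F.≈ x
        nonzero-surjective x x≉0 = fromElement (element-surjective x)
          where
          fromElement : (∃ λ i → element i F.≈ x) → ∃ λ i → nonzero i F.≈ x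
          fromElement (i , eq) = Fin.punchOut z≢i ,
            F.≈.trans (F.≈.reflexive (≡.cong element (Fin.punchIn-punchOut z≢i))) eq
            where
            z≢i : zeroIndex ≢ i
            z≢i z≡i = x≉0 (F.≈.trans (F.≈.sym eq) (F.≈.trans (F.≈.reflexive (≡.cong element (≡.sym z≡i))) element-zero))

        Factorisation : Set
        Factorisation = Fin 1 ⊎ (Fin N × Fin q′)

        value : Factorisation → Carrier
        value (inj₁ _)       = 0#
        value (inj₂ (e , i)) = γ ^ Fin.toℕ e * ι (nonzero i)

        value-≉0 : ∀ e i → value (inj₂ (e , i)) ≉ 0#
        value-≉0 e i = *-≉0 (γ^-≉0 (Fin.toℕ e)) (ι-≉0 (nonzero-≉0 i))

        -- The difference e′ - e is an exponent with power in F and is less than the minimal period,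
        -- so it is 0.
        exponent-≤ : ∀ (e e′ : Fin N) {i i′} → Fin.toℕ e ℕ.≤ Fin.toℕ e′ →
                     value (inj₂ (e , i)) ≈ value (inj₂ (e′ , i′)) → e ≡ e′
        exponent-≤ e e′ {i} {i′} e≤e′ eq = Fin.toℕ-injective (ℕ.≤-antisym e≤e′ (ℕ.m∸n≡0⇒m≤n
          (below-period (Fin.toℕ e′ ℕ.∸ Fin.toℕ e)
            (ratio-inSubfield (Fin.toℕ e) (Fin.toℕ e′ ℕ.∸ Fin.toℕ e) (nonzero-≉0 i)
              (≈.trans (*-congʳ (≈.reflexive (≡.cong (γ ^_) (ℕ.m+[n∸m]≡n e≤e′)))) (≈.sym eq)) (nonzero-≉0 i′))
            (ℕ.≤-<-trans (ℕ.m∸n≤m (Fin.toℕ e′) (Fin.toℕ e)) (Fin.toℕ<n e′)))))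

        exponent-≡ : ∀ e e′ {i i′} → value (inj₂ (e , i)) ≈ value (inj₂ (e′ , i′)) → e ≡ e′
        exponent-≡ e e′ {i} {i′} eq = by-order (ℕ.≤-total (Fin.toℕ e) (Fin.toℕ e′))
          where
          by-order : Fin.toℕ e ℕ.≤ Fin.toℕ e′ ⊎ Fin.toℕ e′ ℕ.≤ Fin.toℕ e → e ≡ e′
          by-order (inj₁ e≤e′) = exponent-≤ e e′ {i} {i′} e≤e′ eq
          by-order (inj₂ e′≤e) = ≡.sym (exponent-≤ e′ e {i′} {i} e′≤e (≈.sym eq))

        value-injective : ∀ x y → value x ≈ value y → x ≡ y
        value-injective (inj₁ zero)    (inj₁ zero)      eq = refl
        value-injective (inj₁ _)       (inj₂ (e , i))   eq = contradiction (≈.sym eq) (value-≉0 e i)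
        value-injective (inj₂ (e , i)) (inj₁ _)         eq = contradiction eq (value-≉0 e i)
        value-injective (inj₂ (e , i)) (inj₂ (e′ , i′)) eq = ≡.cong inj₂ (≡.cong₂ _,_ e≡e′
          (Fin.punchIn-injective zeroIndex i i′ (element-injective (ι.injective
            (*-cancel (γ^-≉0 (Fin.toℕ e)) (≈.trans (*-comm _ _) (≈.trans eq
              (≈.trans (*-congʳ (≈.reflexive (≡.cong (λ e → γ ^ Fin.toℕ e) (≡.sym e≡e′)))) (*-comm _ _)))))))))
          where
          e≡e′ : e ≡ e′
          e≡e′ = exponent-≡ e e′ {i} {i′} eq

        value-surjective : ∀ x → ∃ λ k → value k ≈ x
        value-surjective x = case x ≟ 0# of λ where
            (yes x≈0) → inj₁ zero , ≈.sym x≈0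
            (no  x≉0) → fromPower (proj₂ γ-primitive x x≉0)
          where
          fromPower : (∃ λ n → x ≈ γ ^ n) → ∃ λ k → value k ≈ x
          fromPower (n , x≈γⁿ) = fromQuotient (*-inSubfield (n ℕ./ N) N N-inSubfield)
            where
            fromQuotient : InSubfield (n ℕ./ N ℕ.* N) → ∃ λ k → value k ≈ x
            fromQuotient (y , eq) = fromNonzero (nonzero-surjective y (power-≉0 {n ℕ./ N ℕ.* N} eq))
              where
              fromNonzero : (∃ λ i → nonzero i F.≈ y) → ∃ λ k → value k ≈ x
              fromNonzero (i , i≈y) = inj₂ (Fin.fromℕ< (ℕ.m%n<n n N) , i) , (begin
                γ ^ Fin.toℕ (Fin.fromℕ< (ℕ.m%n<n n N)) * ι (nonzero i)
                  ≈⟨ *-cong (≈.reflexive (≡.cong (γ ^_) (Fin.toℕ-fromℕ< (ℕ.m%n<n n N)))) (ι.⟦⟧-cong i≈y) ⟩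
                γ ^ (n ℕ.% N) * ι y                      ≈⟨ *-congˡ eq ⟨
                γ ^ (n ℕ.% N) * γ ^ (n ℕ./ N ℕ.* N)      ≈⟨ ^-homo-* γ (n ℕ.% N) (n ℕ./ N ℕ.* N) ⟨
                γ ^ (n ℕ.% N ℕ.+ n ℕ./ N ℕ.* N)          ≡⟨ ≡.cong (γ ^_) (ℕ.m≡m%n+[m/n]*n n N) ⟨
                γ ^ n                                    ≈⟨ x≈γⁿ ⟨
                x                                        ∎)

        Factorisation-↔ : Fin (1 ℕ.+ N ℕ.* q′) ↔ Factorisation
        Factorisation-↔ = (mk↔ₛ′ id id (λ _ → refl) (λ _ → refl) ⊎-↔ Fin.*↔×) ↔-∘ Fin.+↔⊎

        -- K is counted twice, by its own enumeration and by the factorisations of its elements.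
        order : q ℕ.^ 3 ≡ 1 ℕ.+ N ℕ.* q′
        order = ℕ.≤-antisym
          (↔-injective⇒≥ Factorisation-↔ (λ i → proj₁ (value-surjective (elements i))) λ {i} {j} eq →
            elements-injective (≈.trans (≈.sym (proj₂ (value-surjective (elements i))))
              (≈.trans (≈.reflexive (≡.cong value eq)) (proj₂ (value-surjective (elements j))))))
          (↔-injective⇒≤ Factorisation-↔ (index ∘ value) λ {x} {y} eq → value-injective x y
            (≈.trans (≈.sym (elements-index (value x))) (≈.trans (≈.reflexive (≡.cong elements eq)) (elements-index (value y)))))

      -- Both numbers multiplied by q - 1 give q³ - 1, by `order` and by `geometric`; since q is at
      -- least 2, the factor cancels.
      period : N ≡ q ℕ.^ 2 ℕ.+ q ℕ.+ 1
      period = fromPredecessor q 2≤q refl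
        where
        fromPredecessor : ∀ n → 2 ℕ.≤ n → q ≡ n → N ≡ q ℕ.^ 2 ℕ.+ q ℕ.+ 1
        fromPredecessor (suc (suc m)) (s≤s (s≤s _)) q≡n = ℕ.*-cancelʳ-≡ N _ (suc m) (ℕ.suc-injective
          (≡.trans (≡.sym (order q≡n)) (≡.subst (λ q → q ℕ.^ 3 ≡ suc ((q ℕ.^ 2 ℕ.+ q ℕ.+ 1) ℕ.* suc m))
            (≡.sym q≡n) (geometric m))))

    period-divides : ∀ k → InSubfield k → q ℕ.^ 2 ℕ.+ q ℕ.+ 1 ℕ.∣ k
    period-divides k U = fromMinimal minimal
      where
      fromMinimal : (∃ λ n → Period n × (∀ k → Period k → n ℕ.≤ k)) → q ℕ.^ 2 ℕ.+ q ℕ.+ 1 ℕ.∣ k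
      fromMinimal (N , (1≤N , N-inSubfield) , N-minimal) = ≡.subst (ℕ._∣ k) M.period (M.period-∣ k U)
        where
        module M = MinimalPeriod N {{ℕ.>-nonZero 1≤N}} N-inSubfield N-minimal

    ∣-difference : ∀ k m n → m ℕ.≤ n → k ℕ.∣ n ℕ.∸ m → + k ℤ.∣ (+ n ℤ.- + m) × + k ℤ.∣ (+ m ℤ.- + n)
    ∣-difference k m n m≤n k∣ =
      ≡.subst (k ℕ.∣_) (≡.sym (≡.trans (≡.cong ℤ.∣_∣ (ℤ.[+m]-[+n]≡m⊖n n m))
        (≡.trans (ℤ.∣m⊖n∣≡∣n⊖m∣ n m) (ℤ.∣⊖∣-≤ m≤n)))) k∣ ,
      ≡.subst (k ℕ.∣_) (≡.sym (≡.trans (≡.cong ℤ.∣_∣ (ℤ.[+m]-[+n]≡m⊖n m n)) (ℤ.∣⊖∣-≤ m≤n))) k∣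

    ratio-≤ : ∀ {m n} → m ℕ.≤ n → ∀ {x y} → x F.≉ F.0# → y F.≉ F.0# → γ ^ n * ι x ≈ γ ^ m * ι y →
              q ℕ.^ 2 ℕ.+ q ℕ.+ 1 ℕ.∣ n ℕ.∸ m
    ratio-≤ {m} {n} m≤n {x} x≉0 y≉0 eq = period-divides (n ℕ.∸ m)
      (ratio-inSubfield m (n ℕ.∸ m) y≉0 (≈.trans (*-congʳ (≈.reflexive (≡.cong (γ ^_) (ℕ.m+[n∸m]≡n m≤n)))) eq) x≉0)

  -- The modulus is the index [K* : F*].
  ratio : ∀ m n {x y} → x F.≉ F.0# → y F.≉ F.0# → γ ^ m * ι x ≈ γ ^ n * ι y →
          + (q ℕ.^ 2 ℕ.+ q ℕ.+ 1) ℤ.∣ (+ n ℤ.- + m)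
  ratio m n x≉0 y≉0 eq = by-order (ℕ.≤-total m n)
    where
    by-order : m ℕ.≤ n ⊎ n ℕ.≤ m → + (q ℕ.^ 2 ℕ.+ q ℕ.+ 1) ℤ.∣ (+ n ℤ.- + m)
    by-order (inj₁ m≤n) = proj₁ (∣-difference _ m n m≤n (ratio-≤ m≤n y≉0 x≉0 (≈.sym eq)))
    by-order (inj₂ n≤m) = proj₂ (∣-difference _ n m n≤m (ratio-≤ n≤m x≉0 y≉0 eq))

-- Indexing of the planes and splitting of vectors into blocks

private
  -- The t + 2 · t(t-1)/2 = t² planes arranged in a square: `P` on the diagonal, `Qᵢ` above it and
  -- `Qⱼ`, with its indices exchanged, below it.
  PlaneIndex-pair : ∀ {t} → PlaneIndex t → Fin t × Fin t
  PlaneIndex-pair (P l)      = l , l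
  PlaneIndex-pair (Qᵢ l m _) = l , m
  PlaneIndex-pair (Qⱼ l m _) = m , l

  PlaneIndex-fromPair : ∀ {t} → Fin t × Fin t → PlaneIndex t
  PlaneIndex-fromPair (l , m) with Fin.<-cmp l m
  ... | tri< l<m _ _ = Qᵢ l m l<m
  ... | tri≈ _ _ _   = P l
  ... | tri> _ _ m<l = Qⱼ m l m<l

  pair-fromPair : ∀ {t} (lm : Fin t × Fin t) → PlaneIndex-pair (PlaneIndex-fromPair lm) ≡ lm
  pair-fromPair (l , m) with Fin.<-cmp l m
  ... | tri< _ _ _    = refl
  ... | tri≈ _ refl _ = refl
  ... | tri> _ _ _    = refl

  fromPair-pair : ∀ {t} (x : PlaneIndex t) → PlaneIndex-fromPair (PlaneIndex-pair x) ≡ x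
  fromPair-pair (P l) with Fin.<-cmp l l
  ... | tri< l<l _ _ = contradiction l<l (Fin.<-irrefl refl)
  ... | tri≈ _ _ _   = refl
  ... | tri> _ _ l<l = contradiction l<l (Fin.<-irrefl refl)
  fromPair-pair (Qᵢ l m l<m) with Fin.<-cmp l m
  ... | tri< l<m′ _ _ = ≡.cong (Qᵢ l m) (Fin.<-irrelevant l<m′ l<m)
  ... | tri≈ _ l≡m _  = contradiction l<m (Fin.<-irrefl l≡m)
  ... | tri> l≮m _ _  = contradiction l<m l≮m
  fromPair-pair (Qⱼ l m l<m) with Fin.<-cmp m l
  ... | tri< _ _ m≯l  = contradiction l<m m≯l
  ... | tri≈ _ m≡l _  = contradiction l<m (Fin.<-irrefl (≡.sym m≡l))
  ... | tri> _ _ l<m′ = ≡.cong (Qⱼ l m) (Fin.<-irrelevant l<m′ l<m)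

PlaneIndex-↔ : ∀ t → PlaneIndex t ↔ (Fin t × Fin t)
PlaneIndex-↔ t = mk↔ₛ′ PlaneIndex-pair PlaneIndex-fromPair pair-fromPair fromPair-pair

module Blocks {q c ℓ} (F : FiniteField q c ℓ) where
  open FieldProperties F
  open LinearAlgebra F
  open VectorProperties F

  block : ∀ {t k} → Vector Carrier (t ℕ.* k) → Fin t → Vector Carrier k
  block u l j = u (Fin.combine l j)

  block-≋ : ∀ {t k} {u v : Vector Carrier (t ℕ.* k)} → (∀ l → block {t} {k} u l ≋ block {t} {k} v l) → u ≋ v
  block-≋ {t} {k} {u} {v} eq i = ≡.subst (λ i → u i ≈ v i) (Fin.combine-remQuot {t} k i)
    (eq (Fin.quotient {t} k i) (Fin.remainder {t} k i))

  concat-combine : ∀ {t k} (xss : Matrix t k) l j → concat xss (Fin.combine l j) ≡ xss l j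
  concat-combine {t} {k} xss l j =
    ≡.cong (λ lj → xss (proj₁ lj) (proj₂ lj)) (Fin.remQuot-combine {t} {k} l j)

  sum-++ : ∀ m {n} (f : Vector Carrier (m ℕ.+ n)) →
           sum f ≈ sum (λ i → f (i Fin.↑ˡ n)) + sum (λ i → f (m Fin.↑ʳ i))
  sum-++ zero    f = ≈.sym (+-identityˡ _)
  sum-++ (suc m) f = ≈.trans (+-congˡ (sum-++ m (f ∘ suc))) (≈.sym (+-assoc _ _ _))

  sum-blocks : ∀ t {k} (f : Vector Carrier (t ℕ.* k)) →
               sum f ≈ sum (λ l → sum (λ j → f (Fin.combine {t} {k} l j)))
  sum-blocks zero    f = ≈.refl
  sum-blocks (suc t) {k} f = ≈.trans (sum-++ k f) (+-congˡ (sum-blocks t (λ i → f (k Fin.↑ʳ i))))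

  dot-concat : ∀ {t k} (u : Vector Carrier (t ℕ.* k)) (xss : Matrix t k) →
               dot u (concat xss) ≈ sum (λ l → dot (block {t} {k} u l) (xss l))
  dot-concat {t} {k} u xss = ≈.trans (sum-blocks t (λ i → u i * concat xss i))
    (sum-cong-≋ λ l → sum-cong-≋ λ j → *-congˡ (≈.reflexive (concat-combine xss l j)))

-- Restriction of functionals to the planes

module ConstructionProperties {q s c ℓ c′ ℓ′ c₀ ℓ₀ b t}
    (F : FiniteField q c ℓ) (K : FiniteField (q ℕ.^ 3) c′ ℓ′) (F₀ : FiniteField s c₀ ℓ₀)
    (q≡s² : q ≡ s ℕ.^ 2) (2≤q : 2 ℕ.≤ q) (2≤s : 2 ℕ.≤ s) (D : Construction F K F₀ t b) where
  open FieldProperties F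
  open LinearAlgebra F
  open VectorProperties F
  open Blocks F
  module D = Construction D
  open D using (γ; φ; ι) renaming (point to rep)
  open FieldAction F K ι D.M φ D.φ-iso
  open import Relation.Binary.Reasoning.Setoid setoid
  private
    module K = FieldProperties K
    module LK = LinearAlgebra K
    module γ = PrimitiveElement F K 2≤q ι D.ι-isRingMonomorphism γ D.γ-primitive
    module φ where
      open FieldExtension.IsAlgebraIsomorphism D.φ-iso public
      open RingMorphisms.IsRingMonomorphism isRingMonomorphism public using (isRingHomomorphism)
      open RingMorphisms.IsRingHomomorphism isRingHomomorphism public

  generator : Vector K.Carrier t → Matrix 3 (t ℕ.* 3)
  generator v r = concat (λ l → φ (v l) r)

  ublock : Vector Carrier (t ℕ.* 3) → Fin t → Vector Carrier 3
  ublock = block {t} {3}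

  -- The functional u restricted to the plane φ̄ v, in the coordinates given by generator v.
  restrict : Vector K.Carrier t → Vector Carrier (t ℕ.* 3) → Vector Carrier 3
  restrict v u r = dot u (generator v r)

  restrict-act : ∀ v u r → restrict v u r ≈ sum (λ l → act (v l) (ublock u l) r)
  restrict-act v u r = ≈.trans (dot-concat u (λ l → φ (v l) r))
    (sum-cong-≋ λ l → dot-comm (ublock u l) (φ (v l) r))

  Q-rep : K.Carrier → Fin t → Fin t → Vector K.Carrier t
  Q-rep k l m = LK.unit l LK.⊕ k LK.• LK.unit m

  private
    act-0ˡ : ∀ w → act K.0# w ≋ 0ᵛ
    act-0ˡ w r = dot-zeroˡ {v = φ K.0# r} {w} (φ.0#-homo r)

    act-unit : ∀ (l m : Fin t) w r → act (LK.unit l m) w r ≈ unit l m * w r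
    act-unit l m w r with does (l Fin.≟ m)
    ... | true  = ≈.trans (act-1 w r) (≈.sym (*-identityˡ _))
    ... | false = ≈.trans (act-0ˡ w r) (≈.sym (zeroˡ _))

    act-•-unit : ∀ k (l m : Fin t) w r → act (k K.* LK.unit l m) w r ≈ unit l m * act k w r
    act-•-unit k l m w r with does (l Fin.≟ m)
    ... | true  = ≈.trans (act-congˡ w (K.*-identityʳ k) r) (≈.sym (*-identityˡ _))
    ... | false = ≈.trans (act-congˡ w (K.zeroʳ k) r) (≈.trans (act-0ˡ w r) (≈.sym (zeroˡ _)))

  restrict-P : ∀ l u → restrict (LK.unit l) u ≋ ublock u l
  restrict-P l u r = begin
    restrict (LK.unit l) u r                        ≈⟨ restrict-act (LK.unit l) u r ⟩
    sum (λ m → act (LK.unit l m) (ublock u m) r)    ≈⟨ sum-cong-≋ (λ m → act-unit l m (ublock u m) r) ⟩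
    dot (unit l) (λ m → ublock u m r)               ≈⟨ unit-dot l (λ m → ublock u m r) ⟩
    ublock u l r                                    ∎

  restrict-Q : ∀ k l m u → restrict (LK.unit l LK.⊕ k LK.• LK.unit m) u ≋ ublock u l ⊕ act k (ublock u m)
  restrict-Q k l m u r = begin
    restrict (LK.unit l LK.⊕ k LK.• LK.unit m) u r
      ≈⟨ restrict-act (LK.unit l LK.⊕ k LK.• LK.unit m) u r ⟩
    sum (λ n → act (LK.unit l n K.+ k K.* LK.unit m n) (ublock u n) r)
      ≈⟨ sum-cong-≋ (λ n → ≈.trans (act-+ (LK.unit l n) (k K.* LK.unit m n) (ublock u n) r)
           (+-cong (act-unit l n (ublock u n) r) (act-•-unit k m n (ublock u n) r))) ⟩
    sum (λ n → unit l n * ublock u n r + unit m n * act k (ublock u n) r)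
      ≈⟨ ∑-distrib-+ (λ n → unit l n * ublock u n r) (λ n → unit m n * act k (ublock u n) r) ⟩
    dot (unit l) (λ n → ublock u n r) + dot (unit m) (λ n → act k (ublock u n) r)
      ≈⟨ +-cong (unit-dot l (λ n → ublock u n r)) (unit-dot m (λ n → act k (ublock u n) r)) ⟩
    ublock u l r + act k (ublock u m) r ∎

  generator-block : ∀ v y l → ublock (combination y (generator v)) l ≋ coact (v l) y
  generator-block v y l j = dot-cong {v = y} {y} {λ r → generator v r (Fin.combine l j)} {λ r → φ (v l) r j}
    ≋-refl (λ r → ≈.reflexive (concat-combine (λ l → φ (v l) r) l j))

  1≉0ₖ : K.1# K.≉ K.0#
  1≉0ₖ eq = γ.γ^-≉0 0 eq

  unit-diagonal : ∀ (l : Fin t) → LK.unit l l K.≈ K.1#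
  unit-diagonal l with l Fin.≟ l
  ... | yes _  = K.≈.refl
  ... | no l≢l = contradiction refl l≢l

  unit-off : ∀ {l m : Fin t} → l ≢ m → LK.unit l m K.≈ K.0#
  unit-off {l} {m} l≢m with l Fin.≟ m
  ... | yes l≡m = contradiction l≡m l≢m
  ... | no _    = K.≈.refl

  module _ {k : K.Carrier} {l m : Fin t} (l<m : l Fin.< m) where
    private
      v : Vector K.Carrier t
      v = LK.unit l LK.⊕ k LK.• LK.unit m

    Q-at-l : v l K.≈ K.1#
    Q-at-l = K.≈.trans (K.+-cong (unit-diagonal l) (K.*-congˡ (unit-off (Fin.<⇒≢ l<m ∘ ≡.sym))))
      (K.≈.trans (K.+-congˡ (K.zeroʳ k)) (K.+-identityʳ K.1#))

    Q-at-m : v m K.≈ k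
    Q-at-m = K.≈.trans (K.+-cong (unit-off (Fin.<⇒≢ l<m)) (K.*-congˡ (unit-diagonal m)))
      (K.≈.trans (K.+-identityˡ _) (K.*-identityʳ k))

    Q-support : ∀ n → v n K.≉ K.0# → n ≡ l ⊎ n ≡ m
    Q-support n vₙ≉0 with n Fin.≟ l | n Fin.≟ m
    ... | yes n≡l | _       = inj₁ n≡l
    ... | no _    | yes n≡m = inj₂ n≡m
    ... | no n≢l  | no n≢m  = contradiction
      (K.≈.trans (K.+-cong (unit-off (n≢l ∘ ≡.sym)) (K.*-congˡ (unit-off (n≢m ∘ ≡.sym))))
        (K.≈.trans (K.+-identityˡ _) (K.zeroʳ k))) vₙ≉0

  anchor : ∀ x → ∃ λ l → rep x l K.≉ K.0#
  anchor (P l)        = l , λ eq → 1≉0ₖ (K.≈.trans (K.≈.sym (unit-diagonal l)) eq)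
  anchor (Qᵢ l m l<m) = l , λ eq → 1≉0ₖ (K.≈.trans (K.≈.sym (Q-at-l l<m)) eq)
  anchor (Qⱼ l m l<m) = l , λ eq → 1≉0ₖ (K.≈.trans (K.≈.sym (Q-at-l l<m)) eq)

  -- At a nonzero coordinate of the representative, the block of the combination is `y` times an
  -- invertible matrix.
  generator-injective : ∀ x y → combination y (generator (rep x)) ≋ 0ᵛ → y ≋ 0ᵛ
  generator-injective x y eq = coact-free y (proj₂ (anchor x)) λ j →
    ≈.trans (≈.sym (generator-block (rep x) y (proj₁ (anchor x)) j)) (eq (Fin.combine (proj₁ (anchor x)) j))

-- Disjointness of the planes and the columns of the generator matrix

module ConstructionPoints {q s c ℓ c′ ℓ′ c₀ ℓ₀ b t}
    (F : FiniteField q c ℓ) (K : FiniteField (q ℕ.^ 3) c′ ℓ′) (F₀ : FiniteField s c₀ ℓ₀)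
    (q≡s² : q ≡ s ℕ.^ 2) (2≤q : 2 ℕ.≤ q) (2≤s : 2 ℕ.≤ s) (D : Construction F K F₀ t b) where
  open FieldProperties F
  open LinearAlgebra F
  open VectorProperties F
  open Projective F
  open ConstructionProperties F K F₀ q≡s² 2≤q 2≤s D
  open D using (γ; φ; ι) renaming (point to rep)
  open FieldAction F K ι D.M φ D.φ-iso
  open import Relation.Binary.Reasoning.Setoid setoid
  private
    module K = FieldProperties K
    module LK = LinearAlgebra K
    module γ = PrimitiveElement F K 2≤q ι D.ι-isRingMonomorphism γ D.γ-primitive
    module P₀ = Projective F₀

  powers-independent : ∀ {l m} → l Fin.< m → ∀ x y → x ≉ 0# → y ≉ 0# →
                       ¬ (γ K.^ D.i l m K.* ι x K.≈ γ K.^ D.j l m K.* ι y)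
  powers-independent {l} {m} l<m x y x≉0 y≉0 eq = D.i-j l m l<m (γ.ratio (D.i l m) (D.j l m) x≉0 y≉0 eq)

  powers-distinct : ∀ {l m} → l Fin.< m → ¬ (γ K.^ D.i l m K.≈ γ K.^ D.j l m)
  powers-distinct l<m eq = powers-independent l<m 1# 1# (2≤q⇒1≉0 2≤q) (2≤q⇒1≉0 2≤q) (K.*-congʳ eq)

  private
    inPlane : PlaneIndex t → Vector Carrier 3 → Vector Carrier (t ℕ.* 3)
    inPlane x y = combination y (generator (rep x))

    -- Block n of a point of φ̄ v is `y` moved by v n, so for `y` nonzero it vanishes only where v n
    -- does. A common point of two planes thus makes the supports of their representatives
    -- comparable.
    support-⊆ : ∀ v v′ y y′ → ¬ (y ≋ 0ᵛ) →
                combination y (generator v) ∝ combination y′ (generator v′) →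
                ∀ n → v n K.≉ K.0# → v′ n K.≉ K.0#
    support-⊆ v v′ y y′ y≉0 (a , eq) n vₙ≉0 v′ₙ≈0 = y≉0 (coact-free y vₙ≉0 λ j → begin
      coact (v n) y j                                         ≈⟨ generator-block v y n j ⟨
      ublock (combination y (generator v)) n j                ≈⟨ eq (Fin.combine n j) ⟩
      a * ublock (combination y′ (generator v′)) n j          ≈⟨ *-congˡ (generator-block v′ y′ n j) ⟩
      a * coact (v′ n) y′ j                                   ≈⟨ *-congˡ (coact-congˡ y′ v′ₙ≈0 j) ⟩
      a * coact K.0# y′ j                                     ≈⟨ *-congˡ (coact-0 y′ j) ⟩
      a * 0#                                                  ≈⟨ zeroʳ a ⟩
      0#                                                      ∎)

    -- Block l, where both representatives have the entry 1, gives y = ay′; block m then shows that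
    -- k and k′ agree on `y`.
    Q-scalar : ∀ k k′ {l m} → l Fin.< m → ∀ y y′ → ¬ (y ≋ 0ᵛ) →
               combination y (generator (Q-rep k l m)) ∝ combination y′ (generator (Q-rep k′ l m)) →
               k K.≈ k′
    Q-scalar k k′ {l} {m} l<m y y′ y≉0 (a , eq) = coact-injective k k′ y y≉0 λ j → begin
      coact k y j                                             ≈⟨ coact-congˡ y (Q-at-m l<m) j ⟨
      coact (v m) y j                                         ≈⟨ at m j ⟩
      a * coact (v′ m) y′ j                                   ≈⟨ *-congˡ (coact-congˡ y′ (Q-at-m l<m) j) ⟩
      a * coact k′ y′ j                                       ≈⟨ combination-• a y′ (φ k′) j ⟨
      coact k′ (a • y′) j                                     ≈⟨ combination-cong {y = y} {a • y′} (φ k′) y≋ay′ j ⟨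
      coact k′ y j                                            ∎
      where
      v v′ : Vector K.Carrier t
      v  = Q-rep k l m
      v′ = Q-rep k′ l m
      at : ∀ n j → coact (v n) y j ≈ a * coact (v′ n) y′ j
      at n j = begin
        coact (v n) y j                                       ≈⟨ generator-block v y n j ⟨
        ublock (combination y (generator v)) n j              ≈⟨ eq (Fin.combine n j) ⟩
        a * ublock (combination y′ (generator v′)) n j        ≈⟨ *-congˡ (generator-block v′ y′ n j) ⟩
        a * coact (v′ n) y′ j                                 ∎
      y≋ay′ : y ≋ a • y′
      y≋ay′ j = begin
        y j                      ≈⟨ coact-1 y j ⟨
        coact K.1# y j           ≈⟨ coact-congˡ y (Q-at-l l<m) j ⟨
        coact (v l) y j          ≈⟨ at l j ⟩
        a * coact (v′ l) y′ j    ≈⟨ *-congˡ (coact-congˡ y′ (Q-at-l l<m) j) ⟩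
        a * coact K.1# y′ j      ≈⟨ *-congˡ (coact-1 y′ j) ⟩
        a * y′ j                 ∎

    P-support : ∀ l n → LK.unit l n K.≉ K.0# → n ≡ l
    P-support l n eq with n Fin.≟ l
    ... | yes n≡l = n≡l
    ... | no  n≢l = contradiction (unit-off (n≢l ∘ ≡.sym)) eq

    -- A support of one element cannot contain the two elements l′ and m′.
    P≉Q : ∀ {l l′ m′ k} (v : Vector K.Carrier t) → (∀ n → v n K.≉ K.0# → n ≡ l) → l′ Fin.< m′ →
          (∀ n → Q-rep k l′ m′ n K.≉ K.0# → v n K.≉ K.0#) → k K.≉ K.0# → ⊥
    P≉Q v only l′<m′ ⊆ k≉0 = Fin.<⇒≢ l′<m′ (≡.trans
      (only _ (⊆ _ λ eq → 1≉0ₖ (K.≈.trans (K.≈.sym (Q-at-l l′<m′)) eq)))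
      (≡.sym (only _ (⊆ _ λ eq → k≉0 (K.≈.trans (K.≈.sym (Q-at-m l′<m′)) eq)))))

    same-pair : ∀ {l m l′ m′ : Fin t} → l Fin.< m → l′ Fin.< m′ →
                l′ ≡ l ⊎ l′ ≡ m → m′ ≡ l ⊎ m′ ≡ m → l ≡ l′ × m ≡ m′
    same-pair l<m l′<m′ (inj₁ refl) (inj₂ refl) = refl , refl
    same-pair l<m l′<m′ (inj₁ refl) (inj₁ refl) = contradiction l′<m′ (Fin.<-irrefl refl)
    same-pair l<m l′<m′ (inj₂ refl) (inj₂ refl) = contradiction l′<m′ (Fin.<-irrefl refl)
    same-pair l<m l′<m′ (inj₂ refl) (inj₁ refl) = contradiction l′<m′ (Fin.<-asym l<m)

    Q-pair : ∀ {k k′ l m l′ m′} → l Fin.< m → l′ Fin.< m′ → k′ K.≉ K.0# →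
             (∀ n → Q-rep k′ l′ m′ n K.≉ K.0# → Q-rep k l m n K.≉ K.0#) → l ≡ l′ × m ≡ m′
    Q-pair {k} {k′} {l} {m} {l′} {m′} l<m l′<m′ k′≉0 ⊆ = same-pair l<m l′<m′
      (Q-support l<m l′ (⊆ l′ λ eq → 1≉0ₖ (K.≈.trans (K.≈.sym (Q-at-l l′<m′)) eq)))
      (Q-support l<m m′ (⊆ m′ λ eq → k′≉0 (K.≈.trans (K.≈.sym (Q-at-m l′<m′)) eq)))

    -- A common point of the two planes. Proportionality is recorded in both directions so that the
    -- relation is symmetric at once, which halves the case analysis of `related⇒≡`.
    PlaneRel : PlaneIndex t → PlaneIndex t → Set _
    PlaneRel x x′ = ∃₂ λ y y′ → ¬ (y ≋ 0ᵛ) × ¬ (y′ ≋ 0ᵛ) × inPlane x y ∝ inPlane x′ y′ × inPlane x′ y′ ∝ inPlane x y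

    support-⊇ : ∀ x x′ → PlaneRel x x′ → ∀ n → rep x′ n K.≉ K.0# → rep x n K.≉ K.0#
    support-⊇ x x′ (y , y′ , y≉0 , y′≉0 , y∝y′ , y′∝y) = support-⊆ (rep x′) (rep x) y′ y y′≉0 y′∝y

    rel-sym : ∀ x x′ → PlaneRel x x′ → PlaneRel x′ x
    rel-sym x x′ (y , y′ , y≉0 , y′≉0 , y∝y′ , y′∝y) = y′ , y , y′≉0 , y≉0 , y′∝y , y∝y′

    Qᵢ-cong : ∀ {l m l′ m′ : Fin t} (l<m : l Fin.< m) (l′<m′ : l′ Fin.< m′) → l ≡ l′ × m ≡ m′ →
              Qᵢ l m l<m ≡ Qᵢ l′ m′ l′<m′
    Qᵢ-cong l<m l′<m′ (refl , refl) = ≡.cong (Qᵢ _ _) (Fin.<-irrelevant l<m l′<m′)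

    Qⱼ-cong : ∀ {l m l′ m′ : Fin t} (l<m : l Fin.< m) (l′<m′ : l′ Fin.< m′) → l ≡ l′ × m ≡ m′ →
              Qⱼ l m l<m ≡ Qⱼ l′ m′ l′<m′
    Qⱼ-cong l<m l′<m′ (refl , refl) = ≡.cong (Qⱼ _ _) (Fin.<-irrelevant l<m l′<m′)

    P-P : ∀ l l′ → PlaneRel (P l) (P l′) → l ≡ l′
    P-P l l′ R = ≡.sym (P-support l l′ (support-⊇ (P l) (P l′) R l′
      λ eq → 1≉0ₖ (K.≈.trans (K.≈.sym (unit-diagonal l′)) eq)))

    P-Qᵢ : ∀ l {l′ m′} (l′<m′ : l′ Fin.< m′) → ¬ PlaneRel (P l) (Qᵢ l′ m′ l′<m′)
    P-Qᵢ l {l′} {m′} l′<m′ R = P≉Q {k = γ K.^ D.i l′ m′} (LK.unit l) (P-support l) l′<m′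
      (support-⊇ (P l) (Qᵢ l′ m′ l′<m′) R) (γ.γ^-≉0 (D.i l′ m′))

    P-Qⱼ : ∀ l {l′ m′} (l′<m′ : l′ Fin.< m′) → ¬ PlaneRel (P l) (Qⱼ l′ m′ l′<m′)
    P-Qⱼ l {l′} {m′} l′<m′ R = P≉Q {k = γ K.^ D.j l′ m′} (LK.unit l) (P-support l) l′<m′
      (support-⊇ (P l) (Qⱼ l′ m′ l′<m′) R) (γ.γ^-≉0 (D.j l′ m′))

    Qᵢ-Qⱼ : ∀ {l m l′ m′ : Fin t} (l<m : l Fin.< m) (l′<m′ : l′ Fin.< m′) →
            ¬ PlaneRel (Qᵢ l m l<m) (Qⱼ l′ m′ l′<m′)
    Qᵢ-Qⱼ {l} {m} {l′} {m′} l<m l′<m′ R = same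
      (Q-pair {γ K.^ D.i l m} {γ K.^ D.j l′ m′} l<m l′<m′ (γ.γ^-≉0 (D.j l′ m′))
        (support-⊇ (Qᵢ l m l<m) (Qⱼ l′ m′ l′<m′) R)) l′<m′ R
      where
      same : ∀ {l′ m′ : Fin t} → l ≡ l′ × m ≡ m′ → (l′<m′ : l′ Fin.< m′) → ¬ PlaneRel (Qᵢ l m l<m) (Qⱼ l′ m′ l′<m′)
      same (refl , refl) l′<m′ (y , y′ , y≉0 , _ , y∝y′ , _) =
        powers-distinct l<m (Q-scalar (γ K.^ D.i l m) (γ K.^ D.j l m) l<m y y′ y≉0 y∝y′)

    related⇒≡ : ∀ x x′ → PlaneRel x x′ → x ≡ x′
    related⇒≡ (P l) (P l′) R = ≡.cong P (P-P l l′ R)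
    related⇒≡ (P l) (Qᵢ _ _ l′<m′) R = ⊥-elim (P-Qᵢ l l′<m′ R)
    related⇒≡ (P l) (Qⱼ _ _ l′<m′) R = ⊥-elim (P-Qⱼ l l′<m′ R)
    related⇒≡ (Qᵢ l m l<m) (P l′) R = ⊥-elim (P-Qᵢ l′ l<m (rel-sym (Qᵢ l m l<m) (P l′) R))
    related⇒≡ (Qⱼ l m l<m) (P l′) R = ⊥-elim (P-Qⱼ l′ l<m (rel-sym (Qⱼ l m l<m) (P l′) R))
    related⇒≡ (Qᵢ l m l<m) (Qᵢ l′ m′ l′<m′) R = Qᵢ-cong l<m l′<m′
      (Q-pair {γ K.^ D.i l m} {γ K.^ D.i l′ m′} l<m l′<m′ (γ.γ^-≉0 (D.i l′ m′))
        (support-⊇ (Qᵢ l m l<m) (Qᵢ l′ m′ l′<m′) R))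
    related⇒≡ (Qⱼ l m l<m) (Qⱼ l′ m′ l′<m′) R = Qⱼ-cong l<m l′<m′
      (Q-pair {γ K.^ D.j l m} {γ K.^ D.j l′ m′} l<m l′<m′ (γ.γ^-≉0 (D.j l′ m′))
        (support-⊇ (Qⱼ l m l<m) (Qⱼ l′ m′ l′<m′) R))
    related⇒≡ (Qᵢ l m l<m) (Qⱼ l′ m′ l′<m′) R = ⊥-elim (Qᵢ-Qⱼ l<m l′<m′ R)
    related⇒≡ (Qⱼ l m l<m) (Qᵢ l′ m′ l′<m′) R =
      ⊥-elim (Qᵢ-Qⱼ l′<m′ l<m (rel-sym (Qⱼ l m l<m) (Qᵢ l′ m′ l′<m′) R))

  planes-disjoint : ∀ x x′ y y′ → ¬ (y ≋ 0ᵛ) →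
                    combination y (generator (rep x)) ∝ combination y′ (generator (rep x′)) → x ≡ x′
  planes-disjoint x x′ y y′ y≉0 y∝y′ = related⇒≡ x x′ (y , y′ , y≉0 , y′≉0 , y∝y′ , y′∝y)
    where
    y′∝y : inPlane x′ y′ ∝ inPlane x y
    y′∝y = ∝-sym (y≉0 ∘ generator-injective x y) y∝y′
    y′≉0 : ¬ (y′ ≋ 0ᵛ)
    y′≉0 y′≋0 = y≉0 (generator-injective x y (≋-trans (proj₂ y∝y′)
      λ j → ≈.trans (*-congˡ (combination-zero (generator (rep x′)) y′≋0 j)) (zeroʳ (proj₁ y∝y′))))

  B : PlaneIndex t → Fin 2 → Pred (Point (t ℕ.* 3)) b
  B x 0F = D.B₁ x
  B x 1F = D.B₂ x

  baer : ∀ x e → IsBaerSubplane F F₀ (D.φ̄ (rep x)) (B x e)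
  baer x 0F = D.B₁-baer x
  baer x 1F = D.B₂-baer x

  module Subplane (x : PlaneIndex t) (e : Fin 2) where
    open IsBaerSubplane (baer x e) public using (iso; respects; image; congruent)
    open BaerSubplane F F₀ 2≤q 2≤s (generator (rep x)) (generator-injective x) (baer x e) public
    open PlaneEmbeddingProperties F F₀ q≡s² 2≤s embedding public
    open PlaneEmbedding embedding public using (f≉0)

    module _ (w : Vector Carrier 3) (w≉0 : ¬ (w ≋ 0ᵛ)) where
      open OffLine (off-line w w≉0) public using (off; off≉0; off-inj)
  open Subplane using (iso; coordinates)

  -- In turn: distinct planes are disjoint, the two subplanes of one plane are disjoint, and `iso`
  -- is injective on each subplane.
  slots-injective : ∀ x e p x′ e′ p′ → iso x e p ∼ iso x′ e′ p′ →
                    (x , e) ≡ (x′ , e′) × p P₀.∼ p′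
  slots-injective x e p x′ e′ p′ p∼p′ = same-plane x′ e′ p′ p∼p′ (planes-disjoint x x′
      (coordinates x e p) (coordinates x′ e′ p′) (Subplane.f≉0 x e p)
      (∝-trans (≋⇒∝ (≋-sym (Subplane.iso-coordinates x e p)))
        (∝-trans {v = proj₁ (iso x′ e′ p′)} p∼p′ (≋⇒∝ (Subplane.iso-coordinates x′ e′ p′)))))
    where
    same-subplane : ∀ e e′ p p′ → iso x e p ∼ iso x e′ p′ → e ≡ e′
    same-subplane 0F 0F p p′ p∼p′ = refl
    same-subplane 1F 1F p p′ p∼p′ = refl
    same-subplane 0F 1F p p′ p∼p′ = ⊥-elim (D.disjoint x {iso x 1F p′}
      (Subplane.respects x 0F {iso x 0F p} {iso x 1F p′} p∼p′ (Subplane.iso∈B x 0F p)) (Subplane.iso∈B x 1F p′))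
    same-subplane 1F 0F p p′ p∼p′ = ⊥-elim (D.disjoint x {iso x 0F p′}
      (Subplane.iso∈B x 0F p′) (Subplane.respects x 1F {iso x 1F p} {iso x 0F p′} p∼p′ (Subplane.iso∈B x 1F p)))
    same-plane : ∀ x′ e′ p′ → iso x e p ∼ iso x′ e′ p′ → x ≡ x′ → (x , e) ≡ (x′ , e′) × p P₀.∼ p′
    same-plane x′ e′ p′ p∼p′ refl = same-point e′ p′ p∼p′ (same-subplane e e′ p p′ p∼p′)
      where
      same-point : ∀ e′ p′ → iso x e p ∼ iso x e′ p′ → e ≡ e′ → (x , e) ≡ (x , e′) × p P₀.∼ p′
      same-point e′ p′ p∼p′ refl = refl , IsBaerSubplane.injective (baer x e) {p} {p′} p∼p′

  column : Fin D.n → Vector Carrier (t ℕ.* 3)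
  column i = proj₁ (D.column i)

  columnOf-∼ : ∀ x e p → ∃ λ i → proj₁ (iso x e p) ∝ column i
  columnOf-∼ x 0F p = D.column-sur {iso x 0F p} (x , inj₁ (Subplane.iso∈B x 0F p))
  columnOf-∼ x 1F p = D.column-sur {iso x 1F p} (x , inj₂ (Subplane.iso∈B x 1F p))

  columnOf : PlaneIndex t → Fin 2 → P₀.Point 3 → Fin D.n
  columnOf x e p = proj₁ (columnOf-∼ x e p)

  columnOf-injective : ∀ x e p x′ e′ p′ → columnOf x e p ≡ columnOf x′ e′ p′ →
                       (x , e) ≡ (x′ , e′) × p P₀.∼ p′
  columnOf-injective x e p x′ e′ p′ eq = slots-injective x e p x′ e′ p′
    (∝-trans (proj₂ (columnOf-∼ x e p)) (∝-sym (proj₂ (iso x′ e′ p′))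
      (≡.subst (λ i → proj₁ (iso x′ e′ p′) ∝ column i) (≡.sym eq) (proj₂ (columnOf-∼ x′ e′ p′)))))

  dot-iso : ∀ u x e p → dot u (proj₁ (iso x e p)) ≈ dot (coordinates x e p) (restrict (rep x) u)
  dot-iso u x e p = ≈.trans (dot-cong {v = u} {u} {proj₁ (iso x e p)} {inPlane x (coordinates x e p)}
      ≋-refl (Subplane.iso-coordinates x e p))
    (dot-combination u (coordinates x e p) (generator (rep x)))

  column⊥⇒ : ∀ u x e p → dot u (column (columnOf x e p)) ≈ 0# →
             dot (coordinates x e p) (restrict (rep x) u) ≈ 0#
  column⊥⇒ u x e p eq = ≈.trans (≈.sym (dot-iso u x e p)) (∝-dot u (proj₂ (columnOf-∼ x e p)) eq)

  ⇒column⊥ : ∀ u x e p → dot (coordinates x e p) (restrict (rep x) u) ≈ 0# →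
             dot u (column (columnOf x e p)) ≈ 0#
  ⇒column⊥ u x e p eq = ∝-dot u (∝-sym (proj₂ (iso x e p)) (proj₂ (columnOf-∼ x e p))) (≈.trans (dot-iso u x e p) eq)

-- Supports and row spaces

module Support {q c ℓ} (F : FiniteField q c ℓ) where
  open FieldProperties F
  open LinearAlgebra F
  open Code F

  private
    not-does⁻¹ : ∀ {a} {A : Set a} (A? : Dec A) → not (does A?) ≡ true → ¬ A
    not-does⁻¹ (no ¬A) eq = ¬A

  ∈-support : ∀ {n} (v : Vector Carrier n) i → v i ≉ 0# → i ∈ₛ support v
  ∈-support v i vᵢ≉0 = Vec.lookup⇒[]= i (support v)
    (≡.trans (Vec.lookup∘tabulate _ i) (≡.cong not (Dec.dec-false (v i ≟ 0#) vᵢ≉0)))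

  support-∈ : ∀ {n} (v : Vector Carrier n) i → i ∈ₛ support v → v i ≉ 0#
  support-∈ v i i∈ = not-does⁻¹ (v i ≟ 0#) (≡.trans (≡.sym (Vec.lookup∘tabulate _ i)) (Vec.[]=⇒lookup i∈))

  weight-cong : ∀ {n} {v w : Vector Carrier n} → v ≋ w → weight v ≡ weight w
  weight-cong {v = v} {w} v≋w = ≡.cong ∣_∣ (Vec.tabulate-cong λ i → ≡.cong not
    (Dec.does-⇔ (mk⇔ (≈.trans (≈.sym (v≋w i))) (≈.trans (v≋w i))) (v i ≟ 0#) (w i ≟ 0#)))

module RowSpaceProperties {q c ℓ} (F : FiniteField q c ℓ) where
  open FieldProperties F
  open LinearAlgebra F
  open VectorProperties F

  rowSpace-isSubspace : ∀ {m n} (A : Matrix m n) → IsSubspace (RowSpace A)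
  rowSpace-isSubspace A = record
    { respects = λ { v≋w (x , v≋xA) → x , ≋-trans (≋-sym v≋w) v≋xA }
    ; 0-closed = 0ᵛ , ≋-sym (combination-zero {y = 0ᵛ} A ≋-refl)
    ; ⊕-closed = λ { (x , v≋xA) (y , w≋yA) → x ⊕ y , λ i →
                     ≈.trans (+-cong (v≋xA i) (w≋yA i)) (≈.sym (combination-⊕ x y A i)) }
    ; •-closed = λ { a (x , v≋xA) → a • x , λ i →
                     ≈.trans (*-congˡ (v≋xA i)) (≈.sym (combination-• a x A i)) }
    }

  independent⇒dimension : ∀ {m n k} (A : Matrix m n) → LinearlyIndependent A → k ≡ m →
                          HasDimension (RowSpace A) k
  independent⇒dimension A independent refl = A , independent , λ v → mk⇔ id id

-- Dimension and minimality of the code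

module ConstructionMinimality {q s c ℓ c′ ℓ′ c₀ ℓ₀ b t}
    (F : FiniteField q c ℓ) (K : FiniteField (q ℕ.^ 3) c′ ℓ′) (F₀ : FiniteField s c₀ ℓ₀)
    (q≡s² : q ≡ s ℕ.^ 2) (2≤q : 2 ℕ.≤ q) (2≤s : 2 ℕ.≤ s) (D : Construction F K F₀ t b) where
  open FieldProperties F
  open LinearAlgebra F
  open VectorProperties F
  open CrossProduct F
  open Projective F
  open Blocks F
  open Code F
  open Support F
  open ConstructionProperties F K F₀ q≡s² 2≤q 2≤s D
  open ConstructionPoints F K F₀ q≡s² 2≤q 2≤s D
  open Subplane using (iso; coordinates)
  open D using (γ; φ; ι) renaming (point to rep)
  open FieldAction F K ι D.M φ D.φ-iso
  open import Relation.Binary.Reasoning.Setoid setoid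
  private
    module K = FieldProperties K
    module γ = PrimitiveElement F K 2≤q ι D.ι-isRingMonomorphism γ D.γ-primitive

  generatorMatrix : Matrix (t ℕ.* 3) D.n
  generatorMatrix = transpose column

  codeword : Vector Carrier (t ℕ.* 3) → Vector Carrier D.n
  codeword u = combination u generatorMatrix

  -- On P l the restriction of `u` is its block l, and it vanishes on a whole subplane, which lies
  -- in no line.
  independent : LinearlyIndependent generatorMatrix
  independent u eq = block-≋ {t} {3} {u} {0ᵛ} λ l → ≋-trans (≋-sym (restrict-P l u))
    (Subplane.nonzero-on-plane (P l) 0F (restrict (rep (P l)) u) λ p →
      column⊥⇒ u (P l) 0F p (eq (columnOf (P l) 0F p)))

  -- Inclusion of the support of the codeword of `w` in that of `u`, in contrapositive form.
  Dominates : Vector Carrier (t ℕ.* 3) → Vector Carrier (t ℕ.* 3) → Set ℓ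
  Dominates u w = ∀ i → dot u (column i) ≈ 0# → dot w (column i) ≈ 0#

  module _ (u w : Vector Carrier (t ℕ.* 3)) (u≻w : Dominates u w) where
    private
      ⊥u⇒⊥w : ∀ x e p → dot (coordinates x e p) (restrict (rep x) u) ≈ 0# →
              dot (coordinates x e p) (restrict (rep x) w) ≈ 0#
      ⊥u⇒⊥w x e p ⊥u = column⊥⇒ w x e p (u≻w (columnOf x e p) (⇒column⊥ u x e p ⊥u))

    -- On a plane, the line on which u vanishes contains a point of each of the two
    -- disjoint subplanes, and w vanishes at both.
    restrict-∝ : ∀ x → restrict (rep x) w ∝ restrict (rep x) u
    restrict-∝ x = by-zero (zero? U)
      where
      U V : Vector Carrier 3
      U = restrict (rep x) u
      V = restrict (rep x) w
      crossing : ¬ (U ≋ 0ᵛ) → (∃ λ p → dot (coordinates x 0F p) U ≈ 0#) →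
                 (∃ λ p → dot (coordinates x 1F p) U ≈ 0#) → V ∝ U
      crossing U≉0 (p₀ , p₀⊥U) (p₁ , p₁⊥U) =
        ∝-trans {v = y₀ ⨯ y₁} (⊥⇒∝⨯ {V} {y₀} {y₁} (flip y₀ V (⊥u⇒⊥w x 0F p₀ p₀⊥U)) (flip y₁ V (⊥u⇒⊥w x 1F p₁ p₁⊥U)) y₀⨯y₁≉0)
          (∝-sym U≉0 (⊥⇒∝⨯ {U} {y₀} {y₁} (flip y₀ U p₀⊥U) (flip y₁ U p₁⊥U) y₀⨯y₁≉0))
        where
        y₀ y₁ : Vector Carrier 3
        y₀ = coordinates x 0F p₀
        y₁ = coordinates x 1F p₁
        flip : ∀ (y v : Vector Carrier 3) → dot y v ≈ 0# → dot v y ≈ 0#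
        flip y v eq = ≈.trans (dot-comm v y) eq
        iso-∼ : y₀ ∝ y₁ → iso x 0F p₀ ∼ iso x 1F p₁
        iso-∼ (a , eq) = ∝-trans (≋⇒∝ (Subplane.iso-coordinates x 0F p₀)) (∝-trans {w = proj₁ (iso x 1F p₁)}
          (a , ≋-trans (combination-cong {y = y₀} {a • y₁} (generator (rep x)) eq) (combination-• a y₁ (generator (rep x))))
          (≋⇒∝ (≋-sym (Subplane.iso-coordinates x 1F p₁))))
        y₀⨯y₁≉0 : ¬ (y₀ ⨯ y₁ ≋ 0ᵛ)
        y₀⨯y₁≉0 eq = case proj₁ (slots-injective x 0F p₀ x 1F p₁
          (iso-∼ (⨯≋0⇒∝ {y₀} {y₁} eq (Subplane.f≉0 x 1F p₁)))) of λ ()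
      by-zero : Dec (U ≋ 0ᵛ) → V ∝ U
      by-zero (no U≉0)  = crossing U≉0 (Subplane.meets-line x 0F U U≉0) (Subplane.meets-line x 1F U U≉0)
      by-zero (yes U≋0) = 0# , λ r → ≈.trans (V≋0 r) (≈.sym (zeroˡ (U r)))
        where
        V≋0 : V ≋ 0ᵛ
        V≋0 = Subplane.nonzero-on-plane x 0F V λ p →
          ⊥u⇒⊥w x 0F p (dot-zeroʳ {v = coordinates x 0F p} U≋0)

    private
      u[_] w[_] : Fin t → Vector Carrier 3
      u[ l ] = ublock u l
      w[ l ] = ublock w l

      block-∝ : ∀ l → w[ l ] ∝ u[ l ]
      block-∝ l = fromPlane (restrict-∝ (P l))
        where
        fromPlane : restrict (rep (P l)) w ∝ restrict (rep (P l)) u → w[ l ] ∝ u[ l ]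
        fromPlane (a , eq) = a , λ r → ≈.trans (≈.sym (restrict-P l w r))
          (≈.trans (eq r) (*-congˡ (restrict-P l u r)))

      -- The hypothesis rearranges to (a - e)x = (e - b)ky. If a = e, then e = b because ky is
      -- nonzero, against a ≉ b. So x = d(ky) with d = (e - b)/(a - e), and d is nonzero because x
      -- is.
      mixed : ∀ k x y a b e → ¬ (x ≋ 0ᵛ) → ¬ (act k y ≋ 0ᵛ) → a ≉ b →
              a • x ⊕ act k (b • y) ≋ e • (x ⊕ act k y) →
              ∃ λ d → d ≉ 0# × x ≋ act (k K.* ι d) y
      mixed k x y a b e x≉0 ky≉0 a≉b eq = fromInverse (inverse a-e≉0)
        where
        balance : (a - e) • x ≋ (e - b) • act k y
        balance r = x-y≈0⇒x≈y _ _ (begin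
          (a - e) * x r - (e - b) * act k y r
            ≈⟨ solve 5 (λ a b e x y → (a :- e) :* x :- (e :- b) :* y :=
                 a :* x :+ b :* y :- e :* (x :+ y)) ≈.refl a b e (x r) (act k y r) ⟩
          a * x r + b * act k y r - e * (x r + act k y r)
            ≈⟨ +-congʳ (+-congˡ (≈.sym (act-• k b y r))) ⟩
          a * x r + act k (b • y) r - e * (x r + act k y r)
            ≈⟨ x≈y⇒x-y≈0 (eq r) ⟩
          0# ∎)
        cancel : ∀ z (v : Vector Carrier 3) → ¬ (v ≋ 0ᵛ) → z • v ≋ 0ᵛ → z ≈ 0#
        cancel z v v≉0 zv≋0 = Dec.decidable-stable (z ≟ 0#) λ z≉0 → v≉0 λ r → *-zero-product (zv≋0 r) z≉0
        a-e≉0 : a - e ≉ 0#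
        a-e≉0 a-e≈0 = a≉b (≈.trans (x-y≈0⇒x≈y a e a-e≈0) (x-y≈0⇒x≈y e b (cancel (e - b) (act k y) ky≉0
          λ r → ≈.trans (≈.sym (balance r)) (≈.trans (*-congʳ a-e≈0) (zeroˡ (x r))))))
        fromInverse : (∃ λ z → (a - e) * z ≈ 1#) → ∃ λ d → d ≉ 0# × x ≋ act (k K.* ι d) y
        fromInverse (z , [a-e]z≈1) = z * (e - b) , d≉0 , λ r → begin
            x r                               ≈⟨ x≋ r ⟩
            z * (e - b) * act k y r           ≈⟨ act-ι (z * (e - b)) k y r ⟨
            act (ι (z * (e - b)) K.* k) y r   ≈⟨ act-congˡ y (K.*-comm (ι (z * (e - b))) k) r ⟩
            act (k K.* ι (z * (e - b))) y r   ∎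
          where
          x≋ : x ≋ (z * (e - b)) • act k y
          x≋ r = begin
            x r                               ≈⟨ *-identityˡ _ ⟨
            1# * x r                          ≈⟨ *-congʳ [a-e]z≈1 ⟨
            (a - e) * z * x r                 ≈⟨ solve 3 (λ d z x → d :* z :* x := z :* (d :* x)) ≈.refl (a - e) z (x r) ⟩
            z * ((a - e) * x r)               ≈⟨ *-congˡ (balance r) ⟩
            z * ((e - b) * act k y r)         ≈⟨ *-assoc _ _ _ ⟨
            z * (e - b) * act k y r           ∎
          d≉0 : z * (e - b) ≉ 0#
          d≉0 d≈0 = x≉0 λ r → ≈.trans (x≋ r) (≈.trans (*-congʳ d≈0) (zeroˡ _))

      on-Q : ∀ k {l m a b} → w[ l ] ≋ a • u[ l ] → w[ m ] ≋ b • u[ m ] →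
             restrict (Q-rep k l m) w ∝ restrict (Q-rep k l m) u →
             ∃ λ e → a • u[ l ] ⊕ act k (b • u[ m ]) ≋ e • (u[ l ] ⊕ act k u[ m ])
      on-Q k {l} {m} {a} {b} wₗ wₘ (e , eq) = e , λ r → begin
        a * u[ l ] r + act k (b • u[ m ]) r
          ≈⟨ +-cong (≈.sym (wₗ r)) (act-cong k {b • u[ m ]} {w[ m ]} (≋-sym wₘ) r) ⟩
        w[ l ] r + act k w[ m ] r                ≈⟨ restrict-Q k l m w r ⟨
        restrict (Q-rep k l m) w r               ≈⟨ eq r ⟩
        e * restrict (Q-rep k l m) u r           ≈⟨ *-congˡ (restrict-Q k l m u r) ⟩
        e * (u[ l ] r + act k u[ m ] r)          ∎

      equal-< : ∀ {l m a b} → l Fin.< m → ¬ (u[ l ] ≋ 0ᵛ) → ¬ (u[ m ] ≋ 0ᵛ) →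
                w[ l ] ≋ a • u[ l ] → w[ m ] ≋ b • u[ m ] → a ≈ b
      equal-< {l} {m} {a} {b} l<m uₗ≉0 uₘ≉0 wₗ wₘ = Dec.decidable-stable (a ≟ b) λ a≉b →
        incompatible (proportional a≉b (D.i l m) (restrict-∝ (Qᵢ l m l<m)))
                     (proportional a≉b (D.j l m) (restrict-∝ (Qⱼ l m l<m)))
        where
        proportional : a ≉ b → ∀ h → restrict (Q-rep (γ K.^ h) l m) w ∝ restrict (Q-rep (γ K.^ h) l m) u →
                       ∃ λ d → d ≉ 0# × u[ l ] ≋ act (γ K.^ h K.* ι d) u[ m ]
        proportional a≉b h R = fromRelation (on-Q (γ K.^ h) wₗ wₘ R)
          where
          fromRelation : (∃ λ e → a • u[ l ] ⊕ act (γ K.^ h) (b • u[ m ]) ≋ e • (u[ l ] ⊕ act (γ K.^ h) u[ m ])) →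
                         ∃ λ d → d ≉ 0# × u[ l ] ≋ act (γ K.^ h K.* ι d) u[ m ]
          fromRelation (e , eq) = mixed (γ K.^ h) u[ l ] u[ m ] a b e uₗ≉0
            (uₘ≉0 ∘ act-free u[ m ] (γ.γ^-≉0 h)) a≉b eq
        incompatible : (∃ λ d → d ≉ 0# × u[ l ] ≋ act (γ K.^ D.i l m K.* ι d) u[ m ]) →
                       (∃ λ d → d ≉ 0# × u[ l ] ≋ act (γ K.^ D.j l m K.* ι d) u[ m ]) → ⊥
        incompatible (d , d≉0 , eq) (d′ , d′≉0 , eq′) = powers-independent l<m d d′ d≉0 d′≉0
          (act-injective (γ K.^ D.i l m K.* ι d) (γ K.^ D.j l m K.* ι d′) u[ m ] uₘ≉0 (≋-trans (≋-sym eq) eq′))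

      equal : ∀ l m {a b} → ¬ (u[ l ] ≋ 0ᵛ) → ¬ (u[ m ] ≋ 0ᵛ) →
              w[ l ] ≋ a • u[ l ] → w[ m ] ≋ b • u[ m ] → a ≈ b
      equal l m {a} {b} uₗ≉0 uₘ≉0 wₗ wₘ = by-order (Fin.<-cmp l m)
        where
        by-order : _ → a ≈ b
        by-order (tri< l<m _ _)    = equal-< l<m uₗ≉0 uₘ≉0 wₗ wₘ
        by-order (tri> _ _ m<l)    = ≈.sym (equal-< m<l uₘ≉0 uₗ≉0 wₘ wₗ)
        by-order (tri≈ _ refl _)   = same (nonzero-entry uₗ≉0)
          where
          same : (∃ λ r → u[ l ] r ≉ 0#) → a ≈ b
          same (r , uᵣ≉0) = *-cancel uᵣ≉0 (≈.trans (≈.sym (wₗ r)) (wₘ r))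

    -- The scalar is taken from one nonzero block of `u`. The other nonzero blocks share it by
    -- `equal`; where a block of `u` is zero, so is that of `w`, and every scalar fits.
    dominated⇒∝ : ¬ (u ≋ 0ᵛ) → w ∝ u
    dominated⇒∝ u≉0 = fromBlock nonzero-block
      where
      nonzero-block : ∃ λ l → ¬ (u[ l ] ≋ 0ᵛ)
      nonzero-block = Fin.¬∀⟶∃¬ _ _ (λ l → zero? u[ l ]) (u≉0 ∘ block-≋ {t} {3} {u} {0ᵛ})
      fromBlock : (∃ λ l → ¬ (u[ l ] ≋ 0ᵛ)) → w ∝ u
      fromBlock (l , uₗ≉0) = a , block-≋ {t} {3} {w} {a • u} λ m → at m (zero? u[ m ])
        where
        a : Carrier
        a = proj₁ (block-∝ l)
        at : ∀ m → Dec (u[ m ] ≋ 0ᵛ) → w[ m ] ≋ a • u[ m ]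
        at m (yes uₘ≋0) r = ≈.trans (proj₂ (block-∝ m) r) (≈.trans (≈.trans (*-congˡ (uₘ≋0 r)) (zeroʳ _))
          (≈.sym (≈.trans (*-congˡ (uₘ≋0 r)) (zeroʳ a))))
        at m (no uₘ≉0) r = ≈.trans (proj₂ (block-∝ m) r)
          (*-congʳ (equal m l uₘ≉0 uₗ≉0 (proj₂ (block-∝ m)) (proj₂ (block-∝ l))))

  isMinimalCode : IsMinimalCode D.𝒟
  isMinimalCode v (u , v≋u) v≉0 w′ (w , w′≋w) σw⊆σv = fromScalar (dominated⇒∝ u w u≻w u≉0)
    where
    u≉0 : ¬ (u ≋ 0ᵛ)
    u≉0 u≋0 = v≉0 (≋-trans v≋u (combination-zero generatorMatrix u≋0))
    u≻w : Dominates u w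
    u≻w i ui≈0 = Dec.decidable-stable (dot w (column i) ≟ 0#) λ wi≉0 →
      support-∈ v i (σw⊆σv (∈-support w′ i (wi≉0 ∘ ≈.trans (≈.sym (w′≋w i))))) (≈.trans (v≋u i) ui≈0)
    fromScalar : w ∝ u → ∃ λ a → w′ ≋ a • v
    fromScalar (a , w≋au) = a , λ i → begin
      w′ i                   ≈⟨ w′≋w i ⟩
      codeword w i           ≈⟨ combination-cong {y = w} {a • u} generatorMatrix w≋au i ⟩
      codeword (a • u) i     ≈⟨ combination-• a u generatorMatrix i ⟩
      a * codeword u i       ≈⟨ *-congˡ (v≋u i) ⟨
      a * v i                ∎

-- Minimum weight and length of the code

module ConstructionWeight {q s c ℓ c′ ℓ′ c₀ ℓ₀ b t′}
    (F : FiniteField q c ℓ) (K : FiniteField (q ℕ.^ 3) c′ ℓ′) (F₀ : FiniteField s c₀ ℓ₀)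
    (q≡s² : q ≡ s ℕ.^ 2) (2≤q : 2 ℕ.≤ q) (2≤s : 2 ℕ.≤ s) (D : Construction F K F₀ (suc t′) b) where
  open FieldProperties F
  open LinearAlgebra F
  open VectorProperties F
  open Blocks F
  open Code F
  open Support F
  open ConstructionProperties F K F₀ q≡s² 2≤q 2≤s D
  open ConstructionPoints F K F₀ q≡s² 2≤q 2≤s D
  open ConstructionMinimality F K F₀ q≡s² 2≤q 2≤s D
  open Subplane using (iso; coordinates)
  open D using (γ; φ; ι) renaming (point to rep)
  open FieldAction F K ι D.M φ D.φ-iso
  open import Relation.Binary.Reasoning.Setoid setoid
  private
    module K = FieldProperties K
    module γ = PrimitiveElement F K 2≤q ι D.ι-isRingMonomorphism γ D.γ-primitive
    module P₀ = Projective F₀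
    module Z = VectorProperties F₀
    t : ℕ
    t = suc t′

  module _ (u : Vector Carrier (t ℕ.* 3)) (l₀ : Fin t) (u₀≉0 : ¬ (ublock u l₀ ≋ 0ᵛ)) where
    private
      u[_] : Fin t → Vector Carrier 3
      u[ l ] = ublock u l

      Nonvanishing : PlaneIndex t → Set ℓ
      Nonvanishing x = ¬ (restrict (rep x) u ≋ 0ᵛ)

      -- The index other than l₀ of a plane that involves l₀.
      partner : Fin t → Fin t → Fin t
      partner l m = [ (λ _ → m) , (λ _ → l) ] (Dec.toSum (l Fin.≟ l₀))

      -- Recovers the index `o` from each of the two planes chosen for it, so that planes chosen for
      -- different indices are different.
      other : PlaneIndex t → Fin t
      other (P m)      = m
      other (Qᵢ l m _) = partner l m
      other (Qⱼ l m _) = partner l m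

      -- The pair {l₀, o} in one of its two orders; the Q planes exist only for l < m, so l₀ can be
      -- either index.
      Opposite : Fin t → Fin t → Fin t → Set
      Opposite o l m = (l ≡ l₀ × m ≡ o) ⊎ (l ≡ o × m ≡ l₀)

      partner-≡ : ∀ {o} l m → o ≢ l₀ → Opposite o l m → partner l m ≡ o
      partner-≡ l m o≢l₀ opp with l Fin.≟ l₀ | opp
      ... | yes _    | inj₁ (_ , m≡o)    = m≡o
      ... | no l≢l₀  | inj₁ (l≡l₀ , _)   = contradiction l≡l₀ l≢l₀
      ... | yes l≡l₀ | inj₂ (l≡o , _)    = contradiction (≡.trans (≡.sym l≡o) l≡l₀) o≢l₀
      ... | no _     | inj₂ (l≡o , _)    = l≡o

      record TwoPlanes (o : Fin t) : Set (ℓ) where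
        constructor twoPlanes
        field
          plane         : Fin 2 → PlaneIndex t
          distinct      : plane 0F ≢ plane 1F
          other≡o       : ∀ e → other (plane e) ≡ o
          nonvanishing  : ∀ e → Nonvanishing (plane e)

      nonvanishing-P : ∀ o → ¬ (u[ o ] ≋ 0ᵛ) → Nonvanishing (P o)
      nonvanishing-P o uₒ≉0 eq = uₒ≉0 (≋-trans (≋-sym (restrict-P o u)) eq)

      vanishing-Q : ∀ k l m → restrict (Q-rep k l m) u ≋ 0ᵛ → u[ l ] ⊕ act k u[ m ] ≋ 0ᵛ
      vanishing-Q k l m eq = ≋-trans (≋-sym (restrict-Q k l m u)) eq

      -- When u[ o ] is zero only the term of l₀ is left, possibly moved by the unit `k` of K.
      nonvanishing-Q : ∀ {k o} l m → k K.≉ K.0# → Opposite o l m → u[ o ] ≋ 0ᵛ →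
                       ¬ (restrict (Q-rep k l m) u ≋ 0ᵛ)
      nonvanishing-Q {k} l m k≉0 (inj₁ (refl , refl)) uₒ≋0 eq = u₀≉0 λ r → begin
        u[ l₀ ] r                        ≈⟨ +-identityʳ _ ⟨
        u[ l₀ ] r + 0#                   ≈⟨ +-congˡ (act-0 k {u[ m ]} uₒ≋0 r) ⟨
        u[ l₀ ] r + act k u[ m ] r       ≈⟨ vanishing-Q k l₀ m eq r ⟩
        0#                               ∎
      nonvanishing-Q {k} l m k≉0 (inj₂ (refl , refl)) uₒ≋0 eq = u₀≉0 (act-free u[ l₀ ] k≉0 λ r → begin
        act k u[ l₀ ] r                  ≈⟨ +-identityˡ _ ⟨
        0# + act k u[ l₀ ] r             ≈⟨ +-congʳ (uₒ≋0 r) ⟨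
        u[ l ] r + act k u[ l₀ ] r       ≈⟨ vanishing-Q k l l₀ eq r ⟩
        0#                               ∎)

      second-nonzero : ∀ {o} l m → Opposite o l m → ¬ (u[ o ] ≋ 0ᵛ) → ¬ (u[ m ] ≋ 0ᵛ)
      second-nonzero l m (inj₁ (_ , refl)) uₒ≉0 = uₒ≉0
      second-nonzero l m (inj₂ (_ , refl)) uₒ≉0 = u₀≉0

      -- If both restrictions vanish, then γⁱuₘ = -uₗ = γʲuₘ, and freeness of the action gives γⁱ =
      -- γʲ.
      not-both : ∀ {l m} → l Fin.< m → ¬ (u[ m ] ≋ 0ᵛ) →
                 restrict (Q-rep (γ K.^ D.i l m) l m) u ≋ 0ᵛ → ¬ (restrict (Q-rep (γ K.^ D.j l m) l m) u ≋ 0ᵛ)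
      not-both {l} {m} l<m uₘ≉0 eqᵢ eqⱼ = powers-distinct l<m
        (act-injective (γ K.^ D.i l m) (γ K.^ D.j l m) u[ m ] uₘ≉0 λ r → +-cancelˡ (u[ l ] r) _ _
          (≈.trans (vanishing-Q (γ K.^ D.i l m) l m eqᵢ r) (≈.sym (vanishing-Q (γ K.^ D.j l m) l m eqⱼ r))))

      pair : PlaneIndex t → PlaneIndex t → Fin 2 → PlaneIndex t
      pair x y 0F = x
      pair x y 1F = y

      -- If u[ o ] is zero, the two Q planes serve; otherwise P o does, together with whichever Q
      -- plane has nonzero restriction.
      two-planes-< : ∀ {o l m} → o ≢ l₀ → l Fin.< m → Opposite o l m → TwoPlanes o
      two-planes-< {o} {l} {m} o≢l₀ l<m opp = by-zero (zero? u[ o ])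
        where
        partner≡o : partner l m ≡ o
        partner≡o = partner-≡ l m o≢l₀ opp
        by-zero : Dec (u[ o ] ≋ 0ᵛ) → TwoPlanes o
        by-zero (yes uₒ≋0) = twoPlanes (pair (Qᵢ l m l<m) (Qⱼ l m l<m)) (λ ())
          (λ { 0F → partner≡o ; 1F → partner≡o })
          (λ { 0F → nonvanishing-Q l m (γ.γ^-≉0 (D.i l m)) opp uₒ≋0
             ; 1F → nonvanishing-Q l m (γ.γ^-≉0 (D.j l m)) opp uₒ≋0 })
        by-zero (no uₒ≉0) = by-Qᵢ (zero? (restrict (rep (Qᵢ l m l<m)) u))
          where
          by-Qᵢ : Dec (restrict (rep (Qᵢ l m l<m)) u ≋ 0ᵛ) → TwoPlanes o
          by-Qᵢ (no Qᵢ≉0) = twoPlanes (pair (P o) (Qᵢ l m l<m)) (λ ())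
            (λ { 0F → refl ; 1F → partner≡o }) (λ { 0F → nonvanishing-P o uₒ≉0 ; 1F → Qᵢ≉0 })
          by-Qᵢ (yes Qᵢ≋0) = twoPlanes (pair (P o) (Qⱼ l m l<m)) (λ ())
            (λ { 0F → refl ; 1F → partner≡o })
            (λ { 0F → nonvanishing-P o uₒ≉0 ; 1F → not-both l<m (second-nonzero l m opp uₒ≉0) Qᵢ≋0 })

      two-planes : ∀ o → o ≢ l₀ → TwoPlanes o
      two-planes o o≢l₀ = by-order (Fin.<-cmp l₀ o)
        where
        by-order : _ → TwoPlanes o
        by-order (tri< l₀<o _ _) = two-planes-< o≢l₀ l₀<o (inj₁ (refl , refl))
        by-order (tri≈ _ l₀≡o _) = contradiction (≡.sym l₀≡o) o≢l₀
        by-order (tri> _ _ o<l₀) = two-planes-< o≢l₀ o<l₀ (inj₂ (refl , refl))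

      two : (o : Fin t′) → TwoPlanes (Fin.punchIn l₀ o)
      two o = two-planes (Fin.punchIn l₀ o) (Fin.punchInᵢ≢i l₀ o)

      -- The 2t - 1 chosen planes: P l₀, and two for each of the t′ = t - 1 other indices, which
      -- `punchIn l₀` enumerates.
      Choice : Set
      Choice = Fin 1 ⊎ (Fin t′ × Fin 2)

      planes : Choice → PlaneIndex t
      planes (inj₁ _)       = P l₀
      planes (inj₂ (o , e)) = TwoPlanes.plane (two o) e

      planes-nonvanishing : ∀ x → Nonvanishing (planes x)
      planes-nonvanishing (inj₁ _)       = nonvanishing-P l₀ u₀≉0
      planes-nonvanishing (inj₂ (o , e)) = TwoPlanes.nonvanishing (two o) e

      planes-other : ∀ o e → other (planes (inj₂ (o , e))) ≡ Fin.punchIn l₀ o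
      planes-other o e = TwoPlanes.other≡o (two o) e

      planes-injective : ∀ x y → planes x ≡ planes y → x ≡ y
      planes-injective (inj₁ 0F) (inj₁ 0F) eq = refl
      planes-injective (inj₁ _) (inj₂ (o , e)) eq = contradiction
        (≡.trans (≡.sym (planes-other o e)) (≡.cong other (≡.sym eq))) (Fin.punchInᵢ≢i l₀ o)
      planes-injective (inj₂ (o , e)) (inj₁ _) eq = contradiction
        (≡.trans (≡.sym (planes-other o e)) (≡.cong other eq)) (Fin.punchInᵢ≢i l₀ o)
      planes-injective (inj₂ (o , e)) (inj₂ (o′ , e′)) eq = same o′ e e′ eq (Fin.punchIn-injective l₀ o o′
        (≡.trans (≡.sym (planes-other o e)) (≡.trans (≡.cong other eq) (planes-other o′ e′))))
        where
        same : ∀ o′ e e′ → planes (inj₂ (o , e)) ≡ planes (inj₂ (o′ , e′)) → o ≡ o′ →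
               _≡_ {A = Choice} (inj₂ (o , e)) (inj₂ (o′ , e′))
        same o′ 0F 0F eq refl = refl
        same o′ 1F 1F eq refl = refl
        same o′ 0F 1F eq refl = contradiction eq (TwoPlanes.distinct (two o))
        same o′ 1F 0F eq refl = contradiction (≡.sym eq) (TwoPlanes.distinct (two o))

      Slot : Set
      Slot = Choice × (Fin 2 × Fin (s ℕ.^ 2))

      Slot-↔ : Fin ((1 ℕ.+ t′ ℕ.* 2) ℕ.* (2 ℕ.* s ℕ.^ 2)) ↔ Slot
      Slot-↔ = (((mk↔ₛ′ id id (λ _ → refl) (λ _ → refl) ⊎-↔ Fin.*↔×) ↔-∘ Fin.+↔⊎) ×-↔ Fin.*↔×) ↔-∘ Fin.*↔×

      offPoint : Choice → Fin 2 → Fin (s ℕ.^ 2) → P₀.Point 3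
      offPoint x e = Subplane.off (planes x) e (restrict (rep (planes x)) u) (planes-nonvanishing x)

      slotColumn : Slot → Fin D.n
      slotColumn (x , e , i) = columnOf (planes x) e (offPoint x e i)

      slotColumn-injective : ∀ a a′ → slotColumn a ≡ slotColumn a′ → a ≡ a′
      slotColumn-injective (x , e , i) (x′ , e′ , i′) eq = same-plane (columnOf-injective
          (planes x) e (offPoint x e i) (planes x′) e′ (offPoint x′ e′ i′) eq)
        where
        same-point : ∀ x′ e′ i′ → x ≡ x′ → e ≡ e′ → offPoint x e i P₀.∼ offPoint x′ e′ i′ →
                     _≡_ {A = Slot} (x , e , i) (x′ , e′ , i′)
        same-point x′ e′ i′ refl refl p∼p′ = ≡.cong (λ i → x , e , i)
          (Subplane.off-inj (planes x) e (restrict (rep (planes x)) u) (planes-nonvanishing x) i i′ p∼p′)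
        same-plane : (planes x , e) ≡ (planes x′ , e′) × offPoint x e i P₀.∼ offPoint x′ e′ i′ →
                     _≡_ {A = Slot} (x , e , i) (x′ , e′ , i′)
        same-plane (eq , p∼p′) = same-point x′ e′ i′
          (planes-injective x x′ (≡.cong proj₁ eq)) (≡.cong proj₂ eq) p∼p′

    block-weight-≥ : (1 ℕ.+ t′ ℕ.* 2) ℕ.* (2 ℕ.* s ℕ.^ 2) ℕ.≤ weight (codeword u)
    block-weight-≥ = injection⇒≤∣p∣ (support (codeword u)) Slot-↔ slotColumn
      (λ {a} {a′} → slotColumn-injective a a′) λ { (x , e , i) → ∈-support (codeword u) (slotColumn (x , e , i))
        (Subplane.off≉0 (planes x) e (restrict (rep (planes x)) u) (planes-nonvanishing x) i ∘
          column⊥⇒ u (planes x) e (offPoint x e i)) }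

  weight-≥ : ∀ u → ¬ (u ≋ 0ᵛ) → (1 ℕ.+ t′ ℕ.* 2) ℕ.* (2 ℕ.* s ℕ.^ 2) ℕ.≤ weight (codeword u)
  weight-≥ u u≉0 = fromBlock (Fin.¬∀⟶∃¬ _ _ (λ l → zero? (ublock u l)) (u≉0 ∘ block-≋ {t} {3} {u} {0ᵛ}))
    where
    fromBlock : (∃ λ l → ¬ (ublock u l ≋ 0ᵛ)) → (1 ℕ.+ t′ ℕ.* 2) ℕ.* (2 ℕ.* s ℕ.^ 2) ℕ.≤ weight (codeword u)
    fromBlock (l , uₗ≉0) = block-weight-≥ u l uₗ≉0

  private
    -- Quantified over the finitely many messages rather than over the vectors of the code; this
    -- makes it decidable, so that the minimum weight is found by search.
    Attained : ℕ → Set ℓ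
    Attained d = ∃ λ (i : Fin (q ℕ.^ (t ℕ.* 3))) →
      ¬ (codeword (vector {t ℕ.* 3} i) ≋ 0ᵛ) × weight (codeword (vector {t ℕ.* 3} i)) ≡ d

    attained? : Unary.Decidable Attained
    attained? d = Fin.any? λ i → Dec.¬? (zero? (codeword (vector {t ℕ.* 3} i))) Dec.×-dec
                                 (weight (codeword (vector {t ℕ.* 3} i)) ℕ.≟ d)

    attained : ∀ u v → v ≋ codeword u → ¬ (v ≋ 0ᵛ) → Attained (weight v)
    attained u v v≋u v≉0 = vectorIndex {t ℕ.* 3} u , (λ eq → v≉0 (≋-trans v≋u′ eq)) , ≡.sym (weight-cong v≋u′)
      where
      u′ : Vector Carrier (t ℕ.* 3)
      u′ = vector {t ℕ.* 3} (vectorIndex {t ℕ.* 3} u)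
      v≋u′ : v ≋ codeword u′
      v≋u′ = ≋-trans v≋u (combination-cong {y = u} {u′} generatorMatrix (≋-sym (vector-index {t ℕ.* 3} u)))

  minimum-weight : ∃ λ d → HasMinimumWeight D.𝒟 d × (1 ℕ.+ t′ ℕ.* 2) ℕ.* (2 ℕ.* s ℕ.^ 2) ℕ.≤ d
  minimum-weight = fromLeast (least attained? (weight (codeword e₀)) (attained e₀ (codeword e₀) ≋-refl codeword≉0))
    where
    -- A nonzero message, whose codeword is nonzero by independence; its weight starts the search.
    e₀ : Vector Carrier (t ℕ.* 3)
    e₀ = unit zero
    codeword≉0 : ¬ (codeword e₀ ≋ 0ᵛ)
    codeword≉0 eq = 2≤q⇒1≉0 2≤q (independent e₀ eq zero)
    fromLeast : (∃ λ d → Attained d × (∀ k → Attained k → d ℕ.≤ k)) →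
                ∃ λ d → HasMinimumWeight D.𝒟 d × (1 ℕ.+ t′ ℕ.* 2) ℕ.* (2 ℕ.* s ℕ.^ 2) ℕ.≤ d
    fromLeast (d , (i , cᵢ≉0 , wᵢ≡d) , d-least) = d ,
      ( (codeword uᵢ , (uᵢ , ≋-refl) , cᵢ≉0 , wᵢ≡d)
      , λ { v (u , v≋u) v≉0 → d-least (weight v) (attained u v v≋u v≉0) } ) ,
      ≡.subst ((1 ℕ.+ t′ ℕ.* 2) ℕ.* (2 ℕ.* s ℕ.^ 2) ℕ.≤_) wᵢ≡d
        (weight-≥ uᵢ (λ uᵢ≋0 → cᵢ≉0 (combination-zero generatorMatrix uᵢ≋0)))
      where
      uᵢ : Vector Carrier (t ℕ.* 3)
      uᵢ = vector {t ℕ.* 3} i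

  -- Injections in both directions: every column is located in some subplane, and distinct places
  -- have distinct columns. `Z.points 3` is q + √q + 1.
  length-≡ : D.n ≡ (t ℕ.* t) ℕ.* (2 ℕ.* Z.points 3)
  length-≡ = ℕ.≤-antisym
    (↔-injective⇒≥ Place-↔ place λ {i} {j} → place-injective i j)
    (↔-injective⇒≤ Place-↔ placeColumn λ {a} {a′} → placeColumn-injective a a′)
    where
    Place : Set
    Place = (Fin t × Fin t) × (Fin 2 × Z.NormalForm 3)

    Place-↔ : Fin ((t ℕ.* t) ℕ.* (2 ℕ.* Z.points 3)) ↔ Place
    Place-↔ = (Fin.*↔× ×-↔ ((mk↔ₛ′ id id (λ _ → refl) (λ _ → refl) ×-↔ Z.NormalForm-↔ 3) ↔-∘ Fin.*↔×)) ↔-∘ Fin.*↔×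

    normalPoint : Z.NormalForm 3 → P₀.Point 3
    normalPoint k = Z.normal k , Z.normal-nonzero (FieldProperties.2≤q⇒1≉0 F₀ 2≤s) k

    index′ : Fin t × Fin t → PlaneIndex t
    index′ = Inverse.from (PlaneIndex-↔ t)

    placeColumn : Place → Fin D.n
    placeColumn (lm , e , k) = columnOf (index′ lm) e (normalPoint k)

    placeColumn-injective : ∀ a a′ → placeColumn a ≡ placeColumn a′ → a ≡ a′
    placeColumn-injective (lm , e , k) (lm′ , e′ , k′) eq = combine (columnOf-injective
        (index′ lm) e (normalPoint k) (index′ lm′) e′ (normalPoint k′) eq)
      where
      combine : (index′ lm , e) ≡ (index′ lm′ , e′) × normalPoint k P₀.∼ normalPoint k′ →
                _≡_ {A = Place} (lm , e , k) (lm′ , e′ , k′)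
      combine (eq , k∼k′) = ≡.cong₂ _,_ (↔-from-injective (PlaneIndex-↔ t) lm lm′ (≡.cong proj₁ eq))
        (≡.cong₂ _,_ (≡.cong proj₂ eq) (Z.normal-injective (FieldProperties.2≤q⇒1≉0 F₀ 2≤s) {3} {k} {k′} k∼k′))

    Located : Fin D.n → PlaneIndex t → Fin 2 → Z.NormalForm 3 → Set (c ⊔ ℓ)
    Located i x e k = column i ∝ proj₁ (iso x e (normalPoint k))

    locate : ∀ i → ∃ λ x → ∃₂ λ e k → Located i x e k
    locate i = fromUnion (D.column-∈ i)
      where
      fromImage : ∀ x e → (∃ λ p → column i ∝ proj₁ (iso x e p)) → ∃ λ x → ∃₂ λ e k → Located i x e k
      fromImage x e (p , i∼p) = fromNormal (Z.normal-covers (proj₂ p))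
        where
        fromNormal : (∃ λ k → proj₁ p Z.∝ Z.normal k) → ∃ λ x → ∃₂ λ e k → Located i x e k
        fromNormal (k , p∝k) = x , e , k ,
          ∝-trans {v = proj₁ (iso x e p)} i∼p (Subplane.congruent x e {p} {normalPoint k} p∝k)
      fromUnion : D.Union (D.column i) → ∃ λ x → ∃₂ λ e k → Located i x e k
      fromUnion (x , inj₁ i∈B) = fromImage x 0F (Equivalence.to (Subplane.image x 0F (D.column i)) i∈B)
      fromUnion (x , inj₂ i∈B) = fromImage x 1F (Equivalence.to (Subplane.image x 1F (D.column i)) i∈B)

    place : Fin D.n → Place
    place i = Inverse.to (PlaneIndex-↔ t) (proj₁ (locate i)) , proj₁ (proj₂ (locate i)) , proj₁ (proj₂ (proj₂ (locate i)))

    place-injective : ∀ i j → place i ≡ place j → i ≡ j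
    place-injective i j eq = same (proj₂ (proj₂ (proj₂ (locate i)))) (proj₂ (proj₂ (proj₂ (locate j))))
        (↔-to-injective (PlaneIndex-↔ t) (proj₁ (locate i)) (proj₁ (locate j)) (≡.cong proj₁ eq))
        (≡.cong (proj₁ ∘ proj₂) eq) (≡.cong (proj₂ ∘ proj₂) eq)
      where
      same : ∀ {x e k x′ e′ k′} → Located i x e k → Located j x′ e′ k′ → x ≡ x′ → e ≡ e′ → k ≡ k′ → i ≡ j
      same {x} {e} {k} i∼ j∼ refl refl refl = D.column-inj {i} {j}
        (∝-trans {v = proj₁ (iso x e (normalPoint k))} i∼ (∝-sym (proj₂ (D.column j)) j∼))

-- Numerical form of the parameters and the final statement

open import Data.Nat.Primality using (prime⇒nonTrivial)
open import Data.Rational.Unnormalised.Base using (_≃_; _≥_; _*_; _-_; _/_; *≡*; *≤*)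

private
  2≤primePower : ∀ {q} → IsPrimePower q → 2 ℕ.≤ q
  2≤primePower (p , suc e , p-prime , _ , refl) = ℕ.≤-trans 2≤p
    (ℕ.m≤m*n p (p ℕ.^ e) {{ℕ.m^n≢0 p e {{ℕ.>-nonZero (ℕ.≤-trans (s≤s z≤n) 2≤p)}}}})
    where
    2≤p : 2 ℕ.≤ p
    2≤p = ℕ.nonTrivial⇒n>1 p {{prime⇒nonTrivial p-prime}}

  2≤root : ∀ {q} s → q ≡ s ℕ.^ 2 → 2 ℕ.≤ q → 2 ℕ.≤ s
  2≤root 0 refl ()
  2≤root 1 refl (s≤s ())
  2≤root (suc (suc s)) _ _ = s≤s (s≤s z≤n)

  -- The length 2t²(q + √q + 1) rewritten by k = 3t and cleared of the denominator 9.
  length-arithmetic : ∀ q s t → q ≡ s ℕ.^ 2 →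
    (t ℕ.* t) ℕ.* (2 ℕ.* (s ℕ.^ 2 ℕ.+ (s ℕ.^ 1 ℕ.+ (s ℕ.^ 0 ℕ.+ 0)))) ℕ.* 9 ≡
    (q ℕ.+ s ℕ.+ 1) ℕ.* (2 ℕ.* (3 ℕ.* t) ℕ.^ 2)
  length-arithmetic q s t refl = lemma s t
    where
    lemma : ∀ s t → (t ℕ.* t) ℕ.* (2 ℕ.* (s ℕ.* (s ℕ.* 1) ℕ.+ (s ℕ.* 1 ℕ.+ (1 ℕ.+ 0)))) ℕ.* 9 ≡
      (s ℕ.* (s ℕ.* 1) ℕ.+ s ℕ.+ 1) ℕ.* (2 ℕ.* ((3 ℕ.* t) ℕ.* ((3 ℕ.* t) ℕ.* 1)))
    lemma = solve-∀

  length-≃ : ∀ n A B → n ℕ.* 9 ≡ A ℕ.* B → + n / 1 ≃ (+ A / 1) * (+ B / 9)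
  length-≃ n A B eq = *≡* (≡.trans (≡.sym (ℤ.pos-* n 9)) (≡.trans (≡.cong +_ eq)
    (≡.trans (ℤ.pos-* A B) (≡.sym (ℤ.*-identityʳ (+ A ℤ.* + B))))))

  -- The factor `12 * t′ + 6` is 4k - 6 for k = 3(t′ + 1), so both sides are three times 2q(2t - 1).
  weight-arithmetic : ∀ q s t′ → q ≡ s ℕ.^ 2 →
    q ℕ.* (12 ℕ.* t′ ℕ.+ 6) ≡ (1 ℕ.+ t′ ℕ.* 2) ℕ.* (2 ℕ.* s ℕ.^ 2) ℕ.* 3
  weight-arithmetic q s t′ refl = lemma s t′
    where
    lemma : ∀ s t′ → s ℕ.* (s ℕ.* 1) ℕ.* (12 ℕ.* t′ ℕ.+ 6) ≡
      (1 ℕ.+ t′ ℕ.* 2) ℕ.* (2 ℕ.* (s ℕ.* (s ℕ.* 1))) ℕ.* 3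
    lemma = solve-∀

  4k≡ : ∀ t′ → 4 ℕ.* (3 ℕ.* suc t′) ≡ 6 ℕ.+ (12 ℕ.* t′ ℕ.+ 6)
  4k≡ t′ = lemma t′
    where
    lemma : ∀ t′ → 4 ℕ.* (3 ℕ.* (1 ℕ.+ t′)) ≡ 6 ℕ.+ (12 ℕ.* t′ ℕ.+ 6)
    lemma = solve-∀

  distance-≥ : ∀ d q k m → 4 ℕ.* k ≡ 6 ℕ.+ m → q ℕ.* m ℕ.≤ d ℕ.* 3 →
               + d / 1 ≥ (+ q / 1) * ((+ 4 / 3) * (+ k / 1) - (+ 2 / 1))
  distance-≥ d q k m 4k≡6+m qm≤3d = *≤* (≡.subst₂ ℤ._≤_ (≡.sym lhs) (ℤ.pos-* d 3) (ℤ.+≤+ qm≤3d))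
    where
    -- The numerator of (4/3)k - 2 as the unnormalised operations build it over the denominator 3;
    -- `-[1+ 1 ]` is -2 and `-[1+ 5 ]` is -6.
    difference : + 4 ℤ.* + k ℤ.* + 1 ℤ.+ -[1+ 1 ] ℤ.* + 3 ≡ + m
    difference = ≡.trans (≡.cong (ℤ._+ -[1+ 5 ]) (≡.trans (ℤ.*-identityʳ (+ 4 ℤ.* + k))
      (≡.trans (≡.sym (ℤ.pos-* 4 k)) (≡.cong +_ 4k≡6+m)))) refl
    lhs : + q ℤ.* (+ 4 ℤ.* + k ℤ.* + 1 ℤ.+ -[1+ 1 ] ℤ.* + 3) ℤ.* + 1 ≡ + (q ℕ.* m)
    lhs = ≡.trans (ℤ.*-identityʳ _) (≡.trans (≡.cong (+ q ℤ.*_) difference) (≡.sym (ℤ.pos-* q m)))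

proposition4p14 : ∀ {c ℓ c′ ℓ′ c₀ ℓ₀ b : Level} (q √q t k : ℕ) →
    IsPrimePower q → q ≡ √q ℕ.^ 2 → 1 ℕ.≤ t → k ≡ 3 ℕ.* t →
    (F : FiniteField q c ℓ) (K : FiniteField (q ℕ.^ 3) c′ ℓ′) (F₀ : FiniteField √q c₀ ℓ₀) →
    (D : Construction F K F₀ t b) →
    ∃ λ (d : ℕ) →
    Code.IsCode F (Construction.n D) k d (Construction.𝒟 D) ×
    Code.IsMinimalCode F (Construction.𝒟 D) ×
    (+ Construction.n D / 1 ≃ (+ (q ℕ.+ √q ℕ.+ 1) / 1) * (+ (2 ℕ.* k ℕ.^ 2) / 9)) ×
    (+ d / 1 ≥ (+ q / 1) * ((+ 4 / 3) * (+ k / 1) - (+ 2 / 1)))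
proposition4p14 q √q (suc t′) k q-primePower q≡√q² 1≤t refl F K F₀ D =
  fromMinimumWeight W.minimum-weight
  where
  2≤q : 2 ℕ.≤ q
  2≤q = 2≤primePower q-primePower
  2≤√q : 2 ℕ.≤ √q
  2≤√q = 2≤root √q q≡√q² 2≤q
  module W = ConstructionWeight F K F₀ q≡√q² 2≤q 2≤√q D
  module M = ConstructionMinimality F K F₀ q≡√q² 2≤q 2≤√q D
  module R = RowSpaceProperties F
  fromMinimumWeight : (∃ λ d → Code.HasMinimumWeight F (Construction.𝒟 D) d ×
                               (1 ℕ.+ t′ ℕ.* 2) ℕ.* (2 ℕ.* √q ℕ.^ 2) ℕ.≤ d) → _
  fromMinimumWeight (d , minimum , bound≤d) = d ,
    record
      { isSubspace    = R.rowSpace-isSubspace M.generatorMatrix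
      -- The dimension is given as 3t, whereas the generator matrix has `t * 3` rows.
      ; dimension     = R.independent⇒dimension M.generatorMatrix M.independent (ℕ.*-comm 3 (suc t′))
      ; minimumWeight = minimum
      } ,
    M.isMinimalCode ,
    length-≃ (Construction.n D) (q ℕ.+ √q ℕ.+ 1) (2 ℕ.* (3 ℕ.* suc t′) ℕ.^ 2)
      (≡.trans (≡.cong (ℕ._* 9) W.length-≡) (length-arithmetic q √q (suc t′) q≡√q²)) ,
    distance-≥ d q (3 ℕ.* suc t′) (12 ℕ.* t′ ℕ.+ 6) (4k≡ t′)
      (ℕ.≤-trans (ℕ.≤-reflexive (weight-arithmetic q √q t′ q≡√q²)) (ℕ.*-monoˡ-≤ 3 bound≤d))
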